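{- For all integers $n\ge 0$ and all $B \in \{28, 94, 182, 204, 226\}$, $b_{11}(242n+B) \equiv 0 \pmod 2$.
   Context: $b_{11}(n)$ denotes the number of partitions of $n$ none of whose parts is divisible by $11$; equivalently $\sum_{n\ge0} b_{11}(n)q^n = \prod_{i\ge1}(1-q^{11i})/(1-q^i)$. -}

module Defs where

open import Data.Nat using (ℕ; zero; suc; _+_; _*_; _∸_; _≤ᵇ_; _%_)
open import Data.Bool using (Bool; true; false; if_then_else_)
open import Data.Nat using (_≡ᵇ_)

-- A partition of n is a multiset of positive parts summing to n.
-- parts k n : number of partitions of n all of whose parts are ≤ k
-- and none of whose parts is divisible by 11.
-- For part size k we sum over the multiplicity m of k (m * k ≤ n).

mutual
  parts : ℕ → ℕ → ℕ
  parts zero n = if n ≡ᵇ 0 then 1 else 0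
  parts (suc k) n =
    if (suc k) % 11 ≡ᵇ 0
    then parts k n
    else multSum k n (suc n)

  multSum : ℕ → ℕ → ℕ → ℕ
  multSum k n zero = 0
  multSum k n (suc c) =
    multSum k n c
    + (if c * suc k ≤ᵇ n then parts k (n ∸ c * suc k) else 0)

-- b₁₁ n : number of partitions of n none of whose parts is divisible by 11
-- (parts of a partition of n are at most n).
b₁₁ : ℕ → ℕ
b₁₁ n = parts n n

{-# OPTIONS --safe #-}
module Submission where

-- In 𝔽₂⟦q⟧ put f = ∏ (1 - qⁿ), f₁₁ = f(q¹¹) and g = f f₁₁ = E² + q O², so that ∑ b₁₁(n) qⁿ = f₁₁ / f.
-- Let H = ∑ b₁₁(22 m + 6) qᵐ.  The theorem follows from f₁₁ H = O: by the pentagonal number theorem the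
-- coefficient of qᵏ in O counts solutions of x² + 11 y² = 12 (4 k + 3), so it vanishes when 4 k + 3 is not
-- a square modulo 11, i.e. for k = 1, 4, 8, 9, 10 modulo 11, and dividing by a series in q¹¹ preserves this.
--
-- By the Jacobi triple product f₁₁ / f times f(q²²)⁵ is a product of five theta series.  Its exponents
-- 22 m + 6 come from a coset of a lattice, and a neighbour of that lattice is ℤ⁵; so f⁵ H counts the z in ℤ⁵
-- with |z|² = 2 m + 1 and v·z = 1 modulo 11, where v = (1, 4, 5, -2, 3).  Rotating coordinates multiplies
-- v·z by 4, hence modulo 2 this is the number of all z up to sign minus that of the z with 11 ∣ v·z.
-- Involutions reduce the two counts to f¹² and q (g E)².  Counting a binary form in two ways yields
-- f¹² + q⁵ f₁₁¹² = g + q g³, and this turns f⁵ H = f¹² + q (g E)² into f₁₁ H = O.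

open import Defs
open import Algebra.Bundles using (AbelianGroup; CommutativeRing)
open import Algebra.Solver.Ring.AlmostCommutativeRing
open import Data.Bool using (Bool; true; false; not; _∧_; _xor_; if_then_else_)
open import Data.Bool.Properties
  using (xor-assoc; xor-comm; xor-same; xor-identityʳ; xor-∧-commutativeRing; not-distribˡ-xor;
         not-involutive; T-≡; ∧-comm; ∧-assoc; ∧-idem; ∧-distribʳ-xor; ∧-distribˡ-xor; ∧-zeroʳ; ∧-identityʳ)
  renaming (_≟_ to _≟ᵇ_)
open import Data.Fin as Fin using (Fin; zero; suc; toℕ; fromℕ<)
import Data.Fin.Properties as Fin
open import Data.Integer as ℤ using (ℤ; +_; -[1+_]; _⊖_; ∣_∣; NonZero; +≤+)
import Data.Integer.Properties as ℤ
open import Data.Integer.DivMod using (_%ℕ_; _/ℕ_; a≡a%ℕn+[a/ℕn]*n; n%ℕd<d)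
import Data.Integer.Divisibility.Signed as ℤ
open import Data.List as List using (List; []; _∷_; _++_; length; map; filter; cartesianProduct;
    cartesianProductWith; deduplicate; allFin)
import Data.List.Properties as List
import Data.List.Membership.Setoid as Membership
import Data.List.Membership.Setoid.Properties as Membershipₚ
open import Data.List.Membership.Propositional using () renaming (_∈_ to _∈ₚ_)
import Data.List.Membership.Propositional.Properties as ∈
open import Data.List.Relation.Unary.All as All using (All; []; _∷_)
import Data.List.Relation.Unary.All.Properties as All
open import Data.List.Relation.Unary.AllPairs using ([]; _∷_)
open import Data.List.Relation.Unary.Any as Any using (here; there)
import Data.List.Relation.Unary.Any.Properties as Any
import Data.List.Relation.Unary.Unique.Setoid as Unique
import Data.List.Relation.Unary.Unique.Setoid.Properties as Uniqueₚ
open import Data.List.Relation.Unary.Unique.DecSetoid.Properties using (deduplicate-!)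
open import Data.List.Relation.Unary.Unique.Propositional.Properties using (allFin⁺)
open import Data.Maybe using (Maybe; just; nothing)
open import Data.Nat as ℕ using (ℕ; zero; suc; pred; z≤n; s≤s; s≤s⁻¹; z<s; _≤ᵇ_; _≡ᵇ_; _∸_; _%_)
import Data.Nat.DivMod as ℕ
import Data.Nat.Divisibility as ℕ
import Data.Nat.Properties as ℕ
open import Data.Product using (_×_; _,_; proj₁; proj₂; ∃; ∃₂)
open import Data.Product.Relation.Binary.Pointwise.NonDependent using (×-decSetoid)
open import Data.Sum using (_⊎_; inj₁; inj₂; [_,_]′)
open import Data.Unit using (⊤; tt)
open import Data.Vec as Vec using (Vec; []; _∷_)
import Data.Vec.Properties as Vec
open import Data.Vec.Relation.Unary.All as VecAll using ([]; _∷_)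
open import Function using (_∘_)
open import Function.Bundles using (Equivalence)
open import Level using (0ℓ)
open import Relation.Binary using (DecSetoid)
open import Relation.Binary.PropositionalEquality
  using (_≡_; _≢_; refl; sym; trans; cong; cong₂; subst; subst₂; module ≡-Reasoning)
  renaming (decSetoid to ≡-decSetoid)
open import Relation.Nullary using (Dec; yes; no; ¬_; ¬?; contradiction)
open import Relation.Nullary.Decidable using (_⊎-dec_; _×-dec_; _→-dec_; from-no; from-yes)

-- The factor f(q²²)⁵ is harmless because a series in q²² passes through the extraction of the
-- exponents 22 m + 6. It is suggested by the product for f₁₁ / f: the odd residues modulo 22 other
-- than 11 form five pairs a, 22 - a, with one theta series for each. The entries of v are the
-- nonzero squares modulo 11, ordered so that each is 4 times the one before it. Hence v is
-- isotropic modulo 11, which makes a neighbouring lattice possible, and the five rotations, an odd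
-- number, carry the class v·z = 1 to every nonzero class up to sign without changing the parity of
-- a count. Counts are taken up to sign because the number of nonzero vectors of a given norm is
-- always even. In dimension five the norm 2 m + 1 is odd, which prevents the involutions from
-- sending a vector to its negative; such vectors would form a second kind of fixed class. The end
-- of the proof is linear algebra: comparing two dissections of g gives two linear relations between
-- E and O whose determinant 1 + q g² is a unit, so the last identity may be checked after
-- multiplication by it.

module PowerSeries where

  open import Data.Nat.Tactic.RingSolver using (solve-∀)
  open import Data.Nat using (_≤_; _<_)

  -- Power series over the field with two elements.

  Series : Set
  Series = ℕ → Bool

  infix 4 _≈_
  -- A record, so that both series can be inferred from the type of a proof; a bare pointwise
  -- equality would unfold.
  record _≈_ (a b : Series) : Set where
    constructor mk
    field at : ∀ n → a n ≡ b n
  open _≈_ public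

  tl : Series → Series
  tl a n = a (suc n)

  infixl 6 _+_
  infixl 7 _*_

  _+_ : Series → Series → Series
  (a + b) n = a n xor b n

  -- The recursion a b = a₀ b + q (tl a) b. Ring laws become inductions on the index of the
  -- coefficient, with the first factor generalised.
  _*_ : Series → Series → Series
  (a * b) zero = a 0 ∧ b 0
  (a * b) (suc n) = (a 0 ∧ b (suc n)) xor (tl a * b) n

  const : Bool → Series
  const c zero = c
  const c (suc _) = false

  0# 1# : Series
  0# = const false
  1# = const true

  0#-at : ∀ n → 0# n ≡ false
  0#-at zero = refl
  0#-at (suc n) = refl

  xor-interchange : ∀ a b c d → (a xor b) xor (c xor d) ≡ (a xor c) xor (b xor d)
  xor-interchange a b c d = begin
    (a xor b) xor (c xor d) ≡⟨ xor-assoc a b _ ⟩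
    a xor (b xor (c xor d)) ≡⟨ cong (a xor_) (xor-assoc b c d) ⟨
    a xor ((b xor c) xor d) ≡⟨ cong (λ x → a xor (x xor d)) (xor-comm b c) ⟩
    a xor ((c xor b) xor d) ≡⟨ cong (a xor_) (xor-assoc c b d) ⟩
    a xor (c xor (b xor d)) ≡⟨ xor-assoc a c _ ⟨
    (a xor c) xor (b xor d) ∎
    where open ≡-Reasoning

  xor-leftComm : ∀ a b c → a xor (b xor c) ≡ b xor (a xor c)
  xor-leftComm a b c = trans (sym (xor-assoc a b c))
    (trans (cong (_xor c) (xor-comm a b)) (xor-assoc b a c))

  ≈-refl : ∀ {a} → a ≈ a
  ≈-refl = mk λ _ → refl
  reindex : ∀ {A : Set} (F : A → Series) {i j} → i ≡ j → F i ≈ F j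
  reindex F refl = ≈-refl
  ≈-sym : ∀ {a b} → a ≈ b → b ≈ a
  ≈-sym p = mk λ n → sym (at p n)
  ≈-trans : ∀ {a b c} → a ≈ b → b ≈ c → a ≈ c
  ≈-trans p q = mk λ n → trans (at p n) (at q n)

  *-cong-< : ∀ {a a' b b'} n → (∀ i → i ≤ n → a i ≡ a' i) → (∀ i → i ≤ n → b i ≡ b' i) →
             (a * b) n ≡ (a' * b') n
  *-cong-< zero p q = cong₂ _∧_ (p 0 z≤n) (q 0 z≤n)
  *-cong-< (suc n) p q = cong₂ _xor_ (cong₂ _∧_ (p 0 z≤n) (q (suc n) ℕ.≤-refl))
    (*-cong-< n (λ i i≤n → p (suc i) (s≤s i≤n)) (λ i i≤n → q i (ℕ.m≤n⇒m≤1+n i≤n)))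

  *-cong : ∀ {a a' b b'} → a ≈ a' → b ≈ b' → a * b ≈ a' * b'
  *-cong p q = mk λ n → *-cong-< n (λ i _ → at p i) (λ i _ → at q i)

  +-cong : ∀ {a a' b b'} → a ≈ a' → b ≈ b' → a + b ≈ a' + b'
  +-cong p q = mk λ n → cong₂ _xor_ (at p n) (at q n)

  *-distribʳ : ∀ c a b n → ((a + b) * c) n ≡ (a * c) n xor (b * c) n
  *-distribʳ c a b zero = ∧-distribʳ-xor (c 0) (a 0) (b 0)
  *-distribʳ c a b (suc n) = trans
    (cong₂ _xor_ (∧-distribʳ-xor (c (suc n)) (a 0) (b 0)) (*-distribʳ c (tl a) (tl b) n))
    (xor-interchange (a 0 ∧ c (suc n)) (b 0 ∧ c (suc n)) _ _)

  *-vanishing : ∀ a b n → (∀ i → a i ≡ false) → (a * b) n ≡ false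
  *-vanishing a b zero h = cong (_∧ b 0) (h 0)
  *-vanishing a b (suc n) h = cong₂ _xor_ (cong (_∧ b (suc n)) (h 0))
      (*-vanishing (tl a) b n (λ i → h (suc i)))

  *-sucʳ : ∀ a b n → (a * b) (suc n) ≡ (a (suc n) ∧ b 0) xor (a * tl b) n
  *-sucʳ a b zero = xor-comm (a 0 ∧ b 1) (a 1 ∧ b 0)
  *-sucʳ a b (suc n) = trans (cong ((a 0 ∧ b (suc (suc n))) xor_) (*-sucʳ (tl a) b n))
    (xor-leftComm (a 0 ∧ b (suc (suc n))) (a (suc (suc n)) ∧ b 0) _)

  *-comm : ∀ a b → a * b ≈ b * a
  *-comm a b = mk (go a b)
    where
    go : ∀ a b n → (a * b) n ≡ (b * a) n
    go a b zero = ∧-comm (a 0) (b 0)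
    go a b (suc n) = trans
      (cong₂ _xor_ (∧-comm (a 0) (b (suc n))) (go (tl a) b n)) (sym (*-sucʳ b a n))

  *-scale : ∀ c a b n → ((λ k → c ∧ a k) * b) n ≡ c ∧ (a * b) n
  *-scale c a b zero = ∧-assoc c (a 0) (b 0)
  *-scale c a b (suc n) = trans
    (cong₂ _xor_ (∧-assoc c (a 0) (b (suc n))) (*-scale c (tl a) b n))
    (sym (∧-distribˡ-xor c _ _))

  *-assoc : ∀ a b c → (a * b) * c ≈ a * (b * c)
  *-assoc a b c = mk (go a)
    where
    go : ∀ a n → ((a * b) * c) n ≡ (a * (b * c)) n
    go a zero = ∧-assoc (a 0) (b 0) (c 0)
    go a (suc n) = begin
      ((a 0 ∧ b 0) ∧ c (suc n)) xor (tl (a * b) * c) n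
        ≡⟨ cong₂ _xor_ (∧-assoc (a 0) (b 0) (c (suc n)))
             (*-distribʳ c (λ k → a 0 ∧ b (suc k)) (tl a * b) n) ⟩
      (a 0 ∧ (b 0 ∧ c (suc n))) xor (((λ k → a 0 ∧ tl b k) * c) n xor ((tl a * b) * c) n)
        ≡⟨ cong (λ x → (a 0 ∧ (b 0 ∧ c (suc n))) xor (x xor ((tl a * b) * c) n))
             (*-scale (a 0) (tl b) c n) ⟩
      (a 0 ∧ (b 0 ∧ c (suc n))) xor ((a 0 ∧ (tl b * c) n) xor ((tl a * b) * c) n)
        ≡⟨ xor-assoc (a 0 ∧ (b 0 ∧ c (suc n))) _ _ ⟨
      ((a 0 ∧ (b 0 ∧ c (suc n))) xor (a 0 ∧ (tl b * c) n)) xor ((tl a * b) * c) n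
        ≡⟨ cong₂ _xor_ (sym (∧-distribˡ-xor (a 0) _ _)) (go (tl a) n) ⟩
      (a 0 ∧ (b * c) (suc n)) xor (tl a * (b * c)) n ∎
      where open ≡-Reasoning

  *-identityˡ : ∀ b → 1# * b ≈ b
  *-identityˡ b = mk go
    where
    go : ∀ n → (1# * b) n ≡ b n
    go zero = refl
    go (suc n) = trans (cong (b (suc n) xor_) (*-vanishing (tl 1#) b n λ _ → refl)) (xor-identityʳ _)

  +-identityˡ : ∀ a → 0# + a ≈ a
  +-identityˡ a = mk λ { zero → refl ; (suc n) → refl }

  +-self : ∀ a → a + a ≈ 0#
  +-self a = mk λ { zero → xor-same (a 0) ; (suc n) → xor-same (a (suc n)) }

  𝔽₂⟦q⟧ : CommutativeRing 0ℓ 0ℓ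
  𝔽₂⟦q⟧ = record
    { Carrier = Series ; _≈_ = _≈_ ; _+_ = _+_ ; _*_ = _*_ ; -_ = λ a → a ; 0# = 0# ; 1# = 1#
    ; isCommutativeRing = record
      { isRing = record
        { +-isAbelianGroup = record
          { isGroup = record
            { isMonoid = record
              { isSemigroup = record
                { isMagma = record
                  { isEquivalence = record { refl = ≈-refl ; sym = ≈-sym ; trans = ≈-trans }
                  ; ∙-cong = +-cong }
                ; assoc = λ a b c → mk λ n → xor-assoc (a n) (b n) (c n) }
              ; identity = +-identityˡ , λ a → ≈-trans (mk λ n → xor-comm (a n) (0# n)) (+-identityˡ a) }
            ; inverse = +-self , +-self
            ; ⁻¹-cong = λ p → p }
          ; comm = λ a b → mk λ n → xor-comm (a n) (b n) }
        ; *-cong = *-cong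
        ; *-assoc = *-assoc
        ; *-identity = *-identityˡ , λ b → ≈-trans (*-comm b 1#) (*-identityˡ b)
        ; distrib = (λ c a b → ≈-trans (*-comm c (a + b)) (≈-trans (mk (*-distribʳ c a b))
                      (+-cong (*-comm a c) (*-comm b c))))
                  , λ c a b → mk (*-distribʳ c a b) }
      ; *-comm = *-comm } }

  ACR : AlmostCommutativeRing 0ℓ 0ℓ
  ACR = fromCommutativeRing 𝔽₂⟦q⟧

  const-* : ∀ c d → const (c ∧ d) ≈ const c * const d
  const-* c d = mk λ where
    zero → refl
    (suc n) → sym (trans (cong (_xor (tl (const c) * const d) n) (∧-zeroʳ c))
        (*-vanishing (tl (const c)) (const d) n λ _ → refl))

  constant-morphism : CommutativeRing.rawRing xor-∧-commutativeRing -Raw-AlmostCommutative⟶ ACR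
  constant-morphism = record
    { ⟦_⟧ = const
    ; +-homo = λ c d → mk λ { zero → refl ; (suc n) → refl }
    ; *-homo = const-*
    ; -‿homo = λ c → ≈-refl
    ; 0-homo = ≈-refl
    ; 1-homo = ≈-refl }

  ≟-const : ∀ c d → Maybe (const c ≈ const d)
  ≟-const c d with c ≟ᵇ d
  ... | yes refl = just ≈-refl
  ... | no _ = nothing

  -- Coefficients in 𝔽₂ let the solver use x + x = 0.
  open import Algebra.Solver.Ring (CommutativeRing.rawRing xor-∧-commutativeRing) ACR
    constant-morphism ≟-const public using (solve; con; _:+_; _:*_; _:=_)
  module ≈-Reasoning where
    open import Relation.Binary.Reasoning.Setoid (CommutativeRing.setoid 𝔽₂⟦q⟧) public
      using (begin_; _∎; step-≈-⟩; step-≈-⟨)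

  open CommutativeRing 𝔽₂⟦q⟧ public
    using (*-congˡ; *-congʳ; +-identityʳ; zeroˡ; zeroʳ; *-identityʳ)

  -- Monomials, dilation, arithmetic progressions of exponents, and 2-dissection.

  sh : Series → Series
  sh a zero = false
  sh a (suc n) = a n

  X : ℕ → Series
  X zero = 1#
  X (suc n) = sh (X n)

  q : Series
  q = X 1

  sh-cong : ∀ {a b} → a ≈ b → sh a ≈ sh b
  sh-cong p = mk λ { zero → refl ; (suc n) → at p n }

  sh-* : ∀ a b → sh a * b ≈ sh (a * b)
  sh-* a b = mk λ { zero → refl ; (suc n) → refl }

  X-+ : ∀ m n → X (m ℕ.+ n) ≈ X m * X n
  X-+ zero n = ≈-sym (*-identityˡ (X n))
  X-+ (suc m) n = ≈-trans (sh-cong (X-+ m n)) (≈-sym (sh-* (X m) (X n)))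

  X*-at : ∀ c a k → (X c * a) (c ℕ.+ k) ≡ a k
  X*-at zero a k = at (*-identityˡ a) k
  X*-at (suc c) a k = trans (at (sh-* (X c) a) (suc c ℕ.+ k)) (X*-at c a k)

  X*-below : ∀ c a k → k < c → (X c * a) k ≡ false
  X*-below (suc c) a zero _ = refl
  X*-below (suc c) a (suc k) (s≤s k<c) = X*-below c a k k<c

  -- interleave a m c places the coefficients of a at c, c + (m + 1), c + 2 (m + 1), …
  interleave : Series → ℕ → ℕ → Series
  interleave a m zero zero = a 0
  interleave a m zero (suc n) = interleave (tl a) m m n
  interleave a m (suc c) zero = false
  interleave a m (suc c) (suc n) = interleave a m c n

  -- a (q ^ m), for m > 0
  dilate : ℕ → Series → Series
  dilate m a = interleave a (pred m) 0

  slice : ℕ → ℕ → Series → Series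
  slice m r a n = a (n ℕ.* m ℕ.+ r)

  interleave-X : ∀ a m c → interleave a m c ≈ X c * interleave a m 0
  interleave-X a m zero = ≈-sym (*-identityˡ _)
  interleave-X a m (suc c) = ≈-trans
    (mk λ { zero → refl ; (suc n) → refl })
    (≈-trans (sh-cong (interleave-X a m c)) (≈-sym (sh-* (X c) _)))

  dilate-unfold : ∀ m a → dilate (suc m) a ≈ const (a 0) + X (suc m) * dilate (suc m) (tl a)
  dilate-unfold m a = mk λ where
    zero → sym (xor-identityʳ (a 0))
    (suc n) → trans (at (interleave-X (tl a) m m) n) refl

  interleave-cong : ∀ {a b} m c n → a ≈ b → interleave a m c n ≡ interleave b m c n
  interleave-cong m zero zero p = at p 0
  interleave-cong m zero (suc n) p = interleave-cong m m n (mk λ k → at p (suc k))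
  interleave-cong m (suc c) zero p = refl
  interleave-cong m (suc c) (suc n) p = interleave-cong m c n p

  dilate-cong : ∀ m {a b} → a ≈ b → dilate m a ≈ dilate m b
  dilate-cong m p = mk λ n → interleave-cong (pred m) 0 n p

  dilate-+ : ∀ m a b → dilate m (a + b) ≈ dilate m a + dilate m b
  dilate-+ m a b = mk (go a b 0)
    where
    go : ∀ a b c n → interleave (a + b) (pred m) c n ≡ interleave a (pred m) c n xor interleave b
        (pred m) c n
    go a b zero zero = refl
    go a b zero (suc n) = go (tl a) (tl b) (pred m) n
    go a b (suc c) zero = refl
    go a b (suc c) (suc n) = go a b c n

  const-*-at : ∀ c a n → (const c * a) n ≡ c ∧ a n
  const-*-at c a zero = refl
  const-*-at c a (suc n) = trans (cong ((c ∧ a (suc n)) xor_) (*-vanishing (tl (const c)) a n λ _ → refl))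
      (xor-identityʳ _)

  -- A series in the power of q that is sliced can be pulled out. Peeling off the constant term of
  -- `h` leaves a shift by `suc m`, which moves the slice by one index; at index 0 the shifted part
  -- has not begun, because `r < suc m`.
  slice-dilate-* : ∀ m r → r < suc m → ∀ h a →
                   slice (suc m) r (dilate (suc m) h * a) ≈ h * slice (suc m) r a
  slice-dilate-* m r r≤m h a = mk (go h)
    where
    unfold : ∀ h k → (dilate (suc m) h * a) k ≡
             (h 0 ∧ a k) xor (X (suc m) * (dilate (suc m) (tl h) * a)) k
    unfold h k = begin
      (dilate (suc m) h * a) k
        ≡⟨ at (*-cong (dilate-unfold m h) ≈-refl) k ⟩
      ((const (h 0) + X (suc m) * dilate (suc m) (tl h)) * a) k
        ≡⟨ *-distribʳ a (const (h 0)) _ k ⟩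
      (const (h 0) * a) k xor ((X (suc m) * dilate (suc m) (tl h)) * a) k
        ≡⟨ cong₂ _xor_ (const-*-at (h 0) a k) (at (*-assoc (X (suc m)) _ a) k) ⟩
      (h 0 ∧ a k) xor (X (suc m) * (dilate (suc m) (tl h) * a)) k ∎
      where open ≡-Reasoning
    go : ∀ h n → (dilate (suc m) h * a) (n ℕ.* suc m ℕ.+ r) ≡ (h * slice (suc m) r a) n
    go h zero = trans (unfold h r)
      (trans (cong ((h 0 ∧ a r) xor_) (X*-below (suc m) _ r r≤m)) (xor-identityʳ _))
    go h (suc n) = trans (unfold h (suc n ℕ.* suc m ℕ.+ r)) (cong ((h 0 ∧ _) xor_) (trans
      (trans (cong (X (suc m) * (dilate (suc m) (tl h) * a)) (ℕ.+-assoc (suc m) (n ℕ.* suc m) r))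
             (X*-at (suc m) _ (n ℕ.* suc m ℕ.+ r)))
      (go (tl h) n)))

  slice-1₀ : ∀ m → slice (suc m) 0 1# ≈ 1#
  slice-1₀ m = mk λ { zero → refl ; (suc n) → refl }

  slice-1₊ : ∀ m r → slice (suc m) (suc r) 1# ≈ 0#
  slice-1₊ m r = mk λ { zero → refl ; (suc n) → refl }

  slice-cong : ∀ m r {a b} → a ≈ b → slice m r a ≈ slice m r b
  slice-cong m r p = mk λ n → at p (n ℕ.* m ℕ.+ r)

  slice-dilate₀ : ∀ m h → slice (suc m) 0 (dilate (suc m) h) ≈ h
  slice-dilate₀ m h = begin
    slice (suc m) 0 (dilate (suc m) h)       ≈⟨ slice-cong (suc m) 0 (≈-sym (*-identityʳ _)) ⟩
    slice (suc m) 0 (dilate (suc m) h * 1#)  ≈⟨ slice-dilate-* m 0 z<s h 1# ⟩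
    h * slice (suc m) 0 1#                   ≈⟨ *-congˡ (slice-1₀ m) ⟩
    h * 1#                                   ≈⟨ *-identityʳ h ⟩
    h ∎
    where open ≈-Reasoning

  slice-dilate₊ : ∀ m r → suc r < suc m → ∀ h → slice (suc m) (suc r) (dilate (suc m) h) ≈ 0#
  slice-dilate₊ m r r<m h = begin
    slice (suc m) (suc r) (dilate (suc m) h)       ≈⟨ slice-cong (suc m) (suc r) (≈-sym (*-identityʳ _)) ⟩
    slice (suc m) (suc r) (dilate (suc m) h * 1#)  ≈⟨ slice-dilate-* m (suc r) r<m h 1# ⟩
    h * slice (suc m) (suc r) 1#                   ≈⟨ *-congˡ (slice-1₊ m r) ⟩
    h * 0#                                         ≈⟨ zeroʳ h ⟩
    0# ∎
    where open ≈-Reasoning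

  -- With this, identities about `dilate` such as its multiplicativity follow from `slice-dilate-*`,
  -- one residue class at a time.
  slices-≈ : ∀ m {a b} → (∀ r → r < suc m → slice (suc m) r a ≈ slice (suc m) r b) → a ≈ b
  slices-≈ m {a} {b} p = mk λ n → trans (cong a (eq n))
    (trans (at (p (n ℕ.% suc m) (ℕ.m%n<n n (suc m))) (n ℕ./ suc m)) (sym (cong b (eq n))))
    where
    eq : ∀ n → n ≡ n ℕ./ suc m ℕ.* suc m ℕ.+ n ℕ.% suc m
    eq n = trans (ℕ.m≡m%n+[m/n]*n n (suc m)) (ℕ.+-comm (n ℕ.% suc m) _)

  dilate-* : ∀ m a b → dilate (suc m) (a * b) ≈ dilate (suc m) a * dilate (suc m) b
  dilate-* m a b = slices-≈ m λ { zero → eq₀ ; (suc r) → eq₊ r }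
    where
    open ≈-Reasoning
    eq₀ : 0 < suc m → slice (suc m) 0 (dilate (suc m) (a * b)) ≈ slice (suc m) 0
        (dilate (suc m) a * dilate (suc m) b)
    eq₀ r<m = begin
      slice (suc m) 0 (dilate (suc m) (a * b))              ≈⟨ slice-dilate₀ m (a * b) ⟩
      a * b                                                 ≈⟨ *-congˡ (slice-dilate₀ m b) ⟨
      a * slice (suc m) 0 (dilate (suc m) b)                ≈⟨ slice-dilate-* m 0 r<m a _ ⟨
      slice (suc m) 0 (dilate (suc m) a * dilate (suc m) b) ∎
    eq₊ : ∀ r → suc r < suc m →
          slice (suc m) (suc r) (dilate (suc m) (a * b)) ≈ slice (suc m) (suc r)
              (dilate (suc m) a * dilate (suc m) b)
    eq₊ r r<m = begin
      slice (suc m) (suc r) (dilate (suc m) (a * b))              ≈⟨ slice-dilate₊ m r r<m (a * b) ⟩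
      0#                                                          ≈⟨ zeroʳ a ⟨
      a * 0#                                                      ≈⟨ *-congˡ (slice-dilate₊ m r r<m b) ⟨
      a * slice (suc m) (suc r) (dilate (suc m) b)                ≈⟨ slice-dilate-* m (suc r) r<m a _ ⟨
      slice (suc m) (suc r) (dilate (suc m) a * dilate (suc m) b) ∎

  head-tail : ∀ a → a ≈ const (a 0) + sh (tl a)
  head-tail a = mk λ { zero → sym (xor-identityʳ (a 0)) ; (suc n) → refl }

  -- The cross terms cancel in characteristic 2, so a² = a₀² + q² (tl a)², which is the recursion
  -- that defines the dilation.
  frobenius : ∀ a → a * a ≈ dilate 2 a
  frobenius a = mk (go a)
    where
    step : ∀ a → a * a ≈ const (a 0) * const (a 0) + sh (sh (tl a * tl a))
    step a = begin
      a * a ≈⟨ *-cong (head-tail a) (head-tail a) ⟩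
      (c + s) * (c + s) ≈⟨ solve 2 (λ c s → (c :+ s) :* (c :+ s) := c :* c :+ s :* s) ≈-refl c s ⟩
      c * c + s * s ≈⟨ +-cong {c * c} ≈-refl (≈-trans (sh-* (tl a) s)
                         (sh-cong (≈-trans (*-comm (tl a) s) (sh-* (tl a) (tl a))))) ⟩
      c * c + sh (sh (tl a * tl a)) ∎
      where
      open ≈-Reasoning
      c = const (a 0)
      s = sh (tl a)
    go : ∀ a n → (a * a) n ≡ dilate 2 a n
    go a zero = ∧-idem (a 0)
    go a (suc zero) = trans (cong ((a 0 ∧ a 1) xor_) (∧-comm (a 1) (a 0))) (xor-same (a 0 ∧ a 1))
    go a (suc (suc n)) = trans (at (step a) (suc (suc n)))
      (trans (cong (_xor (tl a * tl a) n) (trans (const-*-at (a 0) (const (a 0)) (suc (suc n)))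
          (∧-zeroʳ (a 0))))
        (go (tl a) n))

  ev od : Series → Series
  ev = slice 2 0
  od = slice 2 1

  ev-cong : ∀ {a b} → a ≈ b → ev a ≈ ev b
  ev-cong = slice-cong 2 0
  od-cong : ∀ {a b} → a ≈ b → od a ≈ od b
  od-cong = slice-cong 2 1

  private
    dissected : ∀ a b → a * a + q * (b * b) ≈ dilate 2 a * 1# + dilate 2 b * q
    dissected a b = +-cong (≈-trans (frobenius a) (≈-sym (*-identityʳ _)))
      (≈-trans (*-comm q _) (*-congʳ (frobenius b)))

  -- Together with `od-dissect` this is uniqueness of the dissection: every way of writing a series
  -- as a² + q b² yields the same a and b.
  ev-dissect : ∀ a b → ev (a * a + q * (b * b)) ≈ a
  ev-dissect a b = begin
    ev (a * a + q * (b * b))                       ≈⟨ ev-cong (dissected a b) ⟩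
    ev (dilate 2 a * 1#) + ev (dilate 2 b * q)     ≈⟨ +-cong (slice-dilate-* 1 0 z<s a 1#)
        (slice-dilate-* 1 0 z<s b q) ⟩
    a * ev 1# + b * ev q                           ≈⟨ +-cong (*-congˡ (slice-1₀ 1)) (*-congˡ ev-q) ⟩
    a * 1# + b * 0#                                ≈⟨ solve 2
        (λ a b → a :* con true :+ b :* con false := a) ≈-refl a b ⟩
    a ∎
    where
    open ≈-Reasoning
    ev-q : ev q ≈ 0#
    ev-q = mk λ { zero → refl ; (suc n) → refl }

  od-dissect : ∀ a b → od (a * a + q * (b * b)) ≈ b
  od-dissect a b = begin
    od (a * a + q * (b * b))                       ≈⟨ od-cong (dissected a b) ⟩
    od (dilate 2 a * 1#) + od (dilate 2 b * q)     ≈⟨ +-cong (slice-dilate-* 1 1 ℕ.≤-refl a 1#)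
        (slice-dilate-* 1 1 ℕ.≤-refl b q) ⟩
    a * od 1# + b * od q                           ≈⟨ +-cong (*-congˡ (slice-1₊ 1 0)) (*-congˡ od-q) ⟩
    a * 0# + b * 1#                                ≈⟨ solve 2
        (λ a b → a :* con false :+ b :* con true := b) ≈-refl a b ⟩
    b ∎
    where
    open ≈-Reasoning
    od-q : od q ≈ 1#
    od-q = mk λ { zero → refl ; (suc n) → refl }

  dissect : ∀ a → a ≈ ev a * ev a + q * (od a * od a)
  dissect a = slices-≈ 1 λ where
    0 _ → ≈-sym (ev-dissect (ev a) (od a))
    1 _ → ≈-sym (od-dissect (ev a) (od a))
    (suc (suc r)) (s≤s (s≤s ()))

  -- Congruence modulo a power of q, and cancellation.

  infix 4 _≈[_]_
  -- Infinite products never occur; a finite product with enough factors stands for them modulo qⁿ.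
  record _≈[_]_ (a : Series) (n : ℕ) (b : Series) : Set where
    constructor mk[]
    field at[] : ∀ i → i < n → a i ≡ b i
  open _≈[_]_ public

  ≈⇒≈[] : ∀ {a b} n → a ≈ b → a ≈[ n ] b
  ≈⇒≈[] n p = mk[] λ i _ → at p i

  ≈[]⇒≈ : ∀ {a b} → (∀ n → a ≈[ n ] b) → a ≈ b
  ≈[]⇒≈ p = mk λ n → at[] (p (suc n)) n ℕ.≤-refl

  ≈[]-refl : ∀ {a n} → a ≈[ n ] a
  ≈[]-refl = mk[] λ _ _ → refl
  ≈[]-sym : ∀ {a b n} → a ≈[ n ] b → b ≈[ n ] a
  ≈[]-sym p = mk[] λ i i<n → sym (at[] p i i<n)
  ≈[]-trans : ∀ {a b c n} → a ≈[ n ] b → b ≈[ n ] c → a ≈[ n ] c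
  ≈[]-trans p r = mk[] λ i i<n → trans (at[] p i i<n) (at[] r i i<n)
  ≈[]-weaken : ∀ {a b m n} → m ≤ n → a ≈[ n ] b → a ≈[ m ] b
  ≈[]-weaken m≤n p = mk[] λ i i<m → at[] p i (ℕ.<-≤-trans i<m m≤n)

  +-cong[] : ∀ {a a' b b' n} → a ≈[ n ] a' → b ≈[ n ] b' → a + b ≈[ n ] a' + b'
  +-cong[] p r = mk[] λ i i<n → cong₂ _xor_ (at[] p i i<n) (at[] r i i<n)

  *-cong[] : ∀ {a a' b b' n} → a ≈[ n ] a' → b ≈[ n ] b' → a * b ≈[ n ] a' * b'
  *-cong[] p r = mk[] λ i i<n →
    *-cong-< i (λ j j≤i → at[] p j (ℕ.≤-<-trans j≤i i<n)) (λ j j≤i → at[] r j (ℕ.≤-<-trans j≤i i<n))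

  dilate-cong[] : ∀ m {a b n} → a ≈[ n ] b → dilate m a ≈[ n ] dilate m b
  dilate-cong[] m {n = n} p = mk[] λ i i<n → go 0 i (λ k k≤i → at[] p k (ℕ.≤-<-trans k≤i i<n))
    where
    go : ∀ {a b} c i → (∀ k → k ≤ i → a k ≡ b k) → interleave a (pred m) c i ≡ interleave b (pred m) c i
    go zero zero h = h 0 z≤n
    go zero (suc i) h = go (pred m) i (λ k k≤i → h (suc k) (s≤s k≤i))
    go (suc c) zero h = refl
    go (suc c) (suc i) h = go c i (λ k k≤i → h k (ℕ.m≤n⇒m≤1+n k≤i))

  X*-cong[] : ∀ c {a b n} → a ≈[ n ] b → X c * a ≈[ c ℕ.+ n ] X c * b
  X*-cong[] c {a} {b} {n} p = mk[] λ i i<c+n → go i i<c+n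
    where
    go : ∀ i → i < c ℕ.+ n → (X c * a) i ≡ (X c * b) i
    go i i<c+n with i ℕ.<? c
    ... | yes i<c = trans (X*-below c a i i<c) (sym (X*-below c b i i<c))
    ... | no i≮c with ℕ.m≤n⇒∃[o]m+o≡n (ℕ.≮⇒≥ i≮c)
    ...   | k , refl = trans (X*-at c a k) (trans (at[] p k (ℕ.+-cancelˡ-< c k n i<c+n))
        (sym (X*-at c b k)))

  X*-cancel[] : ∀ c {a b n} → X c * a ≈[ c ℕ.+ n ] X c * b → a ≈[ n ] b
  X*-cancel[] c {a} {b} p = mk[] λ i i<n →
    trans (sym (X*-at c a i)) (trans (at[] p (c ℕ.+ i) (ℕ.+-monoʳ-< c i<n)) (X*-at c b i))

  lowest-coefficient : ∀ d a n → (∀ i → i < n → d i ≡ false) → (d * a) n ≡ d n ∧ a 0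
  lowest-coefficient d a zero h = refl
  lowest-coefficient d a (suc n) h = trans
    (cong (λ x → (x ∧ a (suc n)) xor (tl d * a) n) (h 0 z<s))
    (lowest-coefficient (tl d) a n (λ i i<n → h (suc i) (s≤s i<n)))

  -- The lowest nonzero coefficient of b - c would survive multiplication by a series with constant
  -- term 1.
  *-cancelʳ[] : ∀ a {b c n} → a 0 ≡ true → b * a ≈[ n ] c * a → b ≈[ n ] c
  *-cancelʳ[] a {b} {c} {n} a₀ p = mk[] λ i i<n → xor-≡ (b i) (c i) (go n p i i<n)
    where
    xor-≡ : ∀ x y → x xor y ≡ false → x ≡ y
    xor-≡ false y eq = sym eq
    xor-≡ true true eq = refl
    go : ∀ n → b * a ≈[ n ] c * a → ∀ i → i < n → (b + c) i ≡ false
    go (suc n) p i i<n with ℕ.m<1+n⇒m<n∨m≡n i<n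
    ... | inj₁ i<n' = go n (≈[]-weaken (ℕ.n≤1+n n) p) i i<n'
    ... | inj₂ refl = begin
      (b + c) n                    ≡⟨ ∧-identityʳ _ ⟨
      (b + c) n ∧ true             ≡⟨ cong ((b + c) n ∧_) a₀ ⟨
      (b + c) n ∧ a 0              ≡⟨ lowest-coefficient (b + c) a n (go n (≈[]-weaken (ℕ.n≤1+n n) p)) ⟨
      ((b + c) * a) n              ≡⟨ *-distribʳ a b c n ⟩
      (b * a) n xor (c * a) n      ≡⟨ cong (_xor (c * a) n) (at[] p n ℕ.≤-refl) ⟩
      (c * a) n xor (c * a) n      ≡⟨ xor-same ((c * a) n) ⟩
      false ∎
      where open ≡-Reasoning

  *-cancelʳ : ∀ a {b c} → a 0 ≡ true → b * a ≈ c * a → b ≈ c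
  *-cancelʳ a a₀ p = ≈[]⇒≈ λ n → *-cancelʳ[] a a₀ (≈⇒≈[] n p)

  -- Finite products, Gaussian binomials and the q-binomial theorem.

  poch : ℕ → ℕ → ℕ → Series
  poch a s zero = 1#
  poch a s (suc n) = poch a s n * (1# + X (a ℕ.+ n ℕ.* s))

  -- The Gaussian binomial of k + l over k in the variable q^s. Indexing by the two lower entries
  -- makes Pascal's rule free of subtraction.
  gauss : ℕ → ℕ → ℕ → Series
  gauss s zero l = 1#
  gauss s (suc k) zero = 1#
  gauss s (suc k) (suc l) = X (suc k ℕ.* s) * gauss s (suc k) l + gauss s k (suc l)

  gauss-poch : ∀ s k l → gauss s k l * (poch s s k * poch s s l) ≈ poch s s (k ℕ.+ l)
  gauss-poch s zero l = solve 1 (λ p → con true :* (con true :* p) := p) ≈-refl (poch s s l)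
  gauss-poch s (suc k) zero = ≈-trans
    (solve 1 (λ p → con true :* (p :* con true) := p) ≈-refl (poch s s (suc k)))
    (reindex (poch s s) (sym (ℕ.+-identityʳ (suc k))))
  gauss-poch s (suc k) (suc l) = begin
    (x * g₁ + g₂) * ((p * (1# + x)) * (r * (1# + y)))
      ≈⟨ solve 6 (λ x y p r g₁ g₂ →
           (x :* g₁ :+ g₂) :* ((p :* (con true :+ x)) :* (r :* (con true :+ y))) :=
           x :* (con true :+ y) :* (g₁ :* ((p :* (con true :+ x)) :* r))
           :+ (con true :+ x) :* (g₂ :* (p :* (r :* (con true :+ y))))) ≈-refl x y p r g₁ g₂ ⟩
    x * (1# + y) * (g₁ * (poch s s (suc k) * r)) + (1# + x) * (g₂ * (p * poch s s (suc l)))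
      ≈⟨ +-cong {x * (1# + y) * (g₁ * (poch s s (suc k) * r))} {b = (1# + x) *
          (g₂ * (p * poch s s (suc l)))}
           (*-congˡ (≈-trans (gauss-poch s (suc k) l) (reindex (poch s s) (sym (ℕ.+-suc k l)))))
           (*-congˡ (gauss-poch s k (suc l))) ⟩
    x * (1# + y) * t + (1# + x) * t
      ≈⟨ solve 3 (λ x y t → x :* (con true :+ y) :* t :+ (con true :+ x) :* t := t :*
          (con true :+ x :* y)) ≈-refl x y t ⟩
    t * (1# + x * y)
      ≈⟨ *-congˡ (+-cong {1#} ≈-refl (≈-trans (≈-sym (X-+ (suc k ℕ.* s) (suc l ℕ.* s)))
          (reindex X (exponent s k l)))) ⟩
    poch s s (suc k ℕ.+ suc l) ∎
    where
    open ≈-Reasoning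
    x = X (suc k ℕ.* s)
    y = X (suc l ℕ.* s)
    p = poch s s k
    r = poch s s l
    g₁ = gauss s (suc k) l
    g₂ = gauss s k (suc l)
    t = poch s s (k ℕ.+ suc l)
    exponent : ∀ s k l → suc k ℕ.* s ℕ.+ suc l ℕ.* s ≡ s ℕ.+ (k ℕ.+ suc l) ℕ.* s
    exponent = solve-∀

  antidiagonal : ℕ → (ℕ → ℕ → Series) → Series
  antidiagonal zero F = F 0 0
  antidiagonal (suc N) F = F 0 (suc N) + antidiagonal N (λ k l → F (suc k) l)

  antidiagonal-cong : ∀ N m {F G} → (∀ k l → k ℕ.+ l ≡ N → F k l ≈[ m ] G k l) →
                      antidiagonal N F ≈[ m ] antidiagonal N G
  antidiagonal-cong zero m h = h 0 0 refl
  antidiagonal-cong (suc N) m h = +-cong[] (h 0 (suc N) refl)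
    (antidiagonal-cong N m (λ k l eq → h (suc k) l (cong suc eq)))

  antidiagonal-≈ : ∀ N {F G} → (∀ k l → k ℕ.+ l ≡ N → F k l ≈ G k l) → antidiagonal N F ≈ antidiagonal N G
  antidiagonal-≈ N h = ≈[]⇒≈ λ m → antidiagonal-cong N m (λ k l eq → ≈⇒≈[] m (h k l eq))

  antidiagonal-+ : ∀ N F G → antidiagonal N F + antidiagonal N G ≈ antidiagonal N (λ k l → F k l + G k l)
  antidiagonal-+ zero F G = ≈-refl
  antidiagonal-+ (suc N) F G = ≈-trans
    (solve 4 (λ a b c d → (a :+ b) :+ (c :+ d) := (a :+ c) :+ (b :+ d)) ≈-refl
      (F 0 (suc N)) (antidiagonal N (λ k → F (suc k))) (G 0 (suc N)) (antidiagonal N (λ k → G (suc k))))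
    (+-cong {F 0 (suc N) + G 0 (suc N)} ≈-refl (antidiagonal-+ N (λ k → F (suc k)) (λ k → G (suc k))))

  antidiagonal-* : ∀ N c F → c * antidiagonal N F ≈ antidiagonal N (λ k l → c * F k l)
  antidiagonal-* zero c F = ≈-refl
  antidiagonal-* (suc N) c F = ≈-trans
    (solve 3 (λ c a b → c :* (a :+ b) := c :* a :+ c :* b) ≈-refl c (F 0 (suc N))
        (antidiagonal N (λ k → F (suc k))))
    (+-cong {c * F 0 (suc N)} ≈-refl (antidiagonal-* N c (λ k → F (suc k))))

  antidiagonal-last : ∀ N F → antidiagonal (suc N) F ≈ antidiagonal N (λ k l → F k (suc l)) + F (suc N) 0
  antidiagonal-last zero F = ≈-refl
  antidiagonal-last (suc N) F = ≈-trans
    (+-cong {F 0 (suc (suc N))} ≈-refl (antidiagonal-last N (λ k → F (suc k))))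
    (solve 3 (λ a b c → a :+ (b :+ c) := a :+ b :+ c) ≈-refl (F 0 (suc (suc N)))
      (antidiagonal N (λ k l → F (suc k) (suc l))) (F (suc (suc N)) 0))

  -- The two summands of Pascal's rule, moved to the next antidiagonal and padded with 0 at the
  -- border.
  right up : (ℕ → ℕ → Series) → ℕ → ℕ → Series
  right F zero l = 0#
  right F (suc k) l = F k l
  up F k zero = 0#
  up F k (suc l) = F k l

  antidiagonal-right : ∀ N F → antidiagonal (suc N) (right F) ≈ antidiagonal N F
  antidiagonal-right N F = +-identityˡ _

  antidiagonal-up : ∀ N F → antidiagonal (suc N) (up F) ≈ antidiagonal N F
  antidiagonal-up N F = ≈-trans (antidiagonal-last N (up F)) (+-identityʳ _)

  triangle : ℕ → ℕ
  triangle zero = 0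
  triangle (suc k) = k ℕ.+ triangle k

  triangle-+ : ∀ m n → triangle (m ℕ.+ n) ≡ triangle m ℕ.+ triangle n ℕ.+ m ℕ.* n
  triangle-+ zero n = sym (ℕ.+-identityʳ (triangle n))
  triangle-+ (suc m) n = trans (cong ((m ℕ.+ n) ℕ.+_) (triangle-+ m n)) (ring m n (triangle m) (triangle n))
    where
    ring : ∀ m n t u → (m ℕ.+ n) ℕ.+ (t ℕ.+ u ℕ.+ m ℕ.* n) ≡ (m ℕ.+ t) ℕ.+ u ℕ.+ suc m ℕ.* n
    ring = solve-∀

  -- Homogenising ∏ (1 + q^(x - e + m s)) to ∏ (q^e + q^(x + m s)) keeps the exponents nonnegative.
  mixed : ℕ → ℕ → ℕ → ℕ → Series
  mixed s x e zero = 1#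
  mixed s x e (suc N) = (X e + X x) * mixed s (x ℕ.+ s) e N

  exponent : ℕ → ℕ → ℕ → ℕ → ℕ → ℕ
  exponent s x e k l = triangle k ℕ.* s ℕ.+ k ℕ.* x ℕ.+ l ℕ.* e

  -- Taking q^e from the first factor raises `l`, taking q^x raises `k`; after matching exponents
  -- the two contributions are the summands of Pascal's rule.
  q-binomial : ∀ s x e N → mixed s x e N ≈ antidiagonal N (λ k l → X (exponent s x e k l) * gauss s k l)
  q-binomial s x e zero = ≈-sym (*-identityˡ 1#)
  q-binomial s x e (suc N) = begin
    (X e + X x) * mixed s (x ℕ.+ s) e N
      ≈⟨ *-congˡ (q-binomial s (x ℕ.+ s) e N) ⟩
    (X e + X x) * antidiagonal N F′
      ≈⟨ solve 3 (λ a b c → (a :+ b) :* c := a :* c :+ b :* c) ≈-refl (X e) (X x) (antidiagonal N F′) ⟩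
    X e * antidiagonal N F′ + X x * antidiagonal N F′
      ≈⟨ +-cong {X e * antidiagonal N F′} {b = X x * antidiagonal N F′}
           (antidiagonal-* N (X e) F′) (antidiagonal-* N (X x) F′) ⟩
    antidiagonal N G + antidiagonal N H
      ≈⟨ +-cong {antidiagonal (suc N) (up G)} {b = antidiagonal (suc N) (right H)} (antidiagonal-up N G)
          (antidiagonal-right N H) ⟨
    antidiagonal (suc N) (up G) + antidiagonal (suc N) (right H)
      ≈⟨ antidiagonal-+ (suc N) (up G) (right H) ⟩
    antidiagonal (suc N) (λ k l → up G k l + right H k l)
      ≈⟨ antidiagonal-≈ (suc N) pascal ⟩
    antidiagonal (suc N) (λ k l → X (exponent s x e k l) * gauss s k l) ∎
    where
    open ≈-Reasoning
    F′ G H : ℕ → ℕ → Series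
    F′ k l = X (exponent s (x ℕ.+ s) e k l) * gauss s k l
    G k l = X e * F′ k l
    H k l = X x * F′ k l
    merge : ∀ a b g {c} → a ℕ.+ b ≡ c → X a * (X b * g) ≈ X c * g
    merge a b g eq = ≈-trans (≈-sym (*-assoc (X a) (X b) g))
        (*-congʳ (≈-trans (≈-sym (X-+ a b)) (reindex X eq)))
    e₁ : ∀ s x e l → e ℕ.+ (0 ℕ.+ l ℕ.* e) ≡ suc l ℕ.* e
    e₁ = solve-∀
    e₂ : ∀ s x e k t → x ℕ.+ (t ℕ.* s ℕ.+ k ℕ.* (x ℕ.+ s) ℕ.+ 0 ℕ.* e) ≡
        (k ℕ.+ t) ℕ.* s ℕ.+ suc k ℕ.* x ℕ.+ 0 ℕ.* e
    e₂ = solve-∀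
    e₃ : ∀ s x e k l t → x ℕ.+ (t ℕ.* s ℕ.+ k ℕ.* (x ℕ.+ s) ℕ.+ suc l ℕ.* e) ≡
        (k ℕ.+ t) ℕ.* s ℕ.+ suc k ℕ.* x ℕ.+ suc l ℕ.* e
    e₃ = solve-∀
    e₄ : ∀ s x e k l t → e ℕ.+ ((k ℕ.+ t) ℕ.* s ℕ.+ suc k ℕ.* (x ℕ.+ s) ℕ.+ l ℕ.* e) ≡
         ((k ℕ.+ t) ℕ.* s ℕ.+ suc k ℕ.* x ℕ.+ suc l ℕ.* e) ℕ.+ suc k ℕ.* s
    e₄ = solve-∀
    pascal : ∀ k l → k ℕ.+ l ≡ suc N → up G k l + right H k l ≈ X (exponent s x e k l) * gauss s k l
    pascal zero (suc l) _ = ≈-trans (+-identityʳ _) (merge e _ 1# (e₁ s x e l))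
    pascal (suc k) zero _ = ≈-trans (+-identityˡ _)
        (≈-trans (merge x _ (gauss s k 0) (e₂ s x e k (triangle k)))
      (*-congˡ (gauss-0 k)))
      where
      gauss-0 : ∀ k → gauss s k 0 ≈ 1#
      gauss-0 zero = ≈-refl
      gauss-0 (suc k) = ≈-refl
    pascal (suc k) (suc l) _ = begin
      X e * F′ (suc k) l + X x * F′ k (suc l)
        ≈⟨ +-cong {X e * F′ (suc k) l} {b = X x * F′ k (suc l)}
             (merge e _ (gauss s (suc k) l) (e₄ s x e k l (triangle k)))
             (merge x _ (gauss s k (suc l)) (e₃ s x e k l (triangle k))) ⟩
      X (E ℕ.+ suc k ℕ.* s) * gauss s (suc k) l + X E * gauss s k (suc l)
        ≈⟨ +-cong {X (E ℕ.+ suc k ℕ.* s) * gauss s (suc k) l} (*-congʳ (X-+ E (suc k ℕ.* s))) ≈-refl ⟩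
      X E * X (suc k ℕ.* s) * gauss s (suc k) l + X E * gauss s k (suc l)
        ≈⟨ solve 4 (λ a b c d → a :* b :* c :+ a :* d := a :* (b :* c :+ d)) ≈-refl (X E) (X (suc k ℕ.* s))
            (gauss s (suc k) l) (gauss s k (suc l)) ⟩
      X E * gauss s (suc k) (suc l) ∎
      where
      E = exponent s x e (suc k) (suc l)

  -- The Jacobi triple product.

  poch-first : ∀ a s n → poch a s (suc n) ≈ (1# + X a) * poch (a ℕ.+ s) s n
  poch-first a s zero = ≈-trans (*-identityˡ _) (≈-trans (+-cong {1#} ≈-refl (reindex X (ℕ.+-identityʳ a)))
      (≈-sym (*-identityʳ _)))
  poch-first a s (suc n) = begin
    poch a s (suc n) * (1# + X (a ℕ.+ suc n ℕ.* s))
      ≈⟨ *-cong (poch-first a s n) (+-cong {1#} ≈-refl (reindex X (sym (ℕ.+-assoc a s (n ℕ.* s))))) ⟩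
    (1# + X a) * poch (a ℕ.+ s) s n * (1# + X (a ℕ.+ s ℕ.+ n ℕ.* s))
      ≈⟨ *-assoc _ _ _ ⟩
    (1# + X a) * poch (a ℕ.+ s) s (suc n) ∎
    where open ≈-Reasoning

  mixed-upper : ∀ s y e N → mixed s (e ℕ.+ y) e N ≈ X (N ℕ.* e) * poch y s N
  mixed-upper s y e zero = ≈-sym (*-identityˡ 1#)
  mixed-upper s y e (suc N) = begin
    (X e + X (e ℕ.+ y)) * mixed s (e ℕ.+ y ℕ.+ s) e N
      ≈⟨ *-cong (+-cong {X e} ≈-refl (X-+ e y)) (≈-trans (reindex (λ z → mixed s z e N) (ℕ.+-assoc e y s))
          (mixed-upper s (y ℕ.+ s) e N)) ⟩
    (X e + X e * X y) * (X (N ℕ.* e) * poch (y ℕ.+ s) s N)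
      ≈⟨ solve 4 (λ e y n p → (e :+ e :* y) :* (n :* p) := (e :* n) :* ((con true :+ y) :* p)) ≈-refl (X e)
          (X y) (X (N ℕ.* e)) (poch (y ℕ.+ s) s N) ⟩
    (X e * X (N ℕ.* e)) * ((1# + X y) * poch (y ℕ.+ s) s N)
      ≈⟨ *-cong (≈-sym (X-+ e (N ℕ.* e))) (≈-sym (poch-first y s N)) ⟩
    X (suc N ℕ.* e) * poch y s (suc N) ∎
    where
    open ≈-Reasoning

  -- In the first `r` factors q^e is the higher power, so the other one is pulled out; the
  -- hypothesis says that the differences of exponents descend to `b` in steps of a + b. From there
  -- on the order is reversed and `mixed-upper` applies.
  mixed-lower : ∀ a b x e r N → e ℕ.+ a ≡ x ℕ.+ r ℕ.* (a ℕ.+ b) →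
                mixed (a ℕ.+ b) x e (r ℕ.+ N) ≈
                X (triangle r ℕ.* (a ℕ.+ b) ℕ.+ r ℕ.* x) *
                    (poch b (a ℕ.+ b) r * mixed (a ℕ.+ b) (e ℕ.+ a) e N)
  mixed-lower a b x e zero N eq = ≈-trans (reindex (λ z → mixed (a ℕ.+ b) z e N)
      (trans (sym (ℕ.+-identityʳ x)) (sym eq)))
    (≈-sym (≈-trans (*-identityˡ _) (*-identityˡ _)))
  mixed-lower a b x e (suc r) N eq = begin
    (X e + X x) * mixed s (x ℕ.+ s) e (r ℕ.+ N)
      ≈⟨ *-cong (+-cong {X e} {b = X x} (≈-trans (reindex X e-x) (X-+ x (b ℕ.+ r ℕ.* s))) ≈-refl)
                (mixed-lower a b (x ℕ.+ s) e r N (trans eq (sym (ℕ.+-assoc x s (r ℕ.* s))))) ⟩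
    (X x * X (b ℕ.+ r ℕ.* s) + X x) * (X C * (p * m))
      ≈⟨ solve 5 (λ x y c p m → (x :* y :+ x) :* (c :* (p :* m)) := (x :* c) :*
          ((p :* (con true :+ y)) :* m)) ≈-refl
           (X x) (X (b ℕ.+ r ℕ.* s)) (X C) p m ⟩
    (X x * X C) * (poch b s (suc r) * m)
      ≈⟨ *-congʳ (≈-trans (≈-sym (X-+ x C)) (reindex X (ring s x r (triangle r)))) ⟩
    X (triangle (suc r) ℕ.* s ℕ.+ suc r ℕ.* x) * (poch b s (suc r) * m) ∎
    where
    open ≈-Reasoning
    s = a ℕ.+ b
    C = triangle r ℕ.* s ℕ.+ r ℕ.* (x ℕ.+ s)
    p = poch b s r
    m = mixed s (e ℕ.+ a) e N
    e-x : e ≡ x ℕ.+ (b ℕ.+ r ℕ.* s)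
    e-x = ℕ.+-cancelʳ-≡ a e _ (trans eq (ring′ a b x (r ℕ.* s)))
      where
      ring′ : ∀ a b x t → x ℕ.+ ((a ℕ.+ b) ℕ.+ t) ≡ x ℕ.+ (b ℕ.+ t) ℕ.+ a
      ring′ = solve-∀
    ring : ∀ s x r t → x ℕ.+ (t ℕ.* s ℕ.+ r ℕ.* (x ℕ.+ s)) ≡ (r ℕ.+ t) ℕ.* s ℕ.+ suc r ℕ.* x
    ring = solve-∀

  -- a j (j + 1) / 2 + b j (j - 1) / 2
  weight : ℕ → ℕ → ℤ → ℕ
  weight a b (+ j) = triangle j ℕ.* (a ℕ.+ b) ℕ.+ j ℕ.* a
  weight a b -[1+ j ] = triangle (suc j) ℕ.* (a ℕ.+ b) ℕ.+ suc j ℕ.* b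

  weight-≥ : ∀ a b j → ∣ j ∣ ≤ weight (suc a) (suc b) j
  weight-≥ a b (+ j) = ℕ.≤-trans (ℕ.m≤m*n j (suc a)) (ℕ.m≤n+m _ _)
  weight-≥ a b -[1+ j ] = ℕ.≤-trans (ℕ.m≤m*n (suc j) (suc b)) (ℕ.m≤n+m _ _)

  ints : ℕ → List ℤ
  ints zero = + 0 ∷ []
  ints (suc n) = + suc n ∷ -[1+ n ] ∷ ints n

  sum : (ℤ → Series) → List ℤ → Series
  sum F [] = 0#
  sum F (j ∷ js) = F j + sum F js

  -- Ramanujan's theta function f(q^a, q^b). For positive a and b the coefficient of qⁱ may be read
  -- from the terms with ∣j∣ ≤ i, by `weight-≥`.
  theta : ℕ → ℕ → Series
  theta a b i = sum (λ j → X (weight a b j)) (ints i) i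

  X-below : ∀ c i → i < c → X c i ≡ false
  X-below (suc c) zero _ = refl
  X-below (suc c) (suc i) (s≤s h) = X-below c i h

  X*-≈[] : ∀ c {a n} → n ≤ c → X c * a ≈[ n ] 0#
  X*-≈[] c {a} n≤c = mk[] λ i i<n → trans (X*-below c a i (ℕ.<-≤-trans i<n n≤c)) (sym (0#-at i))

  X-≈[] : ∀ c {n} → n ≤ c → X c ≈[ n ] 0#
  X-≈[] c n≤c = ≈[]-trans (≈⇒≈[] _ (≈-sym (*-identityʳ (X c)))) (X*-≈[] c n≤c)

  theta-partial : ∀ a b n m → m ≤ n →
    sum (λ j → X (weight (suc a) (suc b) j)) (ints n) ≈[ suc m ] sum (λ j → X (weight (suc a) (suc b) j))
        (ints m)
  theta-partial a b n m m≤n with ℕ.m≤n⇒m<n∨m≡n m≤n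
  ... | inj₂ refl = ≈[]-refl
  theta-partial a b (suc n) m m≤n | inj₁ (s≤s m≤n') = ≈[]-trans
    (+-cong[] {a' = 0#} (X-≈[] _ (ℕ.≤-trans (s≤s m≤n') (weight-≥ a b (+ suc n))))
      (+-cong[] {a' = 0#} (X-≈[] _ (ℕ.≤-trans (s≤s m≤n') (weight-≥ a b -[1+ n ])))
          (theta-partial a b n m m≤n')))
    (≈⇒≈[] _ (≈-trans (+-identityˡ _) (+-identityˡ _)))

  theta-≈[] : ∀ a b n → theta (suc a) (suc b) ≈[ suc n ] sum (λ j → X (weight (suc a) (suc b) j)) (ints n)
  theta-≈[] a b n = mk[] λ i i<n → sym (at[] (theta-partial a b n i (s≤s⁻¹ i<n)) i ℕ.≤-refl)

  antidiagonal-ints : ∀ n F → antidiagonal (n ℕ.+ n) (λ k l → F (k ⊖ n)) ≈ sum F (ints n)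
  antidiagonal-ints zero F = ≈-sym (+-identityʳ (F (+ 0)))
  antidiagonal-ints (suc n) F = begin
    antidiagonal (suc n ℕ.+ suc n) G
      ≈⟨ reindex (λ z → antidiagonal z G) (cong suc (ℕ.+-suc n n)) ⟩
    G 0 (suc (suc (n ℕ.+ n))) + antidiagonal (suc (n ℕ.+ n)) (λ k → G (suc k))
      ≈⟨ +-cong {F -[1+ n ]} ≈-refl (antidiagonal-last (n ℕ.+ n) (λ k → G (suc k))) ⟩
    F -[1+ n ] + (antidiagonal (n ℕ.+ n) (λ k l → F (suc k ⊖ suc n)) + F (suc (suc (n ℕ.+ n)) ⊖ suc n))
      ≈⟨ +-cong {F -[1+ n ]} ≈-refl (+-cong {antidiagonal (n ℕ.+ n) (λ k l → F (suc k ⊖ suc n))}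
           (≈-trans (antidiagonal-≈ (n ℕ.+ n) (λ k l _ → reindex F (ℤ.[1+m]⊖[1+n]≡m⊖n k n)))
               (antidiagonal-ints n F))
           (reindex F last)) ⟩
    F -[1+ n ] + (sum F (ints n) + F (+ suc n))
      ≈⟨ solve 3 (λ a b c → a :+ (b :+ c) := c :+ (a :+ b)) ≈-refl (F -[1+ n ]) (sum F (ints n))
          (F (+ suc n)) ⟩
    sum F (ints (suc n)) ∎
    where
    open ≈-Reasoning
    G : ℕ → ℕ → Series
    G k l = F (k ⊖ suc n)
    last : suc (suc (n ℕ.+ n)) ⊖ suc n ≡ + suc n
    last = trans (ℤ.⊖-≥ (s≤s (ℕ.m≤n⇒m≤1+n (ℕ.m≤m+n n n))))
      (cong +_ (trans (cong (ℕ._∸ n) (sym (ℕ.+-suc n n))) (ℕ.m+n∸m≡n n (suc n))))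

  poch-limit : ∀ s m i → poch s s (m ℕ.+ i) ≈[ s ℕ.+ m ℕ.* s ] poch s s m
  poch-limit s m zero = ≈⇒≈[] _ (reindex (poch s s) (ℕ.+-identityʳ m))
  poch-limit s m (suc i) rewrite ℕ.+-suc m i = ≈[]-trans
    (*-cong[] (poch-limit s m i) (+-cong[] {a = 1#} ≈[]-refl
      (X-≈[] _ (ℕ.+-monoʳ-≤ s (ℕ.*-monoˡ-≤ s (ℕ.m≤m+n m i))))))
    (≈⇒≈[] _ (≈-trans (*-congˡ (+-identityʳ 1#)) (*-identityʳ _)))

  poch-0 : ∀ s a n → poch (suc a) s n 0 ≡ true
  poch-0 s a zero = refl
  poch-0 s a (suc n) rewrite poch-0 s a n = refl

  -- As its entries grow, the Gaussian binomial tends to the reciprocal of the infinite product.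
  -- Multiplied by one more product it becomes a quotient-free identity through `gauss-poch`, and
  -- all products with at least m factors agree up to the exponent m s.
  gauss-limit : ∀ s m i j n → poch (suc s) (suc s) (m ℕ.+ n) * gauss (suc s) (m ℕ.+ i)
      (m ℕ.+ j) ≈[ suc s ℕ.+ m ℕ.* suc s ] 1#
  gauss-limit s′ m i j n = *-cancelʳ[] (P (m ℕ.+ j)) (poch-0 s s′ (m ℕ.+ j))
    (≈[]-trans (*-cong[] (*-cong[] (≈[]-trans (poch-limit s m n)
        (≈[]-sym (poch-limit s m i))) ≈[]-refl) ≈[]-refl)
    (≈[]-trans (≈⇒≈[] _ (≈-trans (solve 3 (λ p g r → p :* g :* r := g :* (p :* r)) ≈-refl
                                 (P (m ℕ.+ i)) (gauss s (m ℕ.+ i) (m ℕ.+ j)) (P (m ℕ.+ j)))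
                               (gauss-poch s (m ℕ.+ i) (m ℕ.+ j))))
    (≈[]-trans (≈[]-trans (≈⇒≈[] _ (reindex P (ring m i j))) (poch-limit s m (i ℕ.+ (m ℕ.+ j))))
    (≈[]-trans (≈[]-sym (poch-limit s m j)) (≈⇒≈[] _ (≈-sym (*-identityˡ _)))))))
    where
    s = suc s′
    P = poch s s
    ring : ∀ m i j → (m ℕ.+ i) ℕ.+ (m ℕ.+ j) ≡ m ℕ.+ (i ℕ.+ (m ℕ.+ j))
    ring = solve-∀

  module _ (a′ b′ n : ℕ) where
    private
      a b s C : ℕ
      a = suc a′
      b = suc b′
      s = a ℕ.+ b
      C = (triangle n ℕ.* s ℕ.+ n ℕ.* a) ℕ.+ n ℕ.* (n ℕ.* s)

    -- With e = n s the change of order between q^e and the other power falls in the middle of the 2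
    -- n factors, so each half gives one of the products. `C` is the exponent of the central term k
    -- = l = n.
    product-expansion : X C * (poch b s n * poch a s n) ≈
      antidiagonal (n ℕ.+ n) (λ k l → X (exponent s a (n ℕ.* s) k l) * gauss s k l)
    product-expansion = begin
      X C * (poch b s n * poch a s n)
        ≈⟨ *-congʳ (X-+ C₁ (n ℕ.* (n ℕ.* s))) ⟩
      X C₁ * X (n ℕ.* (n ℕ.* s)) * (poch b s n * poch a s n)
        ≈⟨ solve 4 (λ x y p r → x :* y :* (p :* r) := x :* (p :* (y :* r))) ≈-refl
             (X C₁) (X (n ℕ.* (n ℕ.* s))) (poch b s n) (poch a s n) ⟩
      X C₁ * (poch b s n * (X (n ℕ.* (n ℕ.* s)) * poch a s n))
        ≈⟨ *-congˡ (*-congˡ (mixed-upper s a (n ℕ.* s) n)) ⟨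
      X C₁ * (poch b s n * mixed s (n ℕ.* s ℕ.+ a) (n ℕ.* s) n)
        ≈⟨ mixed-lower a b a (n ℕ.* s) n n (ℕ.+-comm (n ℕ.* s) a) ⟨
      mixed s a (n ℕ.* s) (n ℕ.+ n)
        ≈⟨ q-binomial s a (n ℕ.* s) (n ℕ.+ n) ⟩
      antidiagonal (n ℕ.+ n) (λ k l → X (exponent s a (n ℕ.* s) k l) * gauss s k l) ∎
      where
      open ≈-Reasoning
      C₁ = triangle n ℕ.* s ℕ.+ n ℕ.* a

    term-limit : ∀ m i j N E → n ≡ m ℕ.+ N → C ℕ.+ n ≤ E ℕ.+ (s ℕ.+ m ℕ.* s) →
                 poch s s n * (X E * gauss s (m ℕ.+ i) (m ℕ.+ j)) ≈[ C ℕ.+ n ] X E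
    term-limit m i j N E refl le = ≈[]-weaken le (≈[]-trans
      (≈⇒≈[] _ (solve 3 (λ p x g → p :* (x :* g) := x :* (p :* g)) ≈-refl (poch s s n) (X E)
          (gauss s (m ℕ.+ i) (m ℕ.+ j))))
      (≈[]-trans (X*-cong[] E (gauss-limit (a′ ℕ.+ b) m i j N)) (≈⇒≈[] _ (*-identityʳ (X E)))))

    bound : ∀ m N w → n ≡ m ℕ.+ N → N ≤ w → C ℕ.+ n ≤ (C ℕ.+ w) ℕ.+ (s ℕ.+ m ℕ.* s)
    bound m N w eq N≤w = ℕ.≤-trans (ℕ.+-monoʳ-≤ C (ℕ.≤-trans (ℕ.≤-reflexive (trans eq (ℕ.+-comm m N)))
      (ℕ.+-mono-≤ N≤w (ℕ.≤-trans (ℕ.m≤m*n m s) (ℕ.m≤n+m (m ℕ.* s) s)))))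
          (ℕ.≤-reflexive (sym (ℕ.+-assoc C w _)))

    combine : ∀ k l m i j N → k ≡ m ℕ.+ i → l ≡ m ℕ.+ j → n ≡ m ℕ.+ N → N ≤ weight a b (k ⊖ n) →
              exponent s a (n ℕ.* s) k l ≡ C ℕ.+ weight a b (k ⊖ n) →
              poch s s n * (X (exponent s a (n ℕ.* s) k l) * gauss s k l) ≈[ C ℕ.+ n ] X C * X
                  (weight a b (k ⊖ n))
    combine k l m i j N refl refl eqₙ N≤w eq = ≈[]-trans
      (term-limit m i j N E eqₙ (subst (λ z → C ℕ.+ n ≤ z ℕ.+ (s ℕ.+ m ℕ.* s)) (sym eq)
          (bound m N _ eqₙ N≤w)))
      (≈⇒≈[] _ (≈-trans (reindex X eq) (X-+ C (weight a b (k ⊖ n)))))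
      where
      E = exponent s a (n ℕ.* s) k l

  triangle-square : ∀ j → triangle j ℕ.+ triangle j ℕ.+ j ≡ j ℕ.* j
  triangle-square zero = refl
  triangle-square (suc j) = trans (ring₁ j (triangle j))
      (trans (cong (λ z → z ℕ.+ suc (j ℕ.+ j)) (triangle-square j)) (ring₂ j))
    where
    ring₁ : ∀ j t → (j ℕ.+ t) ℕ.+ (j ℕ.+ t) ℕ.+ suc j ≡ (t ℕ.+ t ℕ.+ j) ℕ.+ suc (j ℕ.+ j)
    ring₁ = solve-∀
    ring₂ : ∀ j → j ℕ.* j ℕ.+ suc (j ℕ.+ j) ≡ suc j ℕ.* suc j
    ring₂ = solve-∀

  weight-neg : ∀ a b j → weight a b (ℤ.- (+ j)) ≡ triangle j ℕ.* (a ℕ.+ b) ℕ.+ j ℕ.* b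
  weight-neg a b zero = refl
  weight-neg a b (suc j) = refl

  -- The Gaussian binomial is far from its limit only when the smaller of k and l is small; then ∣k
  -- - n∣ is large, and so is the weight. The smaller entry and ∣k - n∣ add up to n, so errors begin
  -- no lower than C + n.
  term : ∀ a b n k l → k ℕ.+ l ≡ n ℕ.+ n → let s = suc a ℕ.+ suc b
                                               C = (triangle n ℕ.* s ℕ.+ n ℕ.* suc a) ℕ.+ n ℕ.* (n ℕ.* s) in
         poch s s n * (X (exponent s (suc a) (n ℕ.* s) k l) * gauss s k l)
           ≈[ C ℕ.+ n ] X C * X (weight (suc a) (suc b) (k ⊖ n))
  term a b n k l eq with ℕ.≤-total k n
  ... | inj₁ k≤n with ℕ.m≤n⇒∃[o]m+o≡n k≤n
  ...   | j , refl = combine a b n k l k 0 (j ℕ.+ j) j (sym (ℕ.+-identityʳ k)) l≡ refl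
            (subst₂ _≤_ (trans (cong ∣_∣ k⊖n) (ℤ.∣-i∣≡∣i∣ (+ j))) refl (weight-≥ a b (k ⊖ n)))
            (trans (main a b k j l (triangle k) (triangle j) (triangle n) l≡ (triangle-+ k j)
                (triangle-square j))
                   (cong (C ℕ.+_) (sym (trans (cong (weight (suc a) (suc b)) k⊖n)
                       (weight-neg (suc a) (suc b) j)))))
    where
    C = (triangle n ℕ.* (suc a ℕ.+ suc b) ℕ.+ n ℕ.* suc a) ℕ.+ n ℕ.* (n ℕ.* (suc a ℕ.+ suc b))
    l≡ : l ≡ k ℕ.+ (j ℕ.+ j)
    l≡ = ℕ.+-cancelˡ-≡ k l _ (trans eq (ring k j))
      where
      ring : ∀ k j → k ℕ.+ j ℕ.+ (k ℕ.+ j) ≡ k ℕ.+ (k ℕ.+ (j ℕ.+ j))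
      ring = solve-∀
    k⊖n : k ⊖ (k ℕ.+ j) ≡ ℤ.- (+ j)
    k⊖n = trans (ℤ.⊖-≤ k≤n) (cong (λ z → ℤ.- (+ z)) (ℕ.m+n∸m≡n k j))
    main : ∀ a b k j l t u v → l ≡ k ℕ.+ (j ℕ.+ j) → v ≡ t ℕ.+ u ℕ.+ k ℕ.* j → u ℕ.+ u ℕ.+ j ≡ j ℕ.* j →
           let s = suc a ℕ.+ suc b ; n = k ℕ.+ j in
           t ℕ.* s ℕ.+ k ℕ.* suc a ℕ.+ l ℕ.* (n ℕ.* s) ≡
           (v ℕ.* s ℕ.+ n ℕ.* suc a) ℕ.+ n ℕ.* (n ℕ.* s) ℕ.+ (u ℕ.* s ℕ.+ j ℕ.* suc b)
    main a b k j l t u v refl refl sq = trans (ring₁ a b k j t) (trans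
      (cong (λ z → (t ℕ.+ k ℕ.* j ℕ.+ z ℕ.+ (k ℕ.+ j) ℕ.* (k ℕ.+ j)) ℕ.* (suc a ℕ.+ suc b) ℕ.+ k ℕ.* suc a)
          (sym sq))
      (ring₂ a b k j t u))
      where
      ring₁ : ∀ a b k j t → t ℕ.* (suc a ℕ.+ suc b) ℕ.+ k ℕ.* suc a ℕ.+ (k ℕ.+ (j ℕ.+ j)) ℕ.*
          ((k ℕ.+ j) ℕ.* (suc a ℕ.+ suc b)) ≡
              (t ℕ.+ k ℕ.* j ℕ.+ j ℕ.* j ℕ.+ (k ℕ.+ j) ℕ.* (k ℕ.+ j)) ℕ.* (suc a ℕ.+ suc b) ℕ.+ k ℕ.* suc a
      ring₁ = solve-∀
      ring₂ : ∀ a b k j t u →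
              (t ℕ.+ k ℕ.* j ℕ.+ (u ℕ.+ u ℕ.+ j) ℕ.+ (k ℕ.+ j) ℕ.* (k ℕ.+ j)) ℕ.*
                  (suc a ℕ.+ suc b) ℕ.+ k ℕ.* suc a ≡
              ((t ℕ.+ u ℕ.+ k ℕ.* j) ℕ.* (suc a ℕ.+ suc b) ℕ.+ (k ℕ.+ j) ℕ.* suc a) ℕ.+ (k ℕ.+ j) ℕ.*
                  ((k ℕ.+ j) ℕ.* (suc a ℕ.+ suc b))
              ℕ.+ (u ℕ.* (suc a ℕ.+ suc b) ℕ.+ j ℕ.* suc b)
      ring₂ = solve-∀
  term a b n k l eq | inj₂ n≤k with ℕ.m≤n⇒∃[o]m+o≡n n≤k
  ... | j , refl = combine a b n k l l (j ℕ.+ j) 0 j k≡ (sym (ℕ.+-identityʳ l)) n≡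
            (subst₂ _≤_ (cong ∣_∣ k⊖n) refl (weight-≥ a b (k ⊖ n)))
            (trans (main a b n j l (triangle k) (triangle j) (triangle n) n≡ (triangle-+ n j))
                   (cong (C ℕ.+_) (sym (cong (weight (suc a) (suc b)) k⊖n))))
    where
    C = (triangle n ℕ.* (suc a ℕ.+ suc b) ℕ.+ n ℕ.* suc a) ℕ.+ n ℕ.* (n ℕ.* (suc a ℕ.+ suc b))
    n≡ : n ≡ l ℕ.+ j
    n≡ = sym (trans (ℕ.+-comm l j) (ℕ.+-cancelˡ-≡ n _ _ (trans (sym (ℕ.+-assoc n j l)) eq)))
    k≡ : n ℕ.+ j ≡ l ℕ.+ (j ℕ.+ j)
    k≡ = trans (cong (ℕ._+ j) n≡) (ℕ.+-assoc l j j)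
    k⊖n : (n ℕ.+ j) ⊖ n ≡ + j
    k⊖n = trans (ℤ.⊖-≥ n≤k) (cong +_ (ℕ.m+n∸m≡n n j))
    main : ∀ a b n j l t u v → n ≡ l ℕ.+ j → t ≡ v ℕ.+ u ℕ.+ n ℕ.* j →
           let s = suc a ℕ.+ suc b ; k = n ℕ.+ j in
           t ℕ.* s ℕ.+ k ℕ.* suc a ℕ.+ l ℕ.* (n ℕ.* s) ≡
           (v ℕ.* s ℕ.+ n ℕ.* suc a) ℕ.+ n ℕ.* (n ℕ.* s) ℕ.+ (u ℕ.* s ℕ.+ j ℕ.* suc a)
    main a b n j l t u v refl refl = ring a b j l u v
      where
      ring : ∀ a b j l u v → (v ℕ.+ u ℕ.+ (l ℕ.+ j) ℕ.* j) ℕ.* (suc a ℕ.+ suc b) ℕ.+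
          (l ℕ.+ j ℕ.+ j) ℕ.* suc a
               ℕ.+ l ℕ.* ((l ℕ.+ j) ℕ.* (suc a ℕ.+ suc b)) ≡
             (v ℕ.* (suc a ℕ.+ suc b) ℕ.+ (l ℕ.+ j) ℕ.* suc a) ℕ.+ (l ℕ.+ j) ℕ.*
                 ((l ℕ.+ j) ℕ.* (suc a ℕ.+ suc b))
               ℕ.+ (u ℕ.* (suc a ℕ.+ suc b) ℕ.+ j ℕ.* suc a)
      ring = solve-∀

  -- The comparison is made modulo q^(C + n) after multiplication by q^C, so cancelling q^C leaves
  -- exactly n known coefficients.
  jacobi : ∀ a b n → let s = suc a ℕ.+ suc b in
           poch (suc a) s n * poch (suc b) s n * poch s s n ≈[ n ] theta (suc a) (suc b)
  jacobi a b n = X*-cancel[] C (≈[]-trans (≈⇒≈[] _ (begin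
      X C * (poch (suc a) s n * poch (suc b) s n * poch s s n)
        ≈⟨ solve 4 (λ x p r t → x :* (p :* r :* t) := t :* (x :* (r :* p))) ≈-refl (X C) (poch (suc a) s n)
            (poch (suc b) s n) (poch s s n) ⟩
      poch s s n * (X C * (poch (suc b) s n * poch (suc a) s n))
        ≈⟨ *-congˡ (product-expansion a b n) ⟩
      poch s s n * antidiagonal (n ℕ.+ n) (λ k l → X (exponent s (suc a) (n ℕ.* s) k l) * gauss s k l)
        ≈⟨ antidiagonal-* (n ℕ.+ n) _ _ ⟩
      antidiagonal (n ℕ.+ n) (λ k l → poch s s n * (X (exponent s (suc a) (n ℕ.* s) k l) * gauss s k l)) ∎))
    (≈[]-trans (antidiagonal-cong (n ℕ.+ n) _ (term a b n))
    (≈[]-trans (≈⇒≈[] _ (≈-trans (≈-sym (antidiagonal-* (n ℕ.+ n) (X C) (λ k l → X (w (k ⊖ n)))))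
                                    (*-congˡ (antidiagonal-ints n (λ j → X (w j))))))
    (X*-cong[] C (≈[]-sym (≈[]-weaken (ℕ.n≤1+n n) (theta-≈[] a b n)))))))
    where
    open ≈-Reasoning
    s = suc a ℕ.+ suc b
    C = (triangle n ℕ.* s ℕ.+ n ℕ.* suc a) ℕ.+ n ℕ.* (n ℕ.* s)
    w = weight (suc a) (suc b)

  -- Product identities for the series f, ψ and Θ₅.

  residues : ℕ → ℕ → ℕ → ℕ → ℕ → Series
  residues a s M zero n = 1#
  residues a s M (suc r) n = residues a s M r n * poch (a ℕ.+ r ℕ.* s) M n

  residues-suc : ∀ a s M r n → residues a s M r (suc n) ≈ residues a s M r n * poch (a ℕ.+ n ℕ.* M) s r
  residues-suc a s M zero n = ≈-sym (*-identityʳ 1#)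
  residues-suc a s M (suc r) n = begin
    residues a s M r (suc n) * (P * (1# + X (a ℕ.+ r ℕ.* s ℕ.+ n ℕ.* M)))
      ≈⟨ *-cong (residues-suc a s M r n) (*-congˡ (+-cong {1#} ≈-refl
          (reindex X (ring a (r ℕ.* s) (n ℕ.* M))))) ⟩
    (residues a s M r n * poch (a ℕ.+ n ℕ.* M) s r) * (P * (1# + x))
      ≈⟨ solve 4 (λ r p P x → (r :* p) :* (P :* (con true :+ x)) := (r :* P) :*
          (p :* (con true :+ x))) ≈-refl
           (residues a s M r n) (poch (a ℕ.+ n ℕ.* M) s r) P x ⟩
    residues a s M (suc r) n * poch (a ℕ.+ n ℕ.* M) s (suc r) ∎
    where
    open ≈-Reasoning
    P = poch (a ℕ.+ r ℕ.* s) M n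
    x = X (a ℕ.+ n ℕ.* M ℕ.+ r ℕ.* s)
    ring : ∀ a b c → a ℕ.+ b ℕ.+ c ≡ a ℕ.+ c ℕ.+ b
    ring = solve-∀

  poch-++ : ∀ a s i j → poch a s (j ℕ.+ i) ≈ poch a s i * poch (a ℕ.+ i ℕ.* s) s j
  poch-++ a s i zero = ≈-sym (*-identityʳ _)
  poch-++ a s i (suc j) = ≈-trans
    (*-cong (poch-++ a s i j) (+-cong {1#} ≈-refl (reindex X (ring a i j s))))
    (*-assoc _ _ _)
    where
    ring : ∀ a i j s → a ℕ.+ (j ℕ.+ i) ℕ.* s ≡ a ℕ.+ i ℕ.* s ℕ.+ j ℕ.* s
    ring = solve-∀

  -- The factors are sorted by their index modulo M. All rearrangements of infinite products below
  -- are instances of this.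
  poch-residues : ∀ a s M n → poch a s (n ℕ.* M) ≈ residues a s (M ℕ.* s) M n
  poch-residues a s M zero = ≈-sym (residues-0 M)
    where
    residues-0 : ∀ r → residues a s (M ℕ.* s) r 0 ≈ 1#
    residues-0 zero = ≈-refl
    residues-0 (suc r) = ≈-trans (*-identityʳ _) (residues-0 r)
  poch-residues a s M (suc n) = begin
    poch a s (M ℕ.+ n ℕ.* M)
      ≈⟨ poch-++ a s (n ℕ.* M) M ⟩
    poch a s (n ℕ.* M) * poch (a ℕ.+ n ℕ.* M ℕ.* s) s M
      ≈⟨ *-cong (poch-residues a s M n) (reindex (λ z → poch z s M) (cong (a ℕ.+_) (ℕ.*-assoc n M s))) ⟩
    residues a s (M ℕ.* s) M n * poch (a ℕ.+ n ℕ.* (M ℕ.* s)) s M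
      ≈⟨ residues-suc a s (M ℕ.* s) M n ⟨
    residues a s (M ℕ.* s) M (suc n) ∎
    where
    open ≈-Reasoning

  poch-square : ∀ a s n → poch a s n * poch a s n ≈ poch (a ℕ.+ a) (s ℕ.+ s) n
  poch-square a s zero = *-identityʳ 1#
  poch-square a s (suc n) = begin
    (p * (1# + x)) * (p * (1# + x))
      ≈⟨ solve 2 (λ p x → (p :* (con true :+ x)) :* (p :* (con true :+ x)) := (p :* p) :*
          (con true :+ x :* x)) ≈-refl p x ⟩
    (p * p) * (1# + x * x)
      ≈⟨ *-cong (poch-square a s n) (+-cong {1#} ≈-refl
          (≈-trans (≈-sym (X-+ m m)) (reindex X (ring a s n)))) ⟩
    poch (a ℕ.+ a) (s ℕ.+ s) (suc n) ∎
    where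
    open ≈-Reasoning
    m = a ℕ.+ n ℕ.* s
    p = poch a s n
    x = X m
    ring : ∀ a s n → a ℕ.+ n ℕ.* s ℕ.+ (a ℕ.+ n ℕ.* s) ≡ a ℕ.+ a ℕ.+ n ℕ.* (s ℕ.+ s)
    ring = solve-∀

  dilate-X : ∀ m c → dilate (suc m) (X c) ≈ X (c ℕ.* suc m)
  dilate-X m zero = slices-≈ m λ where
    zero r<m → ≈-trans (slice-dilate₀ m 1#) (≈-sym (slice-1₀ m))
    (suc r) r<m → ≈-trans (slice-dilate₊ m r r<m 1#) (≈-sym (slice-1₊ m r))
  dilate-X m (suc c) = begin
    dilate (suc m) (X (suc c))                          ≈⟨ dilate-unfold m (X (suc c)) ⟩
    const false + X (suc m) * dilate (suc m) (X c)      ≈⟨ +-identityˡ _ ⟩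
    X (suc m) * dilate (suc m) (X c)                    ≈⟨ *-congˡ (dilate-X m c) ⟩
    X (suc m) * X (c ℕ.* suc m)                         ≈⟨ X-+ (suc m) (c ℕ.* suc m) ⟨
    X (suc c ℕ.* suc m) ∎
    where open ≈-Reasoning

  dilate-poch : ∀ m a s n → dilate (suc m) (poch a s n) ≈ poch (a ℕ.* suc m) (s ℕ.* suc m) n
  dilate-poch m a s zero = dilate-X m 0
  dilate-poch m a s (suc n) = begin
    dilate (suc m) (poch a s n * (1# + X (a ℕ.+ n ℕ.* s)))
      ≈⟨ dilate-* m (poch a s n) _ ⟩
    dilate (suc m) (poch a s n) * dilate (suc m) (1# + X (a ℕ.+ n ℕ.* s))
      ≈⟨ *-cong (dilate-poch m a s n) (dilate-+ (suc m) 1# _) ⟩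
    P * (dilate (suc m) 1# + dilate (suc m) (X (a ℕ.+ n ℕ.* s)))
      ≈⟨ *-congˡ (+-cong {dilate (suc m) 1#} (dilate-X m 0)
           (≈-trans (dilate-X m (a ℕ.+ n ℕ.* s)) (reindex X (ring a s n (suc m))))) ⟩
    P * (1# + X (a ℕ.* suc m ℕ.+ n ℕ.* (s ℕ.* suc m))) ∎
    where
    open ≈-Reasoning
    P = poch (a ℕ.* suc m) (s ℕ.* suc m) n
    ring : ∀ a s n m → (a ℕ.+ n ℕ.* s) ℕ.* m ≡ a ℕ.* m ℕ.+ n ℕ.* (s ℕ.* m)
    ring = solve-∀

  f f₁₁ ψ : Series
  f = theta 2 1
  f₁₁ = dilate 11 f
  ψ = theta 3 1

  -- Euler's pentagonal number theorem: the triple product for (2, 1) runs over the three residue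
  -- classes modulo 3. Defining `f` as the theta series makes its coefficients counts by definition.
  poch-f : ∀ n i → poch 1 1 (i ℕ.+ n) ≈[ n ] f
  poch-f n i = ≈[]-trans (≈[]-trans (≈⇒≈[] n (reindex (poch 1 1) (ℕ.+-comm i n))) (limit i))
    (≈[]-trans (≈[]-sym (≈[]-trans (≈⇒≈[] n (reindex (poch 1 1) (ring n))) (limit (n ℕ.+ n))))
    (≈[]-trans (≈⇒≈[] n (≈-trans (poch-residues 1 1 3 n)
      (solve 3 (λ p r t → con true :* p :* r :* t := r :* p :* t) ≈-refl (poch 1 3 n) (poch 2 3 n)
          (poch 3 3 n))))
    (jacobi 1 0 n)))
    where
    limit : ∀ i → poch 1 1 (n ℕ.+ i) ≈[ n ] poch 1 1 n
    limit i = ≈[]-weaken (ℕ.≤-trans (ℕ.≤-reflexive (sym (ℕ.*-identityʳ n))) (ℕ.n≤1+n _)) (poch-limit 1 n i)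
    ring : ∀ n → n ℕ.* 3 ≡ n ℕ.+ (n ℕ.+ n)
    ring = solve-∀

  poch-f* : ∀ n i → poch 1 1 (n ℕ.* suc i) ≈[ n ] f
  poch-f* n i = ≈[]-trans (≈⇒≈[] n (reindex (poch 1 1) (trans (ℕ.*-suc n i) (ℕ.+-comm n _))))
      (poch-f n (n ℕ.* i))

  poch-f₀ : ∀ n → poch 1 1 n ≈[ n ] f
  poch-f₀ n = poch-f n 0

  poch-f₁₁ : ∀ n i → poch 11 11 (i ℕ.+ n) ≈[ n ] f₁₁
  poch-f₁₁ n i = ≈[]-trans (≈⇒≈[] n (≈-sym (dilate-poch 10 1 1 (i ℕ.+ n)))) (dilate-cong[] 11 (poch-f n i))

  -- Gauss's ψ(q) = f(q²)² / f(q), where f(q²) = f² modulo 2. The product for ψ has the classes 1, 3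
  -- and 0 modulo 4; the extra factor f² = f(q²) supplies the missing class 2.
  ψ-cube : ψ ≈ f * f * f
  ψ-cube = *-cancelʳ (f * f) refl (≈[]⇒≈ λ n →
    ≈[]-trans (*-cong[] (≈[]-sym (jacobi 2 0 n)) (≈[]-sym (*-cong[] (poch-f* n 1) (poch-f* n 1))))
    (≈[]-trans (≈⇒≈[] n (identity n))
    (≈[]-trans (*-cong[] (poch-f* n 3)
        (*-cong[] (*-cong[] (poch-f₀ n) (poch-f₀ n)) (*-cong[] (poch-f₀ n) (poch-f₀ n))))
      (≈⇒≈[] n (solve 1 (λ f → f :* ((f :* f) :* (f :* f)) := (f :* f :* f) :* (f :* f)) ≈-refl f)))))
    where
    open ≈-Reasoning
    identity : ∀ n → poch 3 4 n * poch 1 4 n * poch 4 4 n * (poch 1 1 (n ℕ.* 2) * poch 1 1 (n ℕ.* 2)) ≈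
               poch 1 1 (n ℕ.* 4) * ((poch 1 1 n * poch 1 1 n) * (poch 1 1 n * poch 1 1 n))
    identity n = begin
      p₃ * p₁ * p₄ * (poch 1 1 (n ℕ.* 2) * poch 1 1 (n ℕ.* 2))
        ≈⟨ *-congˡ (≈-trans (poch-square 1 1 (n ℕ.* 2)) (poch-residues 2 2 2 n)) ⟩
      p₃ * p₁ * p₄ * (1# * p₂ * p₄)
        ≈⟨ solve 4 (λ p₁ p₂ p₃ p₄ → p₃ :* p₁ :* p₄ :*
            (con true :* p₂ :* p₄) := con true :* p₁ :* p₂ :* p₃ :* p₄ :* p₄) ≈-refl p₁ p₂ p₃ p₄ ⟩
      1# * p₁ * p₂ * p₃ * p₄ * p₄
        ≈⟨ *-cong (≈-sym (poch-residues 1 1 4 n)) (≈-sym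
            (≈-trans (*-cong (poch-square 1 1 n) (poch-square 1 1 n)) (poch-square 2 2 n))) ⟩
      poch 1 1 (n ℕ.* 4) * ((poch 1 1 n * poch 1 1 n) * (poch 1 1 n * poch 1 1 n)) ∎
      where
      p₁ = poch 1 4 n
      p₂ = poch 2 4 n
      p₃ = poch 3 4 n
      p₄ = poch 4 4 n

  -- The ten parameters are the odd residues modulo 22 other than 11, paired to sum to 22. Each pair
  -- is ordered so that a quarter of its difference runs through 1, 4, 5, -2, 3, the entries of v.
  Θ₅ : Series
  Θ₅ = theta 13 9 * (theta 19 3 * (theta 21 1 * (theta 7 15 * theta 17 5)))

  f₂₂^5 : Series
  f₂₂^5 = f₂₂ * (f₂₂ * (f₂₂ * (f₂₂ * f₂₂)))
    where f₂₂ = f₁₁ * f₁₁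

  -- f₁₁ supplies the missing class 11 modulo 22 together with a sixth copy of the class 22, and f²
  -- = f(q²) supplies the even exponents. All odd and even exponents together make `f`.
  Θ₅-product : Θ₅ * (f₁₁ * (f * f)) ≈ f * (f₁₁ * f₁₁ * f₂₂^5)
  Θ₅-product = ≈[]⇒≈ λ n →
    ≈[]-trans (*-cong[]
      (≈[]-sym (*-cong[] (jacobi 12 8 n) (*-cong[] (jacobi 18 2 n)
          (*-cong[] (jacobi 20 0 n) (*-cong[] (jacobi 6 14 n) (jacobi 16 4 n))))))
      (≈[]-sym (*-cong[] (≈[]-trans (≈⇒≈[] n (reindex (poch 11 11) (ring n))) (poch-f₁₁ n n))
          (*-cong[] (poch-f* n 10) (poch-f* n 10)))))
    (≈[]-trans (≈⇒≈[] n (identity n))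
    (*-cong[] (≈[]-trans (≈⇒≈[] n (reindex (poch 1 1) (ℕ.*-assoc n 11 2))) (poch-f* n 21))
      (let h = ≈[]-trans (≈⇒≈[] n (≈-sym (poch-square 11 11 n))) (*-cong[] (poch-f₁₁ n 0) (poch-f₁₁ n 0)) in
        *-cong[] h (*-cong[] h (*-cong[] h (*-cong[] h (*-cong[] h h)))))))
    where
    open ≈-Reasoning
    ring : ∀ n → n ℕ.* 2 ≡ n ℕ.+ n
    ring = solve-∀
    identity : ∀ n → let p = λ a → poch a 22 n in
      (p 13 * p 9 * p 22) * ((p 19 * p 3 * p 22) * ((p 21 * p 1 * p 22) *
          ((p 7 * p 15 * p 22) * (p 17 * p 5 * p 22))))
        * (poch 11 11 (n ℕ.* 2) * (poch 1 1 (n ℕ.* 11) * poch 1 1 (n ℕ.* 11))) ≈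
      poch 1 1 (n ℕ.* 11 ℕ.* 2) * (p 22 * (p 22 * (p 22 * (p 22 * (p 22 * p 22)))))
    identity n = begin
      L * (poch 11 11 (n ℕ.* 2) * (poch 1 1 (n ℕ.* 11) * poch 1 1 (n ℕ.* 11)))
        ≈⟨ *-congˡ (*-cong (poch-residues 11 11 2 n) (poch-square 1 1 (n ℕ.* 11))) ⟩
      L * (1# * p 11 * z * D)
        ≈⟨ solve 13 (λ a b c d e g h i j k l z D →
             (a :* b :* z) :* ((c :* d :* z) :* ((e :* g :* z) :* ((h :* i :* z) :* (j :* k :* z)))) :*
                 (con true :* l :* z :* D) :=
             con true :* (con true :* g :* d :* k :* h :* b :* l :* a :* i :* j :* c :* e) :* D :*
                 (z :* (z :* (z :* (z :* (z :* z)))))) ≈-refl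
             (p 13) (p 9) (p 19) (p 3) (p 21) (p 1) (p 7) (p 15) (p 17) (p 5) (p 11) z D ⟩
      1# * (1# * p 1 * p 3 * p 5 * p 7 * p 9 * p 11 * p 13 * p 15 * p 17 * p 19 * p 21) * D * Z
        ≈⟨ *-congʳ (*-congʳ (*-congˡ (poch-residues 1 2 11 n))) ⟨
      1# * poch 1 2 (n ℕ.* 11) * D * Z
        ≈⟨ *-congʳ (poch-residues 1 1 2 (n ℕ.* 11)) ⟨
      poch 1 1 (n ℕ.* 11 ℕ.* 2) * Z ∎
      where
      p = λ a → poch a 22 n
      z = p 22
      D = poch 2 2 (n ℕ.* 11)
      Z = z * (z * (z * (z * (z * z))))
      L = (p 13 * p 9 * z) * ((p 19 * p 3 * z) * ((p 21 * p 1 * z) * ((p 7 * p 15 * z) * (p 17 * p 5 * z))))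

  -- The generating function of 11-regular partitions modulo 2.

  odd : ℕ → Bool
  odd zero = false
  odd (suc n) = not (odd n)

  odd-+ : ∀ m n → odd (m ℕ.+ n) ≡ odd m xor odd n
  odd-+ zero n = refl
  odd-+ (suc m) n = trans (cong not (odd-+ m n)) (not-distribˡ-xor (odd m) (odd n))

  even⇒2∣ : ∀ n → odd n ≡ false → 2 ℕ.∣ n
  even⇒2∣ zero _ = ℕ.divides 0 refl
  even⇒2∣ (suc (suc n)) h with even⇒2∣ n (trans (sym (not-involutive (odd n))) h)
  ... | ℕ.divides k refl = ℕ.divides (suc k) refl

  ≤ᵇ-true : ∀ {m n} → m ≤ n → (m ≤ᵇ n) ≡ true
  ≤ᵇ-true h = Equivalence.to T-≡ (ℕ.≤⇒≤ᵇ h)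

  ≤ᵇ-false : ∀ {m n} → n < m → (m ≤ᵇ n) ≡ false
  ≤ᵇ-false {m} {n} h with m ≤ᵇ n in eq
  ... | false = refl
  ... | true = contradiction (ℕ.≤ᵇ⇒≤ m n (Equivalence.from T-≡ eq)) (ℕ.<⇒≱ h)

  summand : ℕ → ℕ → ℕ → ℕ
  summand k n c = if c ℕ.* suc k ≤ᵇ n then parts k (n ∸ c ℕ.* suc k) else 0

  summand-0 : ∀ k n c → n < c ℕ.* suc k → summand k n c ≡ 0
  summand-0 k n c h = cong (λ z → if z then parts k (n ∸ c ℕ.* suc k) else 0) (≤ᵇ-false h)

  summand-suc : ∀ k n c → summand k (suc k ℕ.+ n) (suc c) ≡ summand k n c
  summand-suc k n c = cong₂ (λ z w → if z then parts k w else 0) (≤ᵇ-+ (suc k) _ n)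
      (∸-+ (suc k) n (c ℕ.* suc k))
    where
    ∸-+ : ∀ a b c → a ℕ.+ b ∸ (a ℕ.+ c) ≡ b ∸ c
    ∸-+ a b c = ℕ.[m+n]∸[m+o]≡n∸o a b c
    ≤ᵇ-+ : ∀ a b c → (a ℕ.+ b ≤ᵇ a ℕ.+ c) ≡ (b ≤ᵇ c)
    ≤ᵇ-+ a b c with b ℕ.≤? c
    ... | yes p = trans (≤ᵇ-true (ℕ.+-monoʳ-≤ a p)) (sym (≤ᵇ-true p))
    ... | no p = trans (≤ᵇ-false (ℕ.+-monoʳ-< a (ℕ.≰⇒> p))) (sym (≤ᵇ-false (ℕ.≰⇒> p)))

  multSum-small : ∀ k n C → n < suc k → multSum k n (suc C) ≡ parts k n
  multSum-small k n zero h = refl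
  multSum-small k n (suc C) h = trans (cong₂ ℕ._+_ (multSum-small k n C h)
    (summand-0 k n (suc C) (ℕ.<-≤-trans h (ℕ.m≤m+n (suc k) _)))) (ℕ.+-identityʳ _)

  multSum-step : ∀ k n C → multSum k (suc k ℕ.+ n) (suc C) ≡ parts k (suc k ℕ.+ n) ℕ.+ multSum k n C
  multSum-step k n zero = sym (ℕ.+-identityʳ _)
  multSum-step k n (suc C) = trans (cong₂ ℕ._+_ (multSum-step k n C) (summand-suc k n C))
    (ℕ.+-assoc (parts k (suc k ℕ.+ n)) (multSum k n C) (summand k n C))

  multSum-stable : ∀ k n i → multSum k n (i ℕ.+ suc n) ≡ multSum k n (suc n)
  multSum-stable k n zero = refl
  multSum-stable k n (suc i) = trans (cong₂ ℕ._+_ (multSum-stable k n i)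
    (summand-0 k n (i ℕ.+ suc n) (ℕ.≤-trans (ℕ.m≤n+m (suc n) i) (ℕ.m≤m*n (i ℕ.+ suc n) (suc k)))))
        (ℕ.+-identityʳ _)

  -- Either the part k + 1 does not occur, or one copy of it is taken away. Modulo 2 this is
  -- multiplication by 1 + q^(k + 1).
  multSum-recurrence : ∀ k n → multSum k (suc k ℕ.+ n) (suc (suc k ℕ.+ n)) ≡
                       parts k (suc k ℕ.+ n) ℕ.+ multSum k n (suc n)
  multSum-recurrence k n = trans (multSum-step k n (suc k ℕ.+ n)) (cong (parts k (suc k ℕ.+ n) ℕ.+_)
    (trans (cong (multSum k n) (sym (ℕ.+-suc k n))) (multSum-stable k n k)))

  partsₛ : ℕ → Series
  partsₛ k n = odd (parts k n)

  factor : ℕ → Series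
  factor m = if m % 11 ≡ᵇ 0 then 1# + X m else 1#

  multSum-product : ∀ k → (λ n → odd (multSum k n (suc n))) * (1# + X (suc k)) ≈ partsₛ k
  multSum-product k = ≈-trans (solve 2 (λ g x → g :* (con true :+ x) := g :+ x :* g) ≈-refl g (X (suc k)))
      (mk at-n)
    where
    g : Series
    g n = odd (multSum k n (suc n))
    at-n : ∀ n → (g + X (suc k) * g) n ≡ odd (parts k n)
    at-n n with n ℕ.<? suc k
    ... | yes n<k = trans (cong₂ _xor_ (cong odd (multSum-small k n n n<k)) (X*-below (suc k) g n n<k))
        (xor-identityʳ _)
    ... | no n≮k with ℕ.m≤n⇒∃[o]m+o≡n (ℕ.≮⇒≥ n≮k)
    ...   | i , refl = begin
      g (suc k ℕ.+ i) xor (X (suc k) * g) (suc k ℕ.+ i)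
        ≡⟨ cong₂ _xor_ (trans (cong odd (multSum-recurrence k i)) (odd-+ (parts k (suc k ℕ.+ i)) _))
            (X*-at (suc k) g i) ⟩
      (odd (parts k (suc k ℕ.+ i)) xor g i) xor g i
        ≡⟨ xor-assoc (odd (parts k (suc k ℕ.+ i))) (g i) (g i) ⟩
      odd (parts k (suc k ℕ.+ i)) xor (g i xor g i)
        ≡⟨ cong (odd (parts k (suc k ℕ.+ i)) xor_) (xor-same (g i)) ⟩
      odd (parts k (suc k ℕ.+ i)) xor false
        ≡⟨ xor-identityʳ _ ⟩
      odd (parts k (suc k ℕ.+ i)) ∎
      where open ≡-Reasoning

  partsₛ-suc : ∀ k → partsₛ (suc k) * (1# + X (suc k)) ≈ partsₛ k * factor (suc k)
  partsₛ-suc k with suc k % 11 ≡ᵇ 0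
  ... | true = ≈-refl
  ... | false = ≈-trans (multSum-product k) (≈-sym (*-identityʳ _))

  factors : ℕ → Series
  factors zero = 1#
  factors (suc k) = factors k * factor (suc k)

  partsₛ-product : ∀ k → partsₛ k * poch 1 1 k ≈ factors k
  partsₛ-product zero = ≈-trans (*-congʳ parts-0) (*-identityʳ 1#)
    where
    parts-0 : partsₛ 0 ≈ 1#
    parts-0 = mk λ { zero → refl ; (suc n) → refl }
  partsₛ-product (suc k) = begin
    partsₛ (suc k) * (poch 1 1 k * (1# + X (1 ℕ.+ k ℕ.* 1)))
      ≈⟨ *-congˡ (*-congˡ (+-cong {1#} ≈-refl (reindex X (cong suc (ℕ.*-identityʳ k))))) ⟩
    partsₛ (suc k) * (poch 1 1 k * (1# + X (suc k)))
      ≈⟨ solve 3 (λ a b c → a :* (b :* c) := (a :* c) :* b) ≈-refl (partsₛ (suc k)) (poch 1 1 k)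
          (1# + X (suc k)) ⟩
    (partsₛ (suc k) * (1# + X (suc k))) * poch 1 1 k
      ≈⟨ *-congʳ (partsₛ-suc k) ⟩
    (partsₛ k * factor (suc k)) * poch 1 1 k
      ≈⟨ solve 3 (λ a b c → (a :* b) :* c := (a :* c) :* b) ≈-refl (partsₛ k) (factor (suc k))
          (poch 1 1 k) ⟩
    (partsₛ k * poch 1 1 k) * factor (suc k)
      ≈⟨ *-congʳ (partsₛ-product k) ⟩
    factors (suc k) ∎
    where open ≈-Reasoning

  -- Of eleven consecutive factors only the one at a multiple of 11 differs from 1.
  factors-poch : ∀ n → factors (n ℕ.* 11) ≈ poch 11 11 n
  factors-poch zero = ≈-refl
  factors-poch (suc n) = begin
    F * h 1 * h 2 * h 3 * h 4 * h 5 * h 6 * h 7 * h 8 * h 9 * h 10 * h 11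
      ≈⟨ *-cong (trivial 10 refl (trivial 9 refl (trivial 8 refl
          (trivial 7 refl (trivial 6 refl (trivial 5 refl
           (trivial 4 refl (trivial 3 refl (trivial 2 refl (trivial 1 refl (factors-poch n)))))))))))
           (factor-at 11) ⟩
    poch 11 11 n * (1# + X (11 ℕ.+ n ℕ.* 11)) ∎
    where
    open ≈-Reasoning
    F = factors (n ℕ.* 11)
    h : ℕ → Series
    h i = factor (i ℕ.+ n ℕ.* 11)
    factor-at : ∀ i → h i ≈ (if i % 11 ≡ᵇ 0 then 1# + X (i ℕ.+ n ℕ.* 11) else 1#)
    factor-at i = mk λ m → cong (λ z → (if z ≡ᵇ 0 then 1# + X (i ℕ.+ n ℕ.* 11) else 1#) m)
        (ℕ.[m+kn]%n≡m%n i n 11)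
    trivial : ∀ i → (i % 11 ≡ᵇ 0) ≡ false → ∀ {a b} → a ≈ b → a * h i ≈ b
    trivial i eq p = ≈-trans (*-cong p (≈-trans (factor-at i)
      (mk λ m → cong (λ z → (if z then 1# + X (i ℕ.+ n ℕ.* 11) else 1#) m) eq))) (*-identityʳ _)

  b : Series
  b n = odd (b₁₁ n)

  parts-stable : ∀ n i → partsₛ (i ℕ.+ n) n ≡ b n
  parts-stable n zero = refl
  parts-stable n (suc i) = trans (cong odd (step (i ℕ.+ n) (s≤s (ℕ.m≤n+m n i)))) (parts-stable n i)
    where
    step : ∀ k → n < suc k → parts (suc k) n ≡ parts k n
    step k h with suc k % 11 ≡ᵇ 0
    ... | true = refl
    ... | false = multSum-small k n n h

  b-partsₛ : ∀ n → b ≈[ n ] partsₛ (n ℕ.* 11)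
  b-partsₛ n = mk[] λ i i<n → sym (trans
    (cong (λ z → partsₛ z i) (trans (sym (ℕ.m+[n∸m]≡n (ℕ.≤-trans (ℕ.<⇒≤ i<n) (ℕ.m≤m*n n 11))))
        (ℕ.+-comm i _)))
    (parts-stable i (n ℕ.* 11 ∸ i)))

  b-product : b * f ≈ f₁₁
  b-product = ≈[]⇒≈ λ n →
    ≈[]-trans (*-cong[] (b-partsₛ n) (≈[]-sym (poch-f* n 10)))
    (≈[]-trans (≈⇒≈[] n (≈-trans (partsₛ-product (n ℕ.* 11)) (factors-poch n))) (poch-f₁₁ n 0))

  b-Θ₅ : b * f₂₂^5 ≈ Θ₅
  b-Θ₅ = *-cancelʳ (f₁₁ * (f * f)) refl (begin
    b * f₂₂^5 * (f₁₁ * (f * f))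
      ≈⟨ solve 4 (λ b s f e → b :* s :* (e :* (f :* f)) := f :* ((b :* f) :* e :* s)) ≈-refl b f₂₂^5 f f₁₁ ⟩
    f * ((b * f) * f₁₁ * f₂₂^5)
      ≈⟨ *-congˡ (*-congʳ (*-congʳ b-product)) ⟩
    f * (f₁₁ * f₁₁ * f₂₂^5)
      ≈⟨ Θ₅-product ⟨
    Θ₅ * (f₁₁ * (f * f)) ∎)
    where open ≈-Reasoning

-- Counting modulo 2: enumerations, involutions, bijections.

module Parities where

  open PowerSeries
  open import Data.Nat using (_≤_)

  module _ (S : DecSetoid 0ℓ 0ℓ) where
    open DecSetoid S using (setoid) renaming (Carrier to I)
    open Membership setoid using (_∈_)

    -- A repetition-free enumeration up to the equality of the setoid, remembered only through the
    -- parity of its length. By `parity-unique`, enumerating one predicate in two ways proves an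
    -- equation between coefficients; this is how all counting identities arise.
    record Parity (P : I → Set) (c : Bool) : Set where
      field
        list     : List I
        sound    : All P list
        complete : ∀ {x} → P x → x ∈ list
        unique   : Unique.Unique setoid list
        parity   : odd (length list) ≡ c

  module Counting (S : DecSetoid 0ℓ 0ℓ) where
    open DecSetoid S using (setoid; _≟_)
      renaming (Carrier to I; _≈_ to _∼_; refl to ∼-refl; sym to ∼-sym; trans to ∼-trans)
    open Membership setoid using (_∈_)
    open Unique setoid using (Unique)

    remove : I → List I → List I
    remove z = filter (λ y → ¬? (y ≟ z))

    ≁-resp : ∀ {z x y} → x ∼ y → ¬ x ∼ z → ¬ y ∼ z
    ≁-resp x∼y x≁z y∼z = x≁z (∼-trans x∼y y∼z)

    ∈-remove⁺ : ∀ {x z xs} → x ∈ xs → ¬ x ∼ z → x ∈ remove z xs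
    ∈-remove⁺ = Membershipₚ.∈-filter⁺ setoid _ ≁-resp

    ∈-remove⁻ : ∀ {x z xs} → x ∈ remove z xs → x ∈ xs × ¬ x ∼ z
    ∈-remove⁻ = Membershipₚ.∈-filter⁻ setoid _ ≁-resp

    remove-unique : ∀ {z xs} → Unique xs → Unique (remove z xs)
    remove-unique = Uniqueₚ.filter⁺ setoid _

    fresh : ∀ {x xs} → All (λ y → ¬ x ∼ y) xs → ¬ x ∈ xs
    fresh (h ∷ hs) (here p) = h p
    fresh (h ∷ hs) (there p) = fresh hs p

    length-remove : ∀ {z xs} → Unique xs → z ∈ xs → length xs ≡ suc (length (remove z xs))
    length-remove {z} {x ∷ xs} (x# ∷ _) (here z∼x) with x ≟ z
    ... | yes _ = cong suc (sym (cong length (List.filter-all _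
            (All.map (λ x≁y y∼z → x≁y (∼-sym (∼-trans y∼z z∼x))) x#))))
    ... | no x≁z = contradiction (∼-sym z∼x) x≁z
    length-remove {z} {x ∷ xs} (x# ∷ u) (there z∈xs) with x ≟ z
    ... | yes x∼z = contradiction (Membershipₚ.∈-resp-≈ setoid (∼-sym x∼z) z∈xs) (fresh x#)
    ... | no _ = cong suc (length-remove u z∈xs)

    length-unique : ∀ {xs ys} → Unique xs → Unique ys → (∀ {x} → x ∈ xs → x ∈ ys) →
        (∀ {x} → x ∈ ys → x ∈ xs) →
                    length xs ≡ length ys
    length-unique {[]} {[]} _ _ _ _ = refl
    length-unique {[]} {y ∷ ys} _ _ _ h with h (here ∼-refl)
    ... | ()
    length-unique {x ∷ xs} {ys} (x# ∷ u) v to from = trans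
      (cong suc (length-unique {xs} {remove x ys} u (remove-unique v) to′ from′))
          (sym (length-remove v (to (here ∼-refl))))
      where
      to′ : ∀ {y} → y ∈ xs → y ∈ remove x ys
      to′ y∈xs = ∈-remove⁺ (to (there y∈xs)) (λ y∼x → fresh x# (Membershipₚ.∈-resp-≈ setoid y∼x y∈xs))
      from′ : ∀ {y} → y ∈ remove x ys → y ∈ xs
      from′ y∈ with ∈-remove⁻ y∈
      ... | y∈ys , y≁x with from y∈ys
      ...   | here y∼x = contradiction y∼x y≁x
      ...   | there y∈xs = y∈xs

    member : ∀ {P : I → Set} {xs x} → All P xs → x ∈ xs → ∃ λ y → P y × x ∼ y
    member (p ∷ _) (here x∼y) = _ , p , x∼y
    member (_ ∷ ps) (there x∈xs) = member ps x∈xs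

    covers : ∀ {P : I → Set} {xs ys x} → All P xs → (∀ {x} → P x → x ∈ ys) → x ∈ xs → x ∈ ys
    covers ps h x∈xs with member ps x∈xs
    ... | y , py , x∼y = Membershipₚ.∈-resp-≈ setoid (∼-sym x∼y) (h py)

    parity-unique : ∀ {P c d} → Parity S P c → Parity S P d → c ≡ d
    parity-unique p r = trans (sym (Parity.parity p))
        (trans (cong odd (length-unique (Parity.unique p) (Parity.unique r)
      (covers (Parity.sound p) (Parity.complete r)) (covers (Parity.sound r) (Parity.complete p))))
          (Parity.parity r))

    parity-⇔ : ∀ {P Q c} → (∀ {x} → P x → Q x) → (∀ {x} → Q x → P x) → Parity S P c → Parity S Q c
    parity-⇔ to from p = record
      { list = Parity.list p ; sound = All.map to (Parity.sound p) ; complete = λ q → Parity.complete p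
          (from q)
      ; unique = Parity.unique p ; parity = Parity.parity p }

    parity-∅ : ∀ {P} → (∀ {x} → ¬ P x) → Parity S P false
    parity-∅ h = record { list = [] ; sound = [] ; complete = λ p → contradiction p h ; unique = [] ;
        parity = refl }

    parity-⊎ : ∀ {P Q R c d} → Parity S P c → Parity S Q d →
               (∀ {x} → P x → R x) → (∀ {x} → Q x → R x) → (∀ {x} → R x → P x ⊎ Q x) →
               (∀ {x y} → P x → Q y → ¬ x ∼ y) → Parity S R (c xor d)
    parity-⊎ {P} {Q} p r P⊆R Q⊆R R⊆ disjoint = record
      { list = P.list ++ Q.list
      ; sound = All.++⁺ (All.map P⊆R P.sound) (All.map Q⊆R Q.sound)
      ; complete = λ x → complete (R⊆ x)
      ; unique = Uniqueₚ.++⁺ setoid P.unique Q.unique λ where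
          (x∈P , x∈Q) → let y , py , x∼y = member P.sound x∈P ; z , qz , x∼z = member Q.sound x∈Q in
                        disjoint py qz (∼-trans (∼-sym x∼y) x∼z)
      ; parity = trans (cong odd (List.length-++ P.list))
          (trans (odd-+ (length P.list) _) (cong₂ _xor_ P.parity Q.parity)) }
      where
      module P = Parity p
      module Q = Parity r
      complete : ∀ {x} → P x ⊎ Q x → x ∈ P.list ++ Q.list
      complete (inj₁ px) = Any.++⁺ˡ (P.complete px)
      complete (inj₂ qx) = Any.++⁺ʳ P.list (Q.complete qx)

    parity-finite : ∀ {P : I → Set} → (∀ x → Dec (P x)) → (∀ {x y} → x ∼ y → P x → P y) →
                    (L : List I) → (∀ {x} → P x → x ∈ L) → ∃ (Parity S P)
    parity-finite P? resp L h = _ , record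
      { list = deduplicate _≟_ (filter P? L)
      ; sound = All.deduplicate⁺ _≟_ (All.all-filter P? L)
      ; complete = λ px → Membershipₚ.∈-deduplicate⁺ setoid _≟_ (λ y∼z x∼y → ∼-trans x∼y (∼-sym y∼z) )
          (Membershipₚ.∈-filter⁺ setoid P? resp (h px) px)
      ; unique = deduplicate-! S (filter P? L)
      ; parity = refl }

    module _ (σ : I → I) (σ-cong : ∀ {x y} → x ∼ y → σ x ∼ σ y) where

      private
        fixed? : ∀ x → Dec (σ x ∼ x)
        fixed? x = σ x ≟ x

        fixed-resp : ∀ {x y} → x ∼ y → σ x ∼ x → σ y ∼ y
        fixed-resp x∼y h = ∼-trans (σ-cong (∼-sym x∼y)) (∼-trans h x∼y)

        -- A head that is not fixed is deleted together with its partner, so the recursive call is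
        -- on a filtered tail; the bound `n` is there for termination.
        pairing : ∀ n xs → length xs ≤ n → Unique xs → (∀ {x} → x ∈ xs → σ x ∈ xs) →
            (∀ {x} → x ∈ xs → σ (σ x) ∼ x) →
                  odd (length (filter fixed? xs)) ≡ odd (length xs)
        pairing n [] _ _ _ _ = refl
        pairing (suc n) (x ∷ xs) (s≤s le) (x# ∷ u) closed invol with fixed? x
        ... | yes fx = cong not (pairing n xs le u closed′ (invol ∘ there))
          where
          closed′ : ∀ {y} → y ∈ xs → σ y ∈ xs
          closed′ {y} y∈xs with closed (there y∈xs)
          ... | there h = h
          ... | here σy∼x = contradiction (Membershipₚ.∈-resp-≈ setoid
                  (∼-trans (∼-sym (invol (there y∈xs))) (∼-trans (σ-cong σy∼x) fx)) y∈xs) (fresh x#)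
        ... | no ¬fx with closed (here ∼-refl)
        ...   | here σx∼x = contradiction σx∼x ¬fx
        ...   | there σx∈xs = trans (cong odd (fixed-remove u))
                  (trans (pairing n ys (ℕ.≤-trans (ℕ.≤-trans (ℕ.n≤1+n _) (ℕ.≤-reflexive (sym len))) le)
                            (remove-unique u) closed′ (invol ∘ there ∘ proj₁ ∘ ∈-remove⁻))
                    (sym (trans (cong (not ∘ odd) len) (not-involutive _))))
          where
          ys = remove (σ x) xs
          len : length xs ≡ suc (length ys)
          len = length-remove u σx∈xs
          σσx : σ (σ x) ∼ x
          σσx = invol (here ∼-refl)
          closed′ : ∀ {y} → y ∈ ys → σ y ∈ ys
          closed′ {y} y∈ys with ∈-remove⁻ y∈ys
          ... | y∈xs , y≁σx with closed (there y∈xs)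
          ...   | here σy∼x = contradiction (∼-trans (∼-sym (invol (there y∈xs))) (σ-cong σy∼x)) y≁σx
          ...   | there σy∈xs = ∈-remove⁺ σy∈xs λ σy∼σx → fresh x# (Membershipₚ.∈-resp-≈ setoid
                    (∼-trans (∼-sym (invol (there y∈xs))) (∼-trans (σ-cong σy∼σx) σσx)) y∈xs)
          fixed-remove : ∀ {xs} → Unique xs → length (filter fixed? xs) ≡ length
              (filter fixed? (remove (σ x) xs))
          fixed-remove {[]} _ = refl
          fixed-remove {y ∷ xs} (_ ∷ u) with y ≟ σ x | fixed? y
          ... | yes y∼σx | yes fy = contradiction (∼-trans (∼-sym y∼σx)
              (∼-trans (∼-sym fy) (∼-trans (σ-cong y∼σx) σσx))) ¬fx
          ... | yes y∼σx | no _ = fixed-remove u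
          ... | no _ | yes fy rewrite List.filter-accept fixed? {xs = remove (σ x) xs} fy = cong suc
              (fixed-remove u)
          ... | no _ | no ¬fy rewrite List.filter-reject fixed? {xs = remove (σ x) xs} ¬fy = fixed-remove u

      parity-involution : ∀ {P c} → (∀ {x} → P x → P (σ x)) → (∀ {x} → P x → σ (σ x) ∼ x) →
                          Parity S P c → Parity S (λ x → P x × σ x ∼ x) c
      parity-involution {P} σP σσ p = record
        { list = filter fixed? p.list
        ; sound = All.zip (All.filter⁺ fixed? p.sound , All.all-filter fixed? p.list)
        ; complete = λ (px , fx) → Membershipₚ.∈-filter⁺ setoid fixed? fixed-resp (p.complete px) fx
        ; unique = Uniqueₚ.filter⁺ setoid fixed? p.unique
        ; parity = trans (pairing (length p.list) p.list ℕ.≤-refl p.unique closed invol) p.parity }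
        where
        module p = Parity p
        closed : ∀ {x} → x ∈ p.list → σ x ∈ p.list
        closed x∈ with member p.sound x∈
        ... | y , py , x∼y = Membershipₚ.∈-resp-≈ setoid (σ-cong (∼-sym x∼y)) (p.complete (σP py))
        invol : ∀ {x} → x ∈ p.list → σ (σ x) ∼ x
        invol x∈ with member p.sound x∈
        ... | y , py , x∼y = ∼-trans (σ-cong (σ-cong x∼y)) (∼-trans (σσ py) (∼-sym x∼y))

  open Counting

  module _ (S T : DecSetoid 0ℓ 0ℓ) where
    private
      module S = DecSetoid S
      module T = DecSetoid T

    parity-image : ∀ {P Q c} (φ : S.Carrier → T.Carrier) → (∀ {x y} → x S.≈ y → φ x T.≈ φ y) →
                   (∀ {x} → P x → Q (φ x)) → (∀ {x y} → P x → P y → φ x T.≈ φ y → x S.≈ y) →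
                   (∀ {y} → Q y → ∃ λ x → P x × φ x T.≈ y) → Parity S P c → Parity T Q c
    parity-image {P} {Q} φ φ-cong φP inj surj p = record
      { list = map φ p.list
      ; sound = All.map⁺ (All.map φP p.sound)
      ; complete = λ qy → let x , px , φx≈y = surj qy in
          Membershipₚ.∈-resp-≈ T.setoid φx≈y (Membershipₚ.∈-map⁺ S.setoid T.setoid φ-cong (p.complete px))
      ; unique = unique p.sound p.unique
      ; parity = trans (cong odd (List.length-map φ p.list)) p.parity }
      where
      module p = Parity p
      unique : ∀ {xs} → All P xs → Unique.Unique S.setoid xs → Unique.Unique T.setoid (map φ xs)
      unique [] [] = []
      unique (px ∷ ps) (x# ∷ u) = All.map⁺ (All.zipWith (λ (py , x≉y) φx≈φy → x≉y (inj px py φx≈φy))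
          (ps , x#)) ∷ unique ps u

    parity-× : ∀ {P Q c d} → Parity S P c → Parity T Q d → Parity (×-decSetoid S T) (λ (x , y) → P x × Q y)
        (c ∧ d)
    parity-× {P} {Q} p r = record
      { list = cartesianProduct p.list r.list
      ; sound = sound p.sound
      ; complete = λ (px , qy) → Membershipₚ.∈-cartesianProduct⁺ S.setoid T.setoid (p.complete px)
          (r.complete qy)
      ; unique = Uniqueₚ.cartesianProduct⁺ S.setoid T.setoid p.unique r.unique
      ; parity = trans (parity p.list) (cong₂ _∧_ p.parity r.parity) }
      where
      module p = Parity p
      module r = Parity r
      sound : ∀ {xs} → All P xs → All (λ (x , y) → P x × Q y) (cartesianProduct xs r.list)
      sound [] = []
      sound (px ∷ ps) = All.++⁺ (All.map⁺ (All.map (px ,_) r.sound)) (sound ps)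
      xor-∧ : ∀ x y → y xor (x ∧ y) ≡ not x ∧ y
      xor-∧ false y = xor-identityʳ y
      xor-∧ true false = refl
      xor-∧ true true = refl
      parity : ∀ xs → odd (length (cartesianProduct xs r.list)) ≡ odd (length xs) ∧ odd (length r.list)
      parity [] = refl
      parity (x ∷ xs) = trans (cong odd (List.length-++ (map (x ,_) r.list)))
        (trans (odd-+ (length (map (x ,_) r.list)) _)
        (trans (cong₂ _xor_ (cong odd (List.length-map (x ,_) r.list)) (parity xs))
            (xor-∧ (odd (length xs)) _)))

  -- Series whose coefficients count points of given degree.

  Counts : (S : DecSetoid 0ℓ 0ℓ) → Series → (ℕ → DecSetoid.Carrier S → Set) → Set
  Counts S a D = ∀ n → Parity S (D n) (a n)

  Convolution : ∀ {I J : Set} → (ℕ → I → Set) → (ℕ → J → Set) → ℕ → I × J → Set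
  Convolution D E n (x , y) = ∃₂ λ k l → k ℕ.+ l ≡ n × D k x × E l y

  module _ (S T : DecSetoid 0ℓ 0ℓ) where
    private
      module S = DecSetoid S
      module T = DecSetoid T

    -- Follows the recursion of the product: first component of degree 0, or of positive degree. The
    -- functionality of `D` makes these two cases disjoint.
    counts-* : ∀ {a b D E} → (∀ {m n x y} → D m x → D n y → x S.≈ y → m ≡ n) →
               Counts S a D → Counts T b E → Counts (×-decSetoid S T) (a * b) (Convolution D E)
    counts-* {a} {b} {D} {E} D-functional p r zero = parity-⇔ (×-decSetoid S T)
      (λ (d , e) → 0 , 0 , refl , d , e) (λ { (0 , 0 , refl , d , e) → d , e }) (parity-× S T (p 0) (r 0))
    counts-* {a} {b} {D} {E} D-functional p r (suc n) = parity-⊎ (×-decSetoid S T)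
      (parity-× S T (p 0) (r (suc n)))
      (counts-* {a = tl a} {D = λ k → D (suc k)} {E} (λ d d' eq → ℕ.suc-injective (D-functional d d' eq))
          (p ∘ suc) r n)
      (λ (d , e) → 0 , suc n , refl , d , e)
      (λ { (k , l , eq , d , e) → suc k , l , cong suc eq , d , e })
      (λ { (zero , .(suc n) , refl , d , e) → inj₁ (d , e)
         ; (suc k , l , eq , d , e) → inj₂ (k , l , ℕ.suc-injective eq , d , e) })
      (λ { (d , _) (k , _ , _ , d' , _) (x≈y , _) → ℕ.0≢1+n (D-functional d d' x≈y) })

  counts-dilate : ∀ S {a D} m → Counts S a D → Counts S (dilate (suc m) a)
      (λ n x → ∃ λ k → k ℕ.* suc m ≡ n × D k x)
  counts-dilate S m p n = go 0 n p
    where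
    go : ∀ {a D} c n → Counts S a D → Parity S (λ x → ∃ λ k → c ℕ.+ k ℕ.* suc m ≡ n × D k x)
        (interleave a m c n)
    go zero zero p = parity-⇔ S (λ d → 0 , refl , d) (λ { (0 , _ , d) → d }) (p 0)
    go zero (suc n) p = parity-⇔ S (λ { (k , eq , d) → suc k , cong suc eq , d })
      (λ { (suc k , eq , d) → k , ℕ.suc-injective eq , d }) (go m n (p ∘ suc))
    go (suc c) zero p = parity-∅ S λ { (_ , () , _) }
    go (suc c) (suc n) p = parity-⇔ S (λ { (k , eq , d) → k , cong suc eq , d })
      (λ { (k , eq , d) → k , ℕ.suc-injective eq , d }) (go c n p)

  ℤₛ : DecSetoid 0ℓ 0ℓ
  ℤₛ = ℤ.≡-decSetoid

  ints-complete : ∀ n {j} → ∣ j ∣ ≤ n → Membership._∈_ (DecSetoid.setoid ℤₛ) j (ints n)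
  ints-complete zero {+ zero} _ = here refl
  ints-complete (suc n) {j} h with ℕ.m≤n⇒m<n∨m≡n h
  ... | inj₁ (s≤s h') = there (there (ints-complete n h'))
  ints-complete (suc n) {+ _} h | inj₂ refl = here refl
  ints-complete (suc n) { -[1+ _ ]} h | inj₂ refl = there (here refl)

  ints-bounded : ∀ n → All (λ j → ∣ j ∣ ≤ n) (ints n)
  ints-bounded zero = z≤n ∷ []
  ints-bounded (suc n) = ℕ.≤-refl ∷ ℕ.≤-refl ∷ All.map ℕ.m≤n⇒m≤1+n (ints-bounded n)

  ints-unique : ∀ n → Unique.Unique (DecSetoid.setoid ℤₛ) (ints n)
  ints-unique zero = [] ∷ []
  ints-unique (suc n) = ((λ ()) ∷ big (λ { refl → ℕ.≤-refl })) ∷ big (λ { refl → ℕ.≤-refl }) ∷ ints-unique n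
    where
    big : ∀ {i} → (∀ {j} → i ≡ j → suc n ≤ ∣ j ∣) → All (λ j → ¬ i ≡ j) (ints n)
    big h = All.map (λ j≤n i≡j → ℕ.<⇒≱ (h i≡j) j≤n) (ints-bounded n)

  counts-theta : ∀ a b → Counts ℤₛ (theta (suc a) (suc b)) (λ n j → weight (suc a) (suc b) j ≡ n)
  counts-theta a b n = record
    { list = filter (λ j → w j ℕ.≟ n) (ints n)
    ; sound = All.all-filter _ (ints n)
    ; complete = λ {j} eq → Membershipₚ.∈-filter⁺ (DecSetoid.setoid ℤₛ) _ (λ { refl h → h })
        (ints-complete n (ℕ.≤-trans (weight-≥ a b j) (ℕ.≤-reflexive eq))) eq
    ; unique = Uniqueₚ.filter⁺ (DecSetoid.setoid ℤₛ) _ (ints-unique n)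
    ; parity = parity (ints n) }
    where
    w = weight (suc a) (suc b)
    X-refl : ∀ n → X n n ≡ true
    X-refl zero = refl
    X-refl (suc n) = X-refl n
    X-≢ : ∀ m n → m ≢ n → X m n ≡ false
    X-≢ zero zero h = contradiction refl h
    X-≢ zero (suc n) h = refl
    X-≢ (suc m) zero h = refl
    X-≢ (suc m) (suc n) h = X-≢ m n (h ∘ cong suc)
    parity : ∀ L → odd (length (filter (λ j → w j ℕ.≟ n) L)) ≡ sum (λ j → X (w j)) L n
    parity [] = sym (0#-at n)
    parity (j ∷ L) = by-cases (w j ℕ.≟ n)
      where
      rest = sum (λ j → X (w j)) L n
      by-cases : Dec (w j ≡ n) → odd (length (filter (λ j → w j ℕ.≟ n) (j ∷ L))) ≡ X (w j) n xor rest
      by-cases (yes eq) = trans (cong (odd ∘ length) (List.filter-accept (λ j → w j ℕ.≟ n) {j} {L} eq))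
        (trans (cong not (parity L)) (cong (_xor rest) (sym (trans (cong (λ m → X m n) eq) (X-refl n)))))
      by-cases (no neq) = trans (cong (odd ∘ length) (List.filter-reject (λ j → w j ℕ.≟ n) {j} {L} neq))
        (trans (parity L) (cong (_xor rest) (sym (X-≢ (w j) n neq))))

-- Integers modulo small numbers, and integer vectors up to sign.

module Lattice where

  open PowerSeries using (Series; _≈_; at; q; X; X*-at; X*-below; dilate; slice; ev; f; f₁₁; ψ; Θ₅;
                           triangle; triangle-square; weight; ints; theta)
  open Parities
  open Counting
  open import Data.Integer.Tactic.RingSolver using (solve-∀)
  open import Data.Integer using (_+_; _*_; _-_; -_; _≤_)

  -- The last premise is c (x - y) = d (a - b) with the subtractions moved across.
  linear : ∀ c d {x y a b} .{{_ : NonZero c}} → a ≡ b → c * x + d * b ≡ c * y + d * a → x ≡ y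
  linear c d {x} {y} refl eq = ℤ.*-cancelˡ-≡ c x y (∙-cancelʳ _ _ _ eq)
    where open import Algebra.Properties.Group (AbelianGroup.group ℤ.+-0-abelianGroup) using (∙-cancelʳ)

  linear₂ : ∀ c d e {x y a b a′ b′} .{{_ : NonZero c}} → a ≡ b → a′ ≡ b′ →
            c * x + (d * b + e * b′) ≡ c * y + (d * a + e * a′) → x ≡ y
  linear₂ c d e {x} {y} refl refl eq = ℤ.*-cancelˡ-≡ c x y (∙-cancelʳ _ _ _ eq)
    where open import Algebra.Properties.Group (AbelianGroup.group ℤ.+-0-abelianGroup) using (∙-cancelʳ)

  residue : ∀ n .{{_ : ℕ.NonZero n}} k → ∃₂ λ (r : Fin n) t → k ≡ t * + n + + toℕ r
  residue n k = fromℕ< (n%ℕd<d k n) , k /ℕ n , trans (a≡a%ℕn+[a/ℕn]*n k n)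
    (trans (ℤ.+-comm (+ (k %ℕ n)) (k /ℕ n * + n)) (cong (λ r → k /ℕ n * + n + + r)
        (sym (Fin.toℕ-fromℕ< (n%ℕd<d k n)))))

  -- The standard source of contradictions below: an impossible congruence is brought into this
  -- shape by a ring identity, and the resulting divisibility of numerals is refuted by decision.
  residue-0 : ∀ {n m} t → t * + n + + m ≡ + 0 → n ℕ.∣ m
  residue-0 {n} {m} t eq = ℤ.∣⇒∣ᵤ {+ n} {+ m} (ℤ.divides (- t) (linear (+ 1) (+ 1) eq (ring t (+ n) (+ m))))
    where
    ring : ∀ t n m → + 1 * m + + 1 * + 0 ≡ + 1 * (- t * n) + + 1 * (t * n + m)
    ring = solve-∀

  Even Odd : ℤ → Set
  Even x = ∃ λ k → x ≡ + 2 * k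
  Odd x = ∃ λ k → x ≡ + 2 * k + + 1

  even⊎odd : ∀ x → Even x ⊎ Odd x
  even⊎odd x with residue 2 x
  ... | zero , t , eq = inj₁ (t , trans eq (trans (ℤ.+-identityʳ _) (ℤ.*-comm t (+ 2))))
  ... | suc zero , t , eq = inj₂ (t , trans eq (cong (_+ + 1) (ℤ.*-comm t (+ 2))))

  ¬even×odd : ∀ {x} → Even x → ¬ Odd x
  ¬even×odd (k , refl) (l , eq) with residue-0 {2} {1} (l - k) (linear (+ 1) (+ 1) (sym eq) (ring k l))
    where
    ring : ∀ k l → + 1 * ((l - k) * + 2 + + 1) + + 1 * (+ 2 * k) ≡ + 1 * + 0 + + 1 * (+ 2 * l + + 1)
    ring = solve-∀
  ... | ℕ.divides zero ()
  ... | ℕ.divides (suc _) ()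

  odd? : ∀ x → Dec (Odd x)
  odd? x with even⊎odd x
  ... | inj₁ e = no (¬even×odd e)
  ... | inj₂ o = yes o

  Odd-neg : ∀ {x} → Odd x → Odd (- x)
  Odd-neg (k , refl) = - k - + 1 , ring k
    where
    ring : ∀ k → - (+ 2 * k + + 1) ≡ + 2 * (- k - + 1) + + 1
    ring = solve-∀

  -- The form 4 k + 1 selects one of ± x. Since (4 k + 1)² = 8 (2 k² + k) + 1 and 2 k² + k is the
  -- exponent in ψ, the series ψ counts odd squares with their roots up to sign.
  odd⇒±1mod4 : ∀ {x} → Odd x → ∃ λ k → + 4 * k + + 1 ≡ x ⊎ + 4 * k + + 1 ≡ - x
  odd⇒±1mod4 (k , refl) with even⊎odd k
  ... | inj₁ (l , refl) = l , inj₁ (ring l)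
    where
    ring : ∀ l → + 4 * l + + 1 ≡ + 2 * (+ 2 * l) + + 1
    ring = solve-∀
  ... | inj₂ (l , refl) = - l - + 1 , inj₂ (ring l)
    where
    ring : ∀ l → + 4 * (- l - + 1) + + 1 ≡ - (+ 2 * (+ 2 * l + + 1) + + 1)
    ring = solve-∀

  1mod4-injective : ∀ {k l} → + 4 * k + + 1 ≡ + 4 * l + + 1 ⊎ + 4 * k + + 1 ≡ - (+ 4 * l + + 1) → k ≡ l
  1mod4-injective {k} {l} (inj₁ eq) = linear (+ 4) (+ 1) eq (ring k l)
    where
    ring : ∀ k l → + 4 * k + + 1 * (+ 4 * l + + 1) ≡ + 4 * l + + 1 * (+ 4 * k + + 1)
    ring = solve-∀
  1mod4-injective {k} {l} (inj₂ eq) = contradiction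
    (residue-0 {4} {2} (k + l) (linear (+ 1) (+ 1) eq (ring k l))) (from-no (4 ℕ.∣? 2))
    where
    ring : ∀ k l → + 1 * ((k + l) * + 4 + + 2) + + 1 * - (+ 4 * l + + 1) ≡ + 1 * + 0 + + 1 * (+ 4 * k + + 1)
    ring = solve-∀

  weight-formula : ∀ a b j → + 2 * + weight a b j ≡ + a * (j * (j + + 1)) + + b * (j * (j - + 1))
  weight-formula a b j = formula j
    where
    push : ∀ t k c → + (t ℕ.* (a ℕ.+ b) ℕ.+ k ℕ.* c) ≡ + t * (+ a + + b) + + k * + c
    push t k c = trans (ℤ.pos-+ (t ℕ.* (a ℕ.+ b)) (k ℕ.* c))
      (cong₂ _+_ (trans (ℤ.pos-* t (a ℕ.+ b)) (cong (+ t *_) (ℤ.pos-+ a b))) (ℤ.pos-* k c))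
    square : ∀ k → + triangle k + + triangle k + + k ≡ + k * + k
    square k = trans (cong +_ (triangle-square k)) (ℤ.pos-* k k)
    ring⁺ : ∀ t k a b → + 1 * (+ 2 * (t * (a + b) + k * a)) + (a + b) * (k * k) ≡
            + 1 * (a * (k * (k + + 1)) + b * (k * (k - + 1))) + (a + b) * (t + t + k)
    ring⁺ = solve-∀
    ring⁻ : ∀ t k a b → + 1 * (+ 2 * (t * (a + b) + k * b)) + (a + b) * (k * k) ≡
            + 1 * (a * (- k * (- k + + 1)) + b * (- k * (- k - + 1))) + (a + b) * (t + t + k)
    ring⁻ = solve-∀
    formula : ∀ j → + 2 * + weight a b j ≡ + a * (j * (j + + 1)) + + b * (j * (j - + 1))
    formula (+ k) = trans (cong (+ 2 *_) (push (triangle k) k a))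
      (linear (+ 1) (+ a + + b) (square k) (ring⁺ (+ triangle k) (+ k) (+ a) (+ b)))
    formula -[1+ k ] = trans (cong (+ 2 *_) (push (triangle (suc k)) (suc k) b))
      (linear (+ 1) (+ a + + b) (square (suc k)) (ring⁻ (+ triangle (suc k)) (+ suc k) (+ a) (+ b)))

  Weighted : (S : DecSetoid 0ℓ 0ℓ) → Series → (DecSetoid.Carrier S → ℕ) → Set
  Weighted S a w = Counts S a (λ n x → w x ≡ n)

  module _ {S T : DecSetoid 0ℓ 0ℓ} where
    open DecSetoid S using () renaming (_≈_ to _≈₁_)

    weighted-* : ∀ {a b w w′} → (∀ {x y} → x ≈₁ y → w x ≡ w y) →
                 Weighted S a w → Weighted T b w′ → Weighted (×-decSetoid S T) (a PowerSeries.* b)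
                     (λ (x , y) → w x ℕ.+ w′ y)
    weighted-* w-cong p r n = parity-⇔ (×-decSetoid S T)
      (λ { (_ , _ , eq , refl , refl) → eq }) (λ eq → _ , _ , eq , refl , refl)
      (counts-* S T (λ eq eq' x≈y → trans (sym eq) (trans (w-cong x≈y) eq')) p r n)

  weighted-dilate : ∀ {S a w} m → Weighted S a w → Weighted S (dilate (suc m) a) (λ x → w x ℕ.* suc m)
  weighted-dilate {S} m p n = parity-⇔ S (λ { (_ , eq , refl) → eq }) (λ eq → _ , eq , refl)
      (counts-dilate S m p n)

  weighted-X : ∀ {S a w} c → Weighted S a w → Weighted S (X c PowerSeries.* a) (λ x → c ℕ.+ w x)
  weighted-X {S} {a} {w} c p n with n ℕ.<? c
  ... | yes n<c rewrite X*-below c a n n<c = parity-∅ S λ eq → ℕ.<⇒≱ n<c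
      (ℕ.≤-trans (ℕ.m≤m+n c _) (ℕ.≤-reflexive eq))
  ... | no n≮c with ℕ.m≤n⇒∃[o]m+o≡n (ℕ.≮⇒≥ n≮c)
  ...   | k , refl rewrite X*-at c a k = parity-⇔ S (cong (c ℕ.+_)) (ℕ.+-cancelˡ-≡ c _ _) (p k)

  neg : ∀ {n} → Vec ℤ n → Vec ℤ n
  neg = Vec.map (-_)

  neg-neg : ∀ {n} (v : Vec ℤ n) → neg (neg v) ≡ v
  neg-neg [] = refl
  neg-neg (x ∷ v) = cong₂ _∷_ (ℤ.neg-involutive x) (neg-neg v)

  -- In this setoid an involution fixes the class of v when it sends v to v or to - v; every use of
  -- an involution has to deal with both.
  ℤ±_ : ℕ → DecSetoid 0ℓ 0ℓ
  ℤ± n = record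
    { Carrier = Vec ℤ n
    ; _≈_ = λ v w → v ≡ w ⊎ v ≡ neg w
    ; isDecEquivalence = record
      { isEquivalence = record { refl = inj₁ refl ; sym = ±-sym ; trans = ±-trans }
      ; _≟_ = λ v w → Vec.≡-dec ℤ._≟_ v w ⊎-dec Vec.≡-dec ℤ._≟_ v (neg w) } }
    where
    ±-sym : ∀ {v w : Vec ℤ n} → v ≡ w ⊎ v ≡ neg w → w ≡ v ⊎ w ≡ neg v
    ±-sym (inj₁ refl) = inj₁ refl
    ±-sym {v} {w} (inj₂ refl) = inj₂ (sym (neg-neg w))
    ±-trans : ∀ {u v w : Vec ℤ n} → u ≡ v ⊎ u ≡ neg v → v ≡ w ⊎ v ≡ neg w → u ≡ w ⊎ u ≡ neg w
    ±-trans (inj₁ refl) q = q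
    ±-trans (inj₂ refl) (inj₁ refl) = inj₂ refl
    ±-trans {w = w} (inj₂ refl) (inj₂ refl) = inj₁ (neg-neg w)

  box : ℕ → ∀ n → List (Vec ℤ n)
  box B zero = [] ∷ []
  box B (suc n) = cartesianProductWith _∷_ (ints B) (box B n)

  box-complete : ∀ B {n} {v : Vec ℤ n} → VecAll.All (λ x → ∣ x ∣ ℕ.≤ B) v → v ∈ₚ box B n
  box-complete B [] = here refl
  box-complete B (h ∷ hs) = ∈.∈-cartesianProductWith⁺ _∷_ (ints-complete B h) (box-complete B hs)

  -- Boundedness gives only the existence of a parity. Its value is found later: involutions carry
  -- the unknown value to a simpler predicate, and `parity-unique` compares it there with a known
  -- series.
  parity-bounded : ∀ B {n} {P : Vec ℤ n → Set} → (∀ v → Dec (P v)) → (∀ v → P v → P (neg v)) →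
                   (∀ v → P v → VecAll.All (λ x → ∣ x ∣ ℕ.≤ B) v) → ∃ (Parity (ℤ± n) P)
  parity-bounded B {n} {P} P? P-neg bound = parity-finite (ℤ± n) P?
    (λ { (inj₁ refl) p → p ; {_} {w} (inj₂ refl) p → subst P (neg-neg w) (P-neg _ p) })
    (box B n) (λ {v} p → Any.map inj₁ (box-complete B (bound v p)))

  0≤x² : ∀ x → + 0 ≤ x * x
  0≤x² (+ n) = subst (+ 0 ≤_) (ℤ.pos-* n n) (+≤+ z≤n)
  0≤x² -[1+ n ] = +≤+ z≤n

  infixr 6 _⊕_
  _⊕_ : ∀ {x y} → + 0 ≤ x → + 0 ≤ y → + 0 ≤ x + y
  _⊕_ = ℤ.+-mono-≤

  square-bound : ∀ x {r} M → + 0 ≤ r → x * x + r ≡ + M → ∣ x ∣ ℕ.≤ M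
  square-bound x {r} M r≥0 eq = ℤ.drop‿+≤+ (ℤ.≤-trans (∣x∣≤x² x) (ℤ.≤-trans
    (subst (_≤ x * x + r) (ℤ.+-identityʳ (x * x)) (ℤ.+-monoʳ-≤ (x * x) r≥0)) (ℤ.≤-reflexive eq)))
    where
    m≤m² : ∀ m → m ℕ.≤ m ℕ.* m
    m≤m² zero = z≤n
    m≤m² (suc m) = ℕ.m≤m*n (suc m) (suc m)
    ∣x∣≤x² : ∀ x → + ∣ x ∣ ≤ x * x
    ∣x∣≤x² (+ n) = subst (+ n ≤_) (ℤ.pos-* n n) (+≤+ (m≤m² n))
    ∣x∣≤x² -[1+ n ] = +≤+ (m≤m² (suc n))

  -- A binary form of discriminant -11 and the modular equation.

  ℤ²ₛ : DecSetoid 0ℓ 0ℓ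
  ℤ²ₛ = ×-decSetoid ℤₛ ℤₛ

  _⟨+⟩_ : (ℤ → ℕ) → (ℤ → ℕ) → ℤ × ℤ → ℕ
  (w ⟨+⟩ w′) (κ , l) = w κ ℕ.+ w′ l ℕ.* 11

  counts-g : Weighted ℤ²ₛ (f PowerSeries.* f₁₁) (weight 2 1 ⟨+⟩ weight 2 1)
  counts-g = weighted-* {ℤₛ} {ℤₛ} (cong (weight 2 1)) (counts-theta 1 0)
      (weighted-dilate 10 (counts-theta 1 0))

  counts-ψψ : Weighted ℤ²ₛ (ψ PowerSeries.* dilate 11 ψ) (weight 3 1 ⟨+⟩ weight 3 1)
  counts-ψψ = weighted-* {ℤₛ} {ℤₛ} (cong (weight 3 1)) (counts-theta 2 0)
      (weighted-dilate 10 (counts-theta 2 0))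

  pair≡ : ∀ {a b c d : ℤ} → a ≡ c → b ≡ d → _≡_ {A = Vec ℤ 2} (a ∷ b ∷ []) (c ∷ d ∷ [])
  pair≡ refl refl = refl

  fst≡ : ∀ {a b c d : ℤ} → _≡_ {A = Vec ℤ 2} (a ∷ b ∷ []) (c ∷ d ∷ []) → a ≡ c
  fst≡ refl = refl

  snd≡ : ∀ {a b c d : ℤ} → _≡_ {A = Vec ℤ 2} (a ∷ b ∷ []) (c ∷ d ∷ []) → b ≡ d
  snd≡ refl = refl

  weights⇒ : ∀ a b c d κ l {n} → (weight a b ⟨+⟩ weight c d) (κ , l) ≡ n →
             (+ a * (κ * (κ + + 1)) + + b * (κ * (κ - + 1))) + (+ c * (l * (l + + 1)) + + d *
                 (l * (l - + 1))) * + 11 ≡ + 2 * + n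
  weights⇒ a b c d κ l refl = trans (sym (cong₂ (λ x y → x + y * + 11) (weight-formula a b κ)
      (weight-formula c d l)))
    (trans (ring (+ weight a b κ) (+ weight c d l))
      (cong (+ 2 *_) (sym (trans (ℤ.pos-+ (weight a b κ) _)
          (cong (λ z → + weight a b κ + z) (ℤ.pos-* (weight c d l) 11))))))
    where
    ring : ∀ x y → + 2 * x + + 2 * y * + 11 ≡ + 2 * (x + y * + 11)
    ring = solve-∀

  weights⇐ : ∀ a b c d κ l {n} →
             (+ a * (κ * (κ + + 1)) + + b * (κ * (κ - + 1))) + (+ c * (l * (l + + 1)) + + d *
                 (l * (l - + 1))) * + 11 ≡ + 2 * + n →
             (weight a b ⟨+⟩ weight c d) (κ , l) ≡ n
  weights⇐ a b c d κ l eq = ℤ.+-injective (ℤ.*-cancelˡ-≡ (+ 2) _ _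
      (trans (sym (weights⇒ a b c d κ l refl)) eq))

  -- Two diagonalisations are used: 12 F = (6 t - 5 s)² + 11 s² leads to pentagonal numbers, and 4 F
  -- = (s + t)² + 11 (s - t)² leads to triangular numbers.
  F : ℤ → ℤ → ℤ
  F s t = + 3 * (s * s) - + 5 * (s * t) + + 3 * (t * t)

  ψ₄ : Series
  ψ₄ = dilate 2 (dilate 2 ψ)

  counts-ψ₄ : Weighted ℤₛ ψ₄ (λ k → weight 3 1 k ℕ.* 2 ℕ.* 2)
  counts-ψ₄ = weighted-dilate 1 (weighted-dilate 1 (counts-theta 2 0))

  weight-ψ₄ : ∀ k → + (weight 3 1 k ℕ.* 2 ℕ.* 2) ≡ + 8 * (k * k) + + 4 * k
  weight-ψ₄ k = trans (ℤ.pos-* (weight 3 1 k ℕ.* 2) 2) (trans (cong (_* + 2) (ℤ.pos-* (weight 3 1 k) 2))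
    (linear (+ 1) (+ 2) (weight-formula 3 1 k) (ring k (+ weight 3 1 k))))
    where
    ring : ∀ k w → + 1 * (w * + 2 * + 2) + + 2 * (+ 3 * (k * (k + + 1)) + + 1 * (k * (k - + 1))) ≡
           + 1 * (+ 8 * (k * k) + + 4 * k) + + 2 * (+ 2 * w)
    ring = solve-∀

  -- The solutions of F s t = 2 j + 1 with s odd, up to sign, are counted in two ways.  With 3 ∤ s they are
  -- s = 6 l + 1, t = κ + 5 l + 1 for pentagonal κ, l, and t ↦ 5 s / 3 - t pairs off those with 3 ∣ s.
  -- With t even, s + t and s - t are odd, and for t odd exchanging s and t leaves s = ± t.
  module Binary (j : ℕ) where

    N : ℤ
    N = + 2 * + j + + 1

    Sol : (ℤ → ℤ → Set) → Vec ℤ 2 → Set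
    Sol C (s ∷ t ∷ []) = F s t ≡ N × Odd s × C s t

    F-neg : ∀ s t → F (- s) (- t) ≡ F s t
    F-neg = ring
      where
      ring : ∀ s t → + 3 * (- s * - s) - + 5 * (- s * - t) + + 3 * (- t * - t) ≡ + 3 * (s * s) - + 5 *
          (s * t) + + 3 * (t * t)
      ring = solve-∀

    3∣ : ℤ → ℤ → Set
    3∣ s t = ∃ λ u → s ≡ + 3 * u

    -- Here s = 6 l + 1 and 6 t - 5 s = 6 κ + 1. As (6 κ + 1)² is 1 plus 24 times a pentagonal
    -- number, dividing (6 κ + 1)² + 11 (6 l + 1)² = 24 j + 12 by 24 leaves the exponents of f and
    -- f₁₁.
    coprime-to-3 : Parity (ℤ± 2) (Sol (λ s t → ¬ 3∣ s t)) ((f PowerSeries.* f₁₁) j)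
    coprime-to-3 = parity-image ℤ²ₛ (ℤ± 2) φ (λ { (refl , refl) → inj₁ refl }) (λ {x} → sound x)
      (λ {x} {y} _ _ → injective x y) (λ {y} → surjective y) (counts-g j)
      where
      φ : ℤ × ℤ → Vec ℤ 2
      φ (κ , l) = + 6 * l + + 1 ∷ κ + + 5 * l + + 1 ∷ []
      sound : ∀ x → (weight 2 1 ⟨+⟩ weight 2 1) x ≡ j → Sol (λ s t → ¬ 3∣ s t) (φ x)
      sound (κ , l) eq = linear (+ 1) (+ 1) (weights⇒ 2 1 2 1 κ l eq) (ring κ l (+ j)) ,
          (+ 3 * l , ring₂ l) ,
        λ (u , eq) → from-no (3 ℕ.∣? 1) (residue-0 {3} {1} (+ 2 * l - u)
            (linear (+ 1) (+ 1) eq (ring₃ l u)))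
        where
        ring : ∀ κ l j → + 1 * (+ 3 * ((+ 6 * l + + 1) * (+ 6 * l + + 1)) - + 5 *
            ((+ 6 * l + + 1) * (κ + + 5 * l + + 1))
                   + + 3 * ((κ + + 5 * l + + 1) * (κ + + 5 * l + + 1))) + + 1 * (+ 2 * j) ≡
               + 1 * (+ 2 * j + + 1) + + 1 * ((+ 2 * (κ * (κ + + 1)) + + 1 * (κ * (κ - + 1))) + (+ 2 *
                   (l * (l + + 1)) + + 1 * (l * (l - + 1))) * + 11)
        ring = solve-∀
        ring₂ : ∀ l → + 6 * l + + 1 ≡ + 2 * (+ 3 * l) + + 1
        ring₂ = solve-∀
        ring₃ : ∀ l u → + 1 * ((+ 2 * l - u) * + 3 + + 1) + + 1 * (+ 3 * u) ≡ + 1 * + 0 + + 1 *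
            (+ 6 * l + + 1)
        ring₃ = solve-∀
      injective : ∀ x y → φ x ≡ φ y ⊎ φ x ≡ neg (φ y) → proj₁ x ≡ proj₁ y × proj₂ x ≡ proj₂ y
      injective (κ , l) (κ′ , l′) (inj₁ eq) with linear (+ 6) (+ 1) {x = l} {l′} (fst≡ eq) (ring l l′)
        where
        ring : ∀ l l′ → + 6 * l + + 1 * (+ 6 * l′ + + 1) ≡ + 6 * l′ + + 1 * (+ 6 * l + + 1)
        ring = solve-∀
      ... | refl = linear (+ 1) (+ 1) (snd≡ eq) (ring κ κ′ l) , refl
        where
        ring : ∀ κ κ′ l → + 1 * κ + + 1 * (κ′ + + 5 * l + + 1) ≡ + 1 * κ′ + + 1 * (κ + + 5 * l + + 1)
        ring = solve-∀
      injective (κ , l) (κ′ , l′) (inj₂ eq) = contradiction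
        (residue-0 {3} {2} (+ 2 * l + + 2 * l′) (linear (+ 1) (+ 1) (fst≡ eq) (ring l l′)))
            (from-no (3 ℕ.∣? 2))
        where
        ring : ∀ l l′ → + 1 * ((+ 2 * l + + 2 * l′) * + 3 + + 2) + + 1 * (- (+ 6 * l′ + + 1)) ≡
            + 1 * + 0 + + 1 * (+ 6 * l + + 1)
        ring = solve-∀
      surjective : ∀ y → Sol (λ s t → ¬ 3∣ s t) y → ∃ λ x → (weight 2 1 ⟨+⟩ weight 2 1) x ≡ j ×
          (φ x ≡ y ⊎ φ x ≡ neg y)
      surjective (s ∷ t ∷ []) (F≡N , (k , refl) , 3∤s) with residue 3 k
      ... | zero , l , refl = (t - + 5 * l - + 1 , l) , weights⇐ 2 1 2 1 (t - + 5 * l - + 1) l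
          (linear (+ 1) (+ 1) F≡N (ring l t (+ j))) ,
              inj₁ (pair≡ (ring₁ l) (ring₂ l t))
        where
        ring : ∀ l t j → let κ = t - + 5 * l - + 1 ; s = + 2 * (l * + 3 + + 0) + + 1 in
               + 1 * ((+ 2 * (κ * (κ + + 1)) + + 1 * (κ * (κ - + 1))) + (+ 2 * (l * (l + + 1)) + + 1 *
                   (l * (l - + 1))) * + 11)
                 + + 1 * (+ 2 * j + + 1) ≡
               + 1 * (+ 2 * j) + + 1 * (+ 3 * (s * s) - + 5 * (s * t) + + 3 * (t * t))
        ring = solve-∀
        ring₁ : ∀ l → + 6 * l + + 1 ≡ + 2 * (l * + 3 + + 0) + + 1
        ring₁ = solve-∀
        ring₂ : ∀ l t → t - + 5 * l - + 1 + + 5 * l + + 1 ≡ t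
        ring₂ = solve-∀
      ... | suc zero , l , refl = contradiction (+ 2 * l + + 1 , ring l) 3∤s
        where
        ring : ∀ l → + 2 * (l * + 3 + + 1) + + 1 ≡ + 3 * (+ 2 * l + + 1)
        ring = solve-∀
      ... | suc (suc zero) , l , refl = (- t + + 5 * l + + 4 , - l - + 1) , weights⇐ 2 1 2 1
          (- t + + 5 * l + + 4) (- l - + 1) (linear (+ 1) (+ 1) F≡N (ring l t (+ j))) ,
              inj₂ (pair≡ (ring₁ l) (ring₂ l t))
        where
        ring : ∀ l t j → let κ = - t + + 5 * l + + 4 ; m = - l - + 1 ; s = + 2 * (l * + 3 + + 2) + + 1 in
               + 1 * ((+ 2 * (κ * (κ + + 1)) + + 1 * (κ * (κ - + 1))) + (+ 2 * (m * (m + + 1)) + + 1 *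
                   (m * (m - + 1))) * + 11)
                 + + 1 * (+ 2 * j + + 1) ≡
               + 1 * (+ 2 * j) + + 1 * (+ 3 * (s * s) - + 5 * (s * t) + + 3 * (t * t))
        ring = solve-∀
        ring₁ : ∀ l → + 6 * (- l - + 1) + + 1 ≡ - (+ 2 * (l * + 3 + + 2) + + 1)
        ring₁ = solve-∀
        ring₂ : ∀ l t → - t + + 5 * l + + 4 + + 5 * (- l - + 1) + + 1 ≡ - t
        ring₂ = solve-∀

    -- The left side is 2 F as a sum of squares, which makes the solution set finite.
    F-bound : ∀ s t → F s t ≡ N → s * s + (t * t + + 5 * ((s - t) * (s - t))) ≡ + (4 ℕ.* j ℕ.+ 2)
    F-bound s t eq = trans (linear (+ 1) (+ 2) eq (ring s t (+ j)))
      (sym (trans (ℤ.pos-+ (4 ℕ.* j) 2) (cong (_+ + 2) (ℤ.pos-* 4 j))))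
      where
      ring : ∀ s t j → + 1 * (s * s + (t * t + + 5 * ((s - t) * (s - t)))) + + 2 * (+ 2 * j + + 1) ≡
             + 1 * (+ 4 * j + + 2) + + 2 * (+ 3 * (s * s) - + 5 * (s * t) + + 3 * (t * t))
      ring = solve-∀

    0≤5x² : ∀ x → + 0 ≤ + 5 * (x * x)
    0≤5x² x = ℤ.*-monoˡ-≤-nonNeg (+ 5) (0≤x² x)

    divisible-by-3 : Parity (ℤ± 2) (Sol 3∣) false
    divisible-by-3 = parity-image (ℤ± 2) (ℤ± 2) φ
      (λ { (inj₁ refl) → inj₁ refl ; {_} {u ∷ t ∷ []} (inj₂ refl) → inj₂
          (pair≡ (sym (ℤ.neg-distribʳ-* (+ 3) u)) refl) })
      (λ { {u ∷ t ∷ []} (eq , o) → eq , o , u , refl })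
      (λ { {u ∷ t ∷ []} {u′ ∷ t′ ∷ []} _ _ (inj₁ eq) → inj₁
          (pair≡ (ℤ.*-cancelˡ-≡ (+ 3) u u′ (fst≡ eq)) (snd≡ eq))
         ; {u ∷ t ∷ []} {u′ ∷ t′ ∷ []} _ _ (inj₂ eq) →
             inj₂ (pair≡ (ℤ.*-cancelˡ-≡ (+ 3) u (- u′) (trans (fst≡ eq) (ℤ.neg-distribʳ-* (+ 3) u′)))
                 (snd≡ eq)) })
      (λ { {s ∷ t ∷ []} (eq , o , u , refl) → u ∷ t ∷ [] , (eq , o) , inj₁ refl })
      (subst (Parity (ℤ± 2) P₃) (parity-unique (ℤ± 2) paired (parity-∅ (ℤ± 2) (λ {v} → no-fixed v)))
          (proj₂ finite))
      where
      φ : Vec ℤ 2 → Vec ℤ 2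
      φ (u ∷ t ∷ []) = + 3 * u ∷ t ∷ []
      P₃ : Vec ℤ 2 → Set
      P₃ (u ∷ t ∷ []) = F (+ 3 * u) t ≡ N × Odd (+ 3 * u)
      finite : ∃ (Parity (ℤ± 2) P₃)
      finite = parity-bounded (4 ℕ.* j ℕ.+ 2)
        (λ { (u ∷ t ∷ []) → (F (+ 3 * u) t ℤ.≟ N) ×-dec odd? (+ 3 * u) })
        (λ { (u ∷ t ∷ []) (eq , o) → trans (cong (λ z → F z (- t)) (sym (ℤ.neg-distribʳ-* (+ 3) u)))
            (trans (F-neg (+ 3 * u) t) eq)
                                   , subst Odd (ℤ.neg-distribʳ-* (+ 3) u) (Odd-neg o) })
        (λ { (u ∷ t ∷ []) (eq , o) →
               -- To bound `u` itself, the square (3 u)² is spent as u² and eight further copies of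
               -- u².
               square-bound u _ (0≤5x² u ⊕ (0≤x² u ⊕ (0≤x² u ⊕ (0≤x² u ⊕ (0≤x² t ⊕ 0≤5x² (+ 3 * u - t))))))
                   (trans (ring₁ u t) (F-bound (+ 3 * u) t eq))
             ∷ square-bound t _ (0≤x² (+ 3 * u) ⊕ 0≤5x² (+ 3 * u - t))
                 (trans (ring₂ (+ 3 * u) t) (F-bound (+ 3 * u) t eq)) ∷ [] })
        where
        ring₁ : ∀ u t → u * u + (+ 5 * (u * u) + (u * u + (u * u + (u * u + (t * t + + 5 *
            ((+ 3 * u - t) * (+ 3 * u - t))))))) ≡
                (+ 3 * u) * (+ 3 * u) + (t * t + + 5 * ((+ 3 * u - t) * (+ 3 * u - t)))
        ring₁ = solve-∀
        ring₂ : ∀ s t → t * t + (s * s + + 5 * ((s - t) * (s - t))) ≡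
            s * s + (t * t + + 5 * ((s - t) * (s - t)))
        ring₂ = solve-∀
      σ : Vec ℤ 2 → Vec ℤ 2
      σ (u ∷ t ∷ []) = u ∷ + 5 * u - t ∷ []
      paired : Parity (ℤ± 2) (λ v → P₃ v × (σ v ≡ v ⊎ σ v ≡ neg v)) (proj₁ finite)
      paired = parity-involution (ℤ± 2) σ
        (λ { (inj₁ refl) → inj₁ refl ; {_} {u ∷ t ∷ []} (inj₂ refl) → inj₂ (pair≡ refl (ring₀ u t)) })
        (λ { {u ∷ t ∷ []} (eq , o) → trans (ring u t) eq , o })
        (λ { {u ∷ t ∷ []} _ → inj₁ (pair≡ refl (ring′ u t)) })
        (proj₂ finite)
        where
        ring₀ : ∀ u t → + 5 * - u - - t ≡ - (+ 5 * u - t)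
        ring₀ = solve-∀
        ring : ∀ u t → + 3 * ((+ 3 * u) * (+ 3 * u)) - + 5 * ((+ 3 * u) * (+ 5 * u - t)) + + 3 *
            ((+ 5 * u - t) * (+ 5 * u - t)) ≡
               + 3 * ((+ 3 * u) * (+ 3 * u)) - + 5 * ((+ 3 * u) * t) + + 3 * (t * t)
        ring = solve-∀
        ring′ : ∀ u t → + 5 * u - (+ 5 * u - t) ≡ t
        ring′ = solve-∀
      -- A fixed class would have 2 t = 5 u or u = 0, but u is odd because 3 u is.
      no-fixed : ∀ v → ¬ (P₃ v × (σ v ≡ v ⊎ σ v ≡ neg v))
      no-fixed (u ∷ t ∷ []) ((_ , k , o) , inj₁ eq) = from-no (2 ℕ.∣? 1)
        (residue-0 {2} {1} (+ 5 * k + + 2 - + 3 * t) (linear₂ (+ 1) (- + 5) (+ 3) o (snd≡ eq) (ring u t k)))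
        where
        ring : ∀ u t k → + 1 * ((+ 5 * k + + 2 - + 3 * t) * + 2 + + 1) + (- + 5 *
            (+ 2 * k + + 1) + + 3 * t) ≡
               + 1 * + 0 + (- + 5 * (+ 3 * u) + + 3 * (+ 5 * u - t))
        ring = solve-∀
      no-fixed (u ∷ t ∷ []) ((_ , k , o) , inj₂ eq) = from-no (2 ℕ.∣? 1)
        (residue-0 {2} {1} k (linear₂ (+ 2) (- + 2) (+ 3) o (fst≡ eq) (ring u k)))
        where
        ring : ∀ u k → + 2 * (k * + 2 + + 1) + (- + 2 * (+ 2 * k + + 1) + + 3 * - u) ≡
               + 2 * + 0 + (- + 2 * (+ 3 * u) + + 3 * u)
        ring = solve-∀

    -- With s + t = 4 k + 1 and s - t = 4 l + 1, the value 4 F = 8 j + 4 equals 8 `W` + 12. So `W` =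
    -- j - 1, which accounts for the factor q.
    even-part : Parity (ℤ± 2) (Sol (λ s t → Even t)) ((q PowerSeries.* (ψ PowerSeries.* dilate 11 ψ)) j)
    even-part = parity-image ℤ²ₛ (ℤ± 2) φ (λ { (refl , refl) → inj₁ refl }) (λ {x} → sound x)
      (λ {x} {y} _ _ → injective x y) (λ {y} → surjective y) (weighted-X 1 counts-ψψ j)
      where
      φ : ℤ × ℤ → Vec ℤ 2
      φ (k , l) = + 2 * (k + l) + + 1 ∷ + 2 * (k - l) ∷ []
      W : ℤ × ℤ → ℕ
      W = weight 3 1 ⟨+⟩ weight 3 1
      sound : ∀ x → suc (W x) ≡ j → Sol (λ s t → Even t) (φ x)
      sound (k , l) eq = linear (+ 1) (+ 1) (trans (cong (_+ + 2) (weights⇒ 3 1 3 1 k l refl))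
          (trans (ring′ (+ W (k , l))) (cong (+ 2 *_) (trans (sym (ℤ.pos-+ 1 (W (k , l)))) (cong +_ eq)))))
          (ring k l (+ j)) , (k + l , refl) , (k - l , refl)
        where
        ring′ : ∀ w → + 2 * w + + 2 ≡ + 2 * (+ 1 + w)
        ring′ = solve-∀
        ring : ∀ k l j → let s = + 2 * (k + l) + + 1 ; t = + 2 * (k - l) in
               + 1 * (+ 3 * (s * s) - + 5 * (s * t) + + 3 * (t * t)) + + 1 * (+ 2 * j) ≡
               + 1 * (+ 2 * j + + 1) + + 1 * ((+ 3 * (k * (k + + 1)) + + 1 * (k * (k - + 1))) + (+ 3 *
                   (l * (l + + 1)) + + 1 * (l * (l - + 1))) * + 11 + + 2)
        ring = solve-∀
      injective : ∀ x y → φ x ≡ φ y ⊎ φ x ≡ neg (φ y) → proj₁ x ≡ proj₁ y × proj₂ x ≡ proj₂ y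
      injective (k , l) (k′ , l′) (inj₁ eq) =
        linear₂ (+ 4) (+ 1) (+ 1) (fst≡ eq) (snd≡ eq) (ring₁ k l k′ l′) , linear₂ (+ 4) (+ 1) (- + 1)
            (fst≡ eq) (snd≡ eq) (ring₂ k l k′ l′)
        where
        ring₁ : ∀ k l k′ l′ → + 4 * k + (+ 1 * (+ 2 * (k′ + l′) + + 1) + + 1 * (+ 2 * (k′ - l′))) ≡
                + 4 * k′ + (+ 1 * (+ 2 * (k + l) + + 1) + + 1 * (+ 2 * (k - l)))
        ring₁ = solve-∀
        ring₂ : ∀ k l k′ l′ → + 4 * l + (+ 1 * (+ 2 * (k′ + l′) + + 1) + - + 1 * (+ 2 * (k′ - l′))) ≡
                + 4 * l′ + (+ 1 * (+ 2 * (k + l) + + 1) + - + 1 * (+ 2 * (k - l)))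
        ring₂ = solve-∀
      injective (k , l) (k′ , l′) (inj₂ eq) = contradiction
        (residue-0 {4} {2} (k + k′) (linear₂ (+ 1) (+ 1) (+ 1) (fst≡ eq) (snd≡ eq) (ring k l k′ l′)))
            (from-no (4 ℕ.∣? 2))
        where
        ring : ∀ k l k′ l′ → + 1 * ((k + k′) * + 4 + + 2) + (+ 1 * - (+ 2 *
            (k′ + l′) + + 1) + + 1 * - (+ 2 * (k′ - l′))) ≡
               + 1 * + 0 + (+ 1 * (+ 2 * (k + l) + + 1) + + 1 * (+ 2 * (k - l)))
        ring = solve-∀
      preimage : ∀ k l → F (+ 2 * (k + l) + + 1) (+ 2 * (k - l)) ≡ N → suc (W (k , l)) ≡ j
      preimage k l eq = ℤ.+-injective (trans (ℤ.pos-+ 1 (W (k , l)))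
        (linear₂ (+ 2) (- + 1) (+ 1) (weights⇒ 3 1 3 1 k l refl) eq (ring k l (+ W (k , l)) (+ j))))
        where
        ring : ∀ k l w j → let s = + 2 * (k + l) + + 1 ; t = + 2 * (k - l) in
               + 2 * (+ 1 + w) + (- + 1 * (+ 2 * w) + + 1 * (+ 2 * j + + 1)) ≡
               + 2 * j + (- + 1 * ((+ 3 * (k * (k + + 1)) + + 1 * (k * (k - + 1))) + (+ 3 *
                   (l * (l + + 1)) + + 1 * (l * (l - + 1))) * + 11)
                 + + 1 * (+ 3 * (s * s) - + 5 * (s * t) + + 3 * (t * t)))
        ring = solve-∀
      surjective : ∀ y → Sol (λ s t → Even t) y → ∃ λ x → suc (W x) ≡ j × (φ x ≡ y ⊎ φ x ≡ neg y)
      -- Since s + t = 2 (u + w) + 1, the parity of u + w decides which sign makes s + t equal to 1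
      -- modulo 4; s - t lies in the same class because t is even.
      surjective (s ∷ t ∷ []) (eq , (u , refl) , (w , refl)) with even⊎odd (u + w)
      ... | inj₁ (k , h) = (k , u - k) , preimage k (u - k) (trans (cong₂ F s≡ t≡) eq) , inj₁ (pair≡ s≡ t≡)
        where
        s≡ : + 2 * (k + (u - k)) + + 1 ≡ + 2 * u + + 1
        s≡ = ring k u
          where
          ring : ∀ k u → + 2 * (k + (u - k)) + + 1 ≡ + 2 * u + + 1
          ring = solve-∀
        t≡ : + 2 * (k - (u - k)) ≡ + 2 * w
        t≡ = linear (+ 1) (- + 2) h (ring k u w)
          where
          ring : ∀ k u w → + 1 * (+ 2 * (k - (u - k))) + - + 2 * (+ 2 * k) ≡ + 1 * (+ 2 * w) + - + 2 *
              (u + w)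
          ring = solve-∀
      ... | inj₂ (m , h) = (- m - + 1 , m - u) , preimage (- m - + 1) (m - u)
              (trans (cong₂ F s≡ t≡) (trans (F-neg (+ 2 * u + + 1) (+ 2 * w)) eq)) , inj₂ (pair≡ s≡ t≡)
        where
        s≡ : + 2 * (- m - + 1 + (m - u)) + + 1 ≡ - (+ 2 * u + + 1)
        s≡ = ring m u
          where
          ring : ∀ m u → + 2 * (- m - + 1 + (m - u)) + + 1 ≡ - (+ 2 * u + + 1)
          ring = solve-∀
        t≡ : + 2 * (- m - + 1 - (m - u)) ≡ - (+ 2 * w)
        t≡ = linear (+ 1) (+ 2) h (ring m u w)
          where
          ring : ∀ m u w → + 1 * (+ 2 * (- m - + 1 - (m - u))) + + 2 * (+ 2 * m + + 1) ≡
              + 1 * - (+ 2 * w) + + 2 * (u + w)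
          ring = solve-∀

    diagonal : Parity (ℤ± 2) (Sol (λ s t → t ≡ s)) (ψ₄ j)
    diagonal = parity-image ℤₛ (ℤ± 2) (λ k → + 4 * k + + 1 ∷ + 4 * k + + 1 ∷ []) (λ { refl → inj₁ refl })
      (λ {k} eq → linear (+ 1) (+ 2) (trans (sym (weight-ψ₄ k)) (cong +_ eq)) (ring k (+ j)) ,
          (+ 2 * k , ring₂ k) , refl)
      (λ {k} {l} _ _ → λ { (inj₁ eq) → 1mod4-injective {k} {l} (inj₁ (fst≡ eq)) ; (inj₂ eq) →
          1mod4-injective {k} {l} (inj₂ (fst≡ eq)) })
      (λ {y} → surjective y) (counts-ψ₄ j)
      where
      ring : ∀ k j → let s = + 4 * k + + 1 in
             + 1 * (+ 3 * (s * s) - + 5 * (s * s) + + 3 * (s * s)) + + 2 * j ≡ + 1 * (+ 2 * j + + 1) + + 2 *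
                 (+ 8 * (k * k) + + 4 * k)
      ring = solve-∀
      ring₂ : ∀ k → + 4 * k + + 1 ≡ + 2 * (+ 2 * k) + + 1
      ring₂ = solve-∀
      preimage : ∀ k → F (+ 4 * k + + 1) (+ 4 * k + + 1) ≡ N → weight 3 1 k ℕ.* 2 ℕ.* 2 ≡ j
      preimage k eq = ℤ.+-injective (trans (weight-ψ₄ k) (linear (+ 2) (+ 1) eq (ring₃ k (+ j))))
        where
        ring₃ : ∀ k j → let s = + 4 * k + + 1 in
                + 2 * (+ 8 * (k * k) + + 4 * k) + + 1 * (+ 2 * j + + 1) ≡ + 2 * j + + 1 *
                    (+ 3 * (s * s) - + 5 * (s * s) + + 3 * (s * s))
        ring₃ = solve-∀
      surjective : ∀ y → Sol (λ s t → t ≡ s) y → ∃ λ k → weight 3 1 k ℕ.* 2 ℕ.* 2 ≡ j ×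
                   ((+ 4 * k + + 1 ∷ + 4 * k + + 1 ∷ []) ≡ y ⊎ (+ 4 * k + + 1 ∷ + 4 * k + + 1 ∷ []) ≡ neg y)
      surjective (s ∷ t ∷ []) (eq , o , refl) with odd⇒±1mod4 o
      ... | k , inj₁ h = k , preimage k (trans (cong₂ F h h) eq) , inj₁ (pair≡ h h)
      ... | k , inj₂ h = k , preimage k (trans (cong₂ F h h) (trans (F-neg s s) eq)) , inj₂ (pair≡ h h)

    -- F s (- s) = 11 s², and 11 (4 k + 1)² = 2 j + 1 gives j = 5 + 11 (8 k² + 4 k). This is the
    -- origin of q⁵.
    antidiagonal : Parity (ℤ± 2) (Sol (λ s t → t ≡ - s)) ((X 5 PowerSeries.* dilate 11 ψ₄) j)
    antidiagonal = parity-image ℤₛ (ℤ± 2) (λ k → + 4 * k + + 1 ∷ - (+ 4 * k + + 1) ∷ [])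
        (λ { refl → inj₁ refl })
      (λ {k} eq → linear (+ 1) (+ 2) (trans (sym (weight′ k)) (cong +_ eq)) (ring k (+ j)) ,
          (+ 2 * k , ring₂ k) , refl)
      (λ {k} {l} _ _ → λ { (inj₁ eq) → 1mod4-injective {k} {l} (inj₁ (fst≡ eq)) ; (inj₂ eq) →
          1mod4-injective {k} {l} (inj₂ (fst≡ eq)) })
      (λ {y} → surjective y) (weighted-X 5 (weighted-dilate 10 counts-ψ₄) j)
      where
      w₅ : ℤ → ℕ
      w₅ k = 5 ℕ.+ weight 3 1 k ℕ.* 2 ℕ.* 2 ℕ.* 11
      weight′ : ∀ k → + w₅ k ≡ + 5 + (+ 8 * (k * k) + + 4 * k) * + 11
      weight′ k = trans (ℤ.pos-+ 5 (weight 3 1 k ℕ.* 2 ℕ.* 2 ℕ.* 11)) (cong (λ z → + 5 + z)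
        (trans (ℤ.pos-* (weight 3 1 k ℕ.* 2 ℕ.* 2) 11) (cong (_* + 11) (weight-ψ₄ k))))
      ring : ∀ k j → let s = + 4 * k + + 1 in
             + 1 * (+ 3 * (s * s) - + 5 * (s * - s) + + 3 * (- s * - s)) + + 2 * j ≡ + 1 *
                 (+ 2 * j + + 1) + + 2 * (+ 5 + (+ 8 * (k * k) + + 4 * k) * + 11)
      ring = solve-∀
      ring₂ : ∀ k → + 4 * k + + 1 ≡ + 2 * (+ 2 * k) + + 1
      ring₂ = solve-∀
      preimage : ∀ k → F (+ 4 * k + + 1) (- (+ 4 * k + + 1)) ≡ N → w₅ k ≡ j
      preimage k eq = ℤ.+-injective (trans (weight′ k) (linear (+ 2) (+ 1) eq (ring₃ k (+ j))))
        where
        ring₃ : ∀ k j → let s = + 4 * k + + 1 in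
                + 2 * (+ 5 + (+ 8 * (k * k) + + 4 * k) * + 11) + + 1 * (+ 2 * j + + 1) ≡ + 2 * j + + 1 *
                    (+ 3 * (s * s) - + 5 * (s * - s) + + 3 * (- s * - s))
        ring₃ = solve-∀
      surjective : ∀ y → Sol (λ s t → t ≡ - s) y → ∃ λ k → w₅ k ≡ j ×
                   ((+ 4 * k + + 1 ∷ - (+ 4 * k + + 1) ∷ []) ≡ y ⊎
                       (+ 4 * k + + 1 ∷ - (+ 4 * k + + 1) ∷ []) ≡ neg y)
      surjective (s ∷ t ∷ []) (eq , o , refl) with odd⇒±1mod4 o
      ... | k , inj₁ h = k , preimage k (trans (cong₂ F h (cong (-_) h)) eq) , inj₁ (pair≡ h (cong (-_) h))
      ... | k , inj₂ h = k , preimage k (trans (cong₂ F h (cong (-_) h)) (trans (F-neg s (- s)) eq)) , inj₂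
          (pair≡ h (cong (-_) h))

    odd-part : Parity (ℤ± 2) (Sol (λ s t → Odd t)) (ψ₄ j xor (X 5 PowerSeries.* dilate 11 ψ₄) j)
    odd-part = subst (Parity (ℤ± 2) (Sol (λ s t → Odd t))) (parity-unique (ℤ± 2) swapped
        (parity-⊎ (ℤ± 2) diagonal antidiagonal
          (λ { {s ∷ t ∷ []} (eq , o , refl) → (eq , o , o) , inj₁ refl })
          (λ { {s ∷ t ∷ []} (eq , o , refl) → (eq , o , Odd-neg o) , inj₂
              (pair≡ refl (sym (ℤ.neg-involutive s))) })
          (λ { {s ∷ t ∷ []} ((eq , o , _) , inj₁ fix) → inj₁ (eq , o , fst≡ fix)
             ; {s ∷ t ∷ []} ((eq , o , _) , inj₂ fix) → inj₂ (eq , o , fst≡ fix) })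
          (λ { {s ∷ t ∷ []} {s′ ∷ t′ ∷ []} (_ , o , refl) (_ , _ , refl) (inj₁ eq) → s≢-s o
              (trans (snd≡ eq) (cong (-_) (sym (fst≡ eq))))
             ; {s ∷ t ∷ []} {s′ ∷ t′ ∷ []} (_ , o , refl) (_ , o′ , refl) (inj₂ eq) → s≢-s o′
                 (trans (sym (ℤ.neg-involutive s′)) (trans (sym (snd≡ eq)) (fst≡ eq))) }))) (proj₂ finite)
      where
      finite : ∃ (Parity (ℤ± 2) (Sol (λ s t → Odd t)))
      finite = parity-bounded (4 ℕ.* j ℕ.+ 2)
        (λ { (s ∷ t ∷ []) → (F s t ℤ.≟ N) ×-dec (odd? s ×-dec odd? t) })
        (λ { (s ∷ t ∷ []) (eq , o , o′) → trans (F-neg s t) eq , Odd-neg o , Odd-neg o′ })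
        (λ { (s ∷ t ∷ []) (eq , _) →
               square-bound s _ (0≤x² t ⊕ 0≤5x² (s - t)) (F-bound s t eq)
             ∷ square-bound t _ (0≤x² s ⊕ 0≤5x² (s - t)) (trans (ring s t) (F-bound s t eq)) ∷ [] })
        where
        ring : ∀ s t → t * t + (s * s + + 5 * ((s - t) * (s - t))) ≡
            s * s + (t * t + + 5 * ((s - t) * (s - t)))
        ring = solve-∀
      swap : Vec ℤ 2 → Vec ℤ 2
      swap (s ∷ t ∷ []) = t ∷ s ∷ []
      swapped : Parity (ℤ± 2) (λ v → Sol (λ s t → Odd t) v × (swap v ≡ v ⊎ swap v ≡ neg v)) (proj₁ finite)
      swapped = parity-involution (ℤ± 2) swap
        (λ { {_ ∷ _ ∷ []} (inj₁ refl) → inj₁ refl ; {_} {_ ∷ _ ∷ []} (inj₂ refl) → inj₂ refl })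
        (λ { {s ∷ t ∷ []} (eq , o , o′) → trans (ring s t) eq , o′ , o })
        (λ { {_ ∷ _ ∷ []} _ → inj₁ refl })
        (proj₂ finite)
        where
        ring : ∀ s t → + 3 * (t * t) - + 5 * (t * s) + + 3 * (s * s) ≡ + 3 * (s * s) - + 5 * (s * t) + + 3 *
            (t * t)
        ring = solve-∀
      s≢-s : ∀ {s} → Odd s → ¬ (s ≡ - s)
      s≢-s {s} (k , refl) eq = from-no (2 ℕ.∣? 1) (residue-0 {2} {1} k (linear (+ 2) (+ 1) eq (ring k)))
        where
        ring : ∀ k → + 2 * (k * + 2 + + 1) + + 1 * - (+ 2 * k + + 1) ≡ + 2 * + 0 + + 1 * (+ 2 * k + + 1)
        ring = solve-∀

    modular-equation-at : (f PowerSeries.* f₁₁) j ≡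
      (q PowerSeries.* (ψ PowerSeries.* dilate 11 ψ)) j xor (ψ₄ j xor (X 5 PowerSeries.* dilate 11 ψ₄) j)
    modular-equation-at = trans (sym (xor-identityʳ _)) (parity-unique (ℤ± 2) {P = Sol (λ s t → s ≡ s)}
      (parity-⊎ (ℤ± 2) coprime-to-3 divisible-by-3
        (λ { {_ ∷ _ ∷ []} (eq , o , _) → eq , o , refl }) (λ { {_ ∷ _ ∷ []} (eq , o , _) → eq , o , refl })
        (λ { {s ∷ t ∷ []} (eq , o , _) → by-3 s t eq o })
        (λ { {s ∷ t ∷ []} {s′ ∷ t′ ∷ []} (_ , _ , 3∤s) (_ , _ , 3∣s) (inj₁ refl) → 3∤s 3∣s
           ; {s ∷ t ∷ []} {s′ ∷ t′ ∷ []} (_ , _ , 3∤s) (_ , _ , (u , refl)) (inj₂ refl) → 3∤s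
               (- u , ℤ.neg-distribʳ-* (+ 3) u) }))
      (parity-⊎ (ℤ± 2) even-part odd-part
        (λ { {_ ∷ _ ∷ []} (eq , o , _) → eq , o , refl }) (λ { {_ ∷ _ ∷ []} (eq , o , _) → eq , o , refl })
        (λ { {s ∷ t ∷ []} (eq , o , _) → [ (λ e → inj₁ (eq , o , e)) , (λ o′ → inj₂ (eq , o , o′)) ]′
            (even⊎odd t) })
        (λ { {s ∷ t ∷ []} {s′ ∷ t′ ∷ []} (_ , _ , e) (_ , _ , o) (inj₁ refl) → ¬even×odd e o
           ; {s ∷ t ∷ []} {s′ ∷ t′ ∷ []} (_ , _ , e) (_ , _ , o) (inj₂ refl) → ¬even×odd e (Odd-neg o) })))
      where
      by-3 : ∀ s t → F s t ≡ N → Odd s → Sol (λ s t → ¬ 3∣ s t) (s ∷ t ∷ []) ⊎ Sol 3∣ (s ∷ t ∷ [])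
      by-3 s t eq o with residue 3 s
      ... | zero , u , refl = inj₂ (eq , o , u , trans (ℤ.+-identityʳ _) (ℤ.*-comm u (+ 3)))
      ... | suc zero , u , refl = inj₁ (eq , o , λ (v , h) → from-no (3 ℕ.∣? 1)
              (residue-0 {3} {1} (u - v) (linear (+ 1) (+ 1) h (ring u v))))
        where
        ring : ∀ u v → + 1 * ((u - v) * + 3 + + 1) + + 1 * (+ 3 * v) ≡ + 1 * + 0 + + 1 * (u * + 3 + + 1)
        ring = solve-∀
      ... | suc (suc zero) , u , refl = inj₁ (eq , o , λ (v , h) → from-no (3 ℕ.∣? 2)
              (residue-0 {3} {2} (u - v) (linear (+ 1) (+ 1) h (ring u v))))
        where
        ring : ∀ u v → + 1 * ((u - v) * + 3 + + 2) + + 1 * (+ 3 * v) ≡ + 1 * + 0 + + 1 * (u * + 3 + + 2)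
        ring = solve-∀

  -- Five theta series and the passage to the neighbouring lattice ℤ⁵.

  ℤ⁵ : Set
  ℤ⁵ = ℤ × ℤ × ℤ × ℤ × ℤ

  ℤ⁵ₛ : DecSetoid 0ℓ 0ℓ
  ℤ⁵ₛ = ×-decSetoid ℤₛ (×-decSetoid ℤₛ (×-decSetoid ℤₛ ℤ²ₛ))

  W₅ : ℤ⁵ → ℕ
  W₅ (a , b , c , d , e) = weight 13 9 a ℕ.+ (weight 19 3 b ℕ.+
      (weight 21 1 c ℕ.+ (weight 7 15 d ℕ.+ weight 17 5 e)))

  counts-Θ₅ : Weighted ℤ⁵ₛ Θ₅ W₅
  counts-Θ₅ = weighted-* {ℤₛ} {×-decSetoid ℤₛ (×-decSetoid ℤₛ ℤ²ₛ)} (cong (weight 13 9)) (counts-theta 12 8)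
    (weighted-* {ℤₛ} {×-decSetoid ℤₛ ℤ²ₛ} (cong (weight 19 3)) (counts-theta 18 2)
    (weighted-* {ℤₛ} {ℤ²ₛ} (cong (weight 21 1)) (counts-theta 20 0)
    (weighted-* {ℤₛ} {ℤₛ} (cong (weight 7 15)) (counts-theta 6 14) (counts-theta 16 4))))

  Vecₛ : ℕ → DecSetoid 0ℓ 0ℓ
  Vecₛ n = ≡-decSetoid (Vec.≡-dec {n = n} ℤ._≟_)

  norm : ∀ {n} → Vec ℤ n → ℤ
  norm [] = + 0
  norm (x ∷ v) = x * x + norm v

  -- The inner product with (1, 4, 5, -2, 3), whose square is 0 modulo 11 and which is
  -- multiplied by 4 modulo 11 under cyclic rotation.
  dot : Vec ℤ 5 → ℤ
  dot (a ∷ b ∷ c ∷ d ∷ e ∷ []) = a + + 4 * b + + 5 * c - + 2 * d + + 3 * e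

  Residue : ℕ → Vec ℤ 5 → Set
  Residue c z = ∃ λ k → dot z ≡ k * + 11 + + c

  quint≡ : ∀ {a b c d e a′ b′ c′ d′ e′ : ℤ} → a ≡ a′ → b ≡ b′ → c ≡ c′ → d ≡ d′ → e ≡ e′ →
           _≡_ {A = Vec ℤ 5} (a ∷ b ∷ c ∷ d ∷ e ∷ []) (a′ ∷ b′ ∷ c′ ∷ d′ ∷ e′ ∷ [])
  quint≡ refl refl refl refl refl = refl

  -- The weight for (α, β) is 11 n² + n (α - β) / 2. Completing the square with |v|² = 55 gives 11
  -- W₅ + 55 = |11 n + v|², so W₅ = 22 m + 6 means |11 n + v|² = 121 (2 m + 1).
  W₅-formula : ∀ a b c d e → + W₅ (a , b , c , d , e) ≡
    + 11 * (a * a + (b * b + (c * c + (d * d + e * e)))) + + 2 * (a + + 4 * b + + 5 * c - + 2 * d + + 3 * e)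
  W₅-formula a b c d e = trans (split (weight 13 9 a) _ (half 13 9 a (r₁ a))
      (split (weight 19 3 b) _ (half 19 3 b (r₂ b))
    (split (weight 21 1 c) _ (half 21 1 c (r₃ c)) (split (weight 7 15 d) (weight 17 5 e)
        (half 7 15 d (r₄ d)) (half 17 5 e (r₅ e))))))
    (ring a b c d e)
    where
    half : ∀ α β n {y} → + α * (n * (n + + 1)) + + β * (n * (n - + 1)) ≡ + 2 * y → + weight α β n ≡ y
    half α β n eq = ℤ.*-cancelˡ-≡ (+ 2) _ _ (trans (weight-formula α β n) eq)
    split : ∀ k l {x y} → + k ≡ x → + l ≡ y → + (k ℕ.+ l) ≡ x + y
    split k l p r = trans (ℤ.pos-+ k l) (cong₂ _+_ p r)
    r₁ : ∀ n → + 13 * (n * (n + + 1)) + + 9 * (n * (n - + 1)) ≡ + 2 * (+ 11 * (n * n) + + 2 * n)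
    r₁ = solve-∀
    r₂ : ∀ n → + 19 * (n * (n + + 1)) + + 3 * (n * (n - + 1)) ≡ + 2 * (+ 11 * (n * n) + + 8 * n)
    r₂ = solve-∀
    r₃ : ∀ n → + 21 * (n * (n + + 1)) + + 1 * (n * (n - + 1)) ≡ + 2 * (+ 11 * (n * n) + + 10 * n)
    r₃ = solve-∀
    r₄ : ∀ n → + 7 * (n * (n + + 1)) + + 15 * (n * (n - + 1)) ≡ + 2 * (+ 11 * (n * n) - + 4 * n)
    r₄ = solve-∀
    r₅ : ∀ n → + 17 * (n * (n + + 1)) + + 5 * (n * (n - + 1)) ≡ + 2 * (+ 11 * (n * n) + + 6 * n)
    r₅ = solve-∀
    ring : ∀ a b c d e → (+ 11 * (a * a) + + 2 * a) + ((+ 11 *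
        (b * b) + + 8 * b) + ((+ 11 * (c * c) + + 10 * c)
             + ((+ 11 * (d * d) - + 4 * d) + (+ 11 * (e * e) + + 6 * e)))) ≡
           + 11 * (a * a + (b * b + (c * c + (d * d + e * e)))) + + 2 *
               (a + + 4 * b + + 5 * c - + 2 * d + + 3 * e)
    ring = solve-∀

  -- Put v = (1, 4, 5, -2, 3).  A vector n with v·n = 3 + 11 s corresponds to z with 11 n + v = E z, where
  -- E is the symmetric circulant with first row (1, 4, -6, -2, -8) and E² = 121.
  module Neighbour (m : ℕ) where

    N : ℤ
    N = + 2 * + m + + 1

    -- The vector E (11 n + v) / 121, made integral by eliminating the first coordinate of n through
    -- v·n = 3 + 11 s, as in `first`.
    Z : ℤ → ℤ → ℤ → ℤ → ℤ → Vec ℤ 5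
    Z s b c d e = s - c - e ∷ + 1 + + 4 * s - + 2 * b - + 2 * c - e ∷ - + 2 - + 6 * s + + 2 * b + + 2 * c
        - d + + 2 * e
                ∷ - + 1 - + 2 * s + c ∷ - + 2 - + 8 * s + + 3 * b + + 4 * c - + 2 * d + + 2 * e ∷ []

    first : ℤ → ℤ → ℤ → ℤ → ℤ → ℤ
    first s b c d e = + 3 + + 11 * s - + 4 * b - + 5 * c + + 2 * d - + 3 * e

    -- The s with v·n = 3 + 11 s, obtained without division: W₅ = 22 m + 6 gives 2 s = 2 m - |n|²,
    -- and s = 12 s - 11 s.
    shift : ℤ⁵ → ℤ
    shift (a , b , c , d , e) = + 6 * (+ 2 * + m - (a * a + (b * b + (c * c + (d * d + e * e)))))
                                - (a + + 4 * b + + 5 * c - + 2 * d + + 3 * e - + 3)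

    φ : ℤ⁵ → Vec ℤ 5
    φ n@(a , b , c , d , e) = Z (shift n) b c d e

    Q₁ : Vec ℤ 5 → Set
    Q₁ z = norm z ≡ N × Residue 1 z

    index : ∀ n → W₅ n ≡ m ℕ.* 22 ℕ.+ 6 → + W₅ n ≡ + m * + 22 + + 6
    index n eq = trans (cong +_ eq) (trans (ℤ.pos-+ (m ℕ.* 22) 6) (cong (_+ + 6) (ℤ.pos-* m 22)))

    first-shift : ∀ a b c d e → W₅ (a , b , c , d , e) ≡ m ℕ.* 22 ℕ.+ 6 → a ≡ first
        (shift (a , b , c , d , e)) b c d e
    first-shift a b c d e eq = linear (+ 1) (+ 6) (trans (sym (W₅-formula a b c d e))
        (index (a , b , c , d , e) eq)) (ring a b c d e (+ m))
      where
      ring : ∀ a b c d e m → let S = a * a + (b * b + (c * c + (d * d + e * e))) ; y = a + + 4 * b + + 5 * c - + 2 * d + + 3 * e in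
             + 1 * a + + 6 * (m * + 22 + + 6) ≡
             + 1 * (+ 3 + + 11 * (+ 6 * (+ 2 * m - S) - (y - + 3)) - + 4 * b - + 5 * c + + 2 * d - + 3 * e)
               + + 6 * (+ 11 * S + + 2 * y)
      ring = solve-∀

    -- E is symmetric with E² = 121, so 121 |z|² = |11 n + v|² = 11 W₅ + 55; the equation is this
    -- one divided by 11.
    norm-Z : ∀ s b c d e → let a = first s b c d e in
      + 11 * norm (Z s b c d e) ≡
      + 11 * (a * a + (b * b + (c * c + (d * d + e * e)))) + + 2 *
          (a + + 4 * b + + 5 * c - + 2 * d + + 3 * e) + + 5
    norm-Z = ring
      where
      ring : ∀ s b c d e → let a = + 3 + + 11 * s - + 4 * b - + 5 * c + + 2 * d - + 3 * e
                               z₀ = s - c - e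
                               z₁ = + 1 + + 4 * s - + 2 * b - + 2 * c - e
                               z₂ = - + 2 - + 6 * s + + 2 * b + + 2 * c - d + + 2 * e
                               z₃ = - + 1 - + 2 * s + c
                               z₄ = - + 2 - + 8 * s + + 3 * b + + 4 * c - + 2 * d + + 2 * e in
             + 11 * (z₀ * z₀ + (z₁ * z₁ + (z₂ * z₂ + (z₃ * z₃ + (z₄ * z₄ + + 0))))) ≡
             + 11 * (a * a + (b * b + (c * c + (d * d + e * e)))) + + 2 *
                 (a + + 4 * b + + 5 * c - + 2 * d + + 3 * e) + + 5
      ring = solve-∀

    sound : ∀ n → W₅ n ≡ m ℕ.* 22 ℕ.+ 6 → Q₁ (φ n)
    sound n@(a , b , c , d , e) eq =
      ℤ.*-cancelˡ-≡ (+ 11) (norm (φ n)) N (trans (norm-Z s b c d e) (trans (cong (_+ + 5)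
        (trans (cong (λ a → + 11 * (a * a + (b * b + (c * c + (d * d + e * e)))) + + 2 *
            (a + + 4 * b + + 5 * c - + 2 * d + + 3 * e))
                 (sym (first-shift a b c d e eq)))
          (trans (sym (W₅-formula a b c d e)) (index n eq)))) (ring₁ (+ m)))) ,
      - + 1 - + 3 * s + b + c - d + e , ring₂ s b c d e
      where
      s = shift n
      ring₁ : ∀ m → m * + 22 + + 6 + + 5 ≡ + 11 * (+ 2 * m + + 1)
      ring₁ = solve-∀
      ring₂ : ∀ s b c d e → (s - c - e) + + 4 * (+ 1 + + 4 * s - + 2 * b - + 2 * c - e) + + 5 *
          (- + 2 - + 6 * s + + 2 * b + + 2 * c - d + + 2 * e)
                - + 2 * (- + 1 - + 2 * s + c) + + 3 *
                    (- + 2 - + 8 * s + + 3 * b + + 4 * c - + 2 * d + + 2 * e) ≡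
              (- + 1 - + 3 * s + b + c - d + e) * + 11 + + 1
      ring₂ = solve-∀

    E-row : (u₀ u₁ u₂ u₃ u₄ : ℤ) → Vec ℤ 5 → ℤ
    E-row u₀ u₁ u₂ u₃ u₄ (a ∷ b ∷ c ∷ d ∷ e ∷ []) = u₀ * a + u₁ * b + u₂ * c + u₃ * d + u₄ * e

    injective : ∀ n n′ → W₅ n ≡ m ℕ.* 22 ℕ.+ 6 → W₅ n′ ≡ m ℕ.* 22 ℕ.+ 6 → φ n ≡ φ n′ →
                DecSetoid._≈_ ℤ⁵ₛ n n′
    injective n@(a , b , c , d , e) n′@(a′ , b′ , c′ , d′ , e′) p p′ eq =
      trans (first-shift a b c d e p) (trans first≡ (sym (first-shift a′ b′ c′ d′ e′ p′))) , b≡ , c≡ , d≡ ,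
          e≡
      where
      -- Applied to the rows of E, since E z = 11 n + v recovers n coordinate by coordinate.
      component : ∀ (g : Vec ℤ 5 → ℤ) {x x′} k → g (φ n) ≡ + 11 * x + k → g (φ n′) ≡ + 11 * x′ + k → x ≡ x′
      component g {x} {x′} k h h′ = linear (+ 11) (+ 1) (trans (sym h) (trans (cong g eq) h′)) (ring x x′ k)
        where
        ring : ∀ x x′ k → + 11 * x + + 1 * (+ 11 * x′ + k) ≡ + 11 * x′ + + 1 * (+ 11 * x + k)
        ring = solve-∀
      r₀ : ∀ s b c d e → + 1 * (s - c - e) + + 4 * (+ 1 + + 4 * s - + 2 * b - + 2 * c - e) + - + 6 *
          (- + 2 - + 6 * s + + 2 * b + + 2 * c - d + + 2 * e)
             + - + 2 * (- + 1 - + 2 * s + c) + - + 8 *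
                 (- + 2 - + 8 * s + + 3 * b + + 4 * c - + 2 * d + + 2 * e) ≡
           + 11 * (+ 3 + + 11 * s - + 4 * b - + 5 * c + + 2 * d - + 3 * e) + + 1
      r₀ = solve-∀
      r₁ : ∀ s b c d e → + 4 * (s - c - e) + - + 6 * (+ 1 + + 4 * s - + 2 * b - + 2 * c - e) + - + 2 *
          (- + 2 - + 6 * s + + 2 * b + + 2 * c - d + + 2 * e)
             + - + 8 * (- + 1 - + 2 * s + c) + + 1 *
                 (- + 2 - + 8 * s + + 3 * b + + 4 * c - + 2 * d + + 2 * e) ≡ + 11 * b + + 4
      r₁ = solve-∀
      r₂ : ∀ s b c d e → - + 6 * (s - c - e) + - + 2 * (+ 1 + + 4 * s - + 2 * b - + 2 * c - e) + - + 8 *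
          (- + 2 - + 6 * s + + 2 * b + + 2 * c - d + + 2 * e)
             + + 1 * (- + 1 - + 2 * s + c) + + 4 * (- + 2 - + 8 * s + + 3 * b + + 4 * c - + 2 * d + + 2 * e)
                 ≡ + 11 * c + + 5
      r₂ = solve-∀
      r₃ : ∀ s b c d e → - + 2 * (s - c - e) + - + 8 * (+ 1 + + 4 * s - + 2 * b - + 2 * c - e) + + 1 *
          (- + 2 - + 6 * s + + 2 * b + + 2 * c - d + + 2 * e)
             + + 4 * (- + 1 - + 2 * s + c) + - + 6 *
                 (- + 2 - + 8 * s + + 3 * b + + 4 * c - + 2 * d + + 2 * e) ≡ + 11 * d + - + 2
      r₃ = solve-∀
      r₄ : ∀ s b c d e → - + 8 * (s - c - e) + + 1 * (+ 1 + + 4 * s - + 2 * b - + 2 * c - e) + + 4 *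
          (- + 2 - + 6 * s + + 2 * b + + 2 * c - d + + 2 * e)
             + - + 6 * (- + 1 - + 2 * s + c) + - + 2 *
                 (- + 2 - + 8 * s + + 3 * b + + 4 * c - + 2 * d + + 2 * e) ≡ + 11 * e + + 3
      r₄ = solve-∀
      first≡ = component (E-row (+ 1) (+ 4) (- + 6) (- + 2) (- + 8)) (+ 1) (r₀ (shift n) b c d e)
          (r₀ (shift n′) b′ c′ d′ e′)
      b≡ = component (E-row (+ 4) (- + 6) (- + 2) (- + 8) (+ 1)) (+ 4) (r₁ (shift n) b c d e)
          (r₁ (shift n′) b′ c′ d′ e′)
      c≡ = component (E-row (- + 6) (- + 2) (- + 8) (+ 1) (+ 4)) (+ 5) (r₂ (shift n) b c d e)
          (r₂ (shift n′) b′ c′ d′ e′)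
      d≡ = component (E-row (- + 2) (- + 8) (+ 1) (+ 4) (- + 6)) (- + 2) (r₃ (shift n) b c d e)
          (r₃ (shift n′) b′ c′ d′ e′)
      e≡ = component (E-row (- + 8) (+ 1) (+ 4) (- + 6) (- + 2)) (+ 3) (r₄ (shift n) b c d e)
          (r₄ (shift n′) b′ c′ d′ e′)

    surjective : ∀ z → Q₁ z → ∃ λ n → W₅ n ≡ m ℕ.* 22 ℕ.+ 6 × φ n ≡ z
    surjective (z₀ ∷ w ∷ x ∷ y ∷ z ∷ []) (eq , r , h) =
      n , weight≡ , trans (cong (λ s → Z s b c d e) shift≡) Z≡
      where
      -- The vector n = (E z - v) / 11 after eliminating z₀ through v·z = 11 r + 1, and s = (v·n -
      -- 3) / 11.
      s a b c d e : ℤ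
      s = - + 1 - + 3 * r + w + x - y + z
      a = r - x - z
      b = + 4 * r - + 2 * w - + 2 * x - z
      c = - + 1 - + 6 * r + + 2 * w + + 2 * x - y + + 2 * z
      d = - + 2 * r + x
      e = - + 1 - + 8 * r + + 3 * w + + 4 * x - + 2 * y + + 2 * z
      n : ℤ⁵
      n = a , b , c , d , e
      z₀≡ : z₀ ≡ + 1 + + 11 * r - + 4 * w - + 5 * x + + 2 * y - + 3 * z
      z₀≡ = linear (+ 1) (+ 1) h (ring z₀ w x y z r)
        where
        ring : ∀ z₀ w x y z r → + 1 * z₀ + + 1 * (r * + 11 + + 1) ≡
               + 1 * (+ 1 + + 11 * r - + 4 * w - + 5 * x + + 2 * y - + 3 * z) + + 1 *
                   (z₀ + + 4 * w + + 5 * x - + 2 * y + + 3 * z)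
        ring = solve-∀
      first-a : ∀ r w x y z → r - x - z ≡ + 3 + + 11 * (- + 1 - + 3 * r + w + x - y + z) - + 4 *
          (+ 4 * r - + 2 * w - + 2 * x - z)
          - + 5 * (- + 1 - + 6 * r + + 2 * w + + 2 * x - y + + 2 * z) + + 2 * (- + 2 * r + x) - + 3 *
              (- + 1 - + 8 * r + + 3 * w + + 4 * x - + 2 * y + + 2 * z)
      first-a = solve-∀
      q₀ : ∀ r w x y z → (- + 1 - + 3 * r + w + x - y + z)
          - (- + 1 - + 6 * r + + 2 * w + + 2 * x - y + + 2 * z)
          - (- + 1 - + 8 * r + + 3 * w + + 4 * x - + 2 * y + + 2 * z)
          ≡ + 1 + + 11 * r - + 4 * w - + 5 * x + + 2 * y - + 3 * z
      q₀ = solve-∀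
      q₁ : ∀ r w x y z → + 1 + + 4 * (- + 1 - + 3 * r + w + x - y + z) - + 2 *
          (+ 4 * r - + 2 * w - + 2 * x - z)
          - + 2 * (- + 1 - + 6 * r + + 2 * w + + 2 * x - y + + 2 * z)
              - (- + 1 - + 8 * r + + 3 * w + + 4 * x - + 2 * y + + 2 * z) ≡ w
      q₁ = solve-∀
      q₂ : ∀ r w x y z → - + 2 - + 6 * (- + 1 - + 3 * r + w + x - y + z) + + 2 *
          (+ 4 * r - + 2 * w - + 2 * x - z)
          + + 2 * (- + 1 - + 6 * r + + 2 * w + + 2 * x - y + + 2 * z) - (- + 2 * r + x) + + 2 *
              (- + 1 - + 8 * r + + 3 * w + + 4 * x - + 2 * y + + 2 * z) ≡ x
      q₂ = solve-∀
      q₃ : ∀ r w x y z → - + 1 - + 2 * (- + 1 - + 3 * r + w + x - y + z)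
          + (- + 1 - + 6 * r + + 2 * w + + 2 * x - y + + 2 * z) ≡ y
      q₃ = solve-∀
      q₄ : ∀ r w x y z → - + 2 - + 8 * (- + 1 - + 3 * r + w + x - y + z) + + 3 *
          (+ 4 * r - + 2 * w - + 2 * x - z)
          + + 4 * (- + 1 - + 6 * r + + 2 * w + + 2 * x - y + + 2 * z) - + 2 * (- + 2 * r + x) + + 2 *
              (- + 1 - + 8 * r + + 3 * w + + 4 * x - + 2 * y + + 2 * z) ≡ z
      q₄ = solve-∀
      Z≡ : Z s b c d e ≡ (z₀ ∷ w ∷ x ∷ y ∷ z ∷ [])
      Z≡ = quint≡ (trans (q₀ r w x y z) (sym z₀≡)) (q₁ r w x y z) (q₂ r w x y z) (q₃ r w x y z)
          (q₄ r w x y z)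
      formula : + 11 * N ≡ + W₅ n + + 5
      formula = trans (cong (+ 11 *_) (trans (sym eq) (cong norm (sym Z≡)))) (trans (norm-Z s b c d e)
        (cong (_+ + 5) (trans (cong (λ a → + 11 * (a * a + (b * b + (c * c + (d * d + e * e)))) + + 2 *
            (a + + 4 * b + + 5 * c - + 2 * d + + 3 * e))
          (sym (first-a r w x y z))) (sym (W₅-formula a b c d e)))))
      weight≡ : W₅ n ≡ m ℕ.* 22 ℕ.+ 6
      weight≡ = ℤ.+-injective (trans (linear (+ 1) (- + 1) formula (ring (+ W₅ n) (+ m)))
        (sym (trans (ℤ.pos-+ (m ℕ.* 22) 6) (cong (_+ + 6) (ℤ.pos-* m 22)))))
        where
        ring : ∀ w m → + 1 * w + - + 1 * (w + + 5) ≡ + 1 * (m * + 22 + + 6) + - + 1 *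
            (+ 11 * (+ 2 * m + + 1))
        ring = solve-∀
      shift≡ : shift n ≡ s
      shift≡ = linear (+ 11) (- + 1) (trans (sym (first-a r w x y z)) (first-shift a b c d e weight≡))
          (ring (shift n) s b c d e)
        where
        ring : ∀ s s′ b c d e → + 11 * s + - + 1 * (+ 3 + + 11 * s - + 4 * b - + 5 * c + + 2 * d - + 3 * e)
            ≡
               + 11 * s′ + - + 1 * (+ 3 + + 11 * s′ - + 4 * b - + 5 * c + + 2 * d - + 3 * e)
        ring = solve-∀

    neighbour : Parity (Vecₛ 5) Q₁ (slice 22 6 Θ₅ m)
    neighbour = parity-image ℤ⁵ₛ (Vecₛ 5) φ (λ { (refl , refl , refl , refl , refl) → refl })
      (λ {n} → sound n) (λ {n} {n′} → injective n n′) (λ {z} → surjective z) (counts-Θ₅ (m ℕ.* 22 ℕ.+ 6))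

  -- Rotation of coordinates and residue classes of v·z modulo 11.

  rot : Vec ℤ 5 → Vec ℤ 5
  rot (a ∷ b ∷ c ∷ d ∷ e ∷ []) = e ∷ a ∷ b ∷ c ∷ d ∷ []

  rotate : ℕ → Vec ℤ 5 → Vec ℤ 5
  rotate zero z = z
  rotate (suc k) z = rot (rotate k z)

  rot-injective : ∀ {y z} → rot y ≡ rot z → y ≡ z
  rot-injective {_ ∷ _ ∷ _ ∷ _ ∷ _ ∷ []} {_ ∷ _ ∷ _ ∷ _ ∷ _ ∷ []} refl = refl

  rotate-injective : ∀ k {y z} → rotate k y ≡ rotate k z → y ≡ z
  rotate-injective zero eq = eq
  rotate-injective (suc k) eq = rotate-injective k (rot-injective eq)

  norm-rot : ∀ z → norm (rot z) ≡ norm z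
  norm-rot (a ∷ b ∷ c ∷ d ∷ e ∷ []) = ring (a * a) (b * b) (c * c) (d * d) (e * e)
    where
    ring : ∀ a b c d e → e + (a + (b + (c + (d + + 0)))) ≡ a + (b + (c + (d + (e + + 0))))
    ring = solve-∀

  norm-rotate : ∀ k z → norm (rotate k z) ≡ norm z
  norm-rotate zero z = refl
  norm-rotate (suc k) z = trans (norm-rot (rotate k z)) (norm-rotate k z)

  norm-neg : ∀ {n} (z : Vec ℤ n) → norm (neg z) ≡ norm z
  norm-neg [] = refl
  norm-neg (x ∷ z) = cong₂ _+_ (ring x) (norm-neg z)
    where
    ring : ∀ x → - x * - x ≡ x * x
    ring = solve-∀

  dot-neg : ∀ z → dot (neg z) ≡ - dot z
  dot-neg (a ∷ b ∷ c ∷ d ∷ e ∷ []) = ring a b c d e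
    where
    ring : ∀ a b c d e → - a + + 4 * - b + + 5 * - c - + 2 * - d + + 3 * - e ≡
        - (a + + 4 * b + + 5 * c - + 2 * d + + 3 * e)
    ring = solve-∀

  -- Rotating z amounts to rotating v backwards, and that multiplies it by 4 modulo 11; b + 2 c - d
  -- + e is the quotient of the difference by 11.
  Residue-rot : ∀ {c z} → Residue c z → Residue (4 ℕ.* c) (rot z)
  Residue-rot {κ} {a ∷ b ∷ c ∷ d ∷ e ∷ []} (k , eq) = + 4 * k - (b + + 2 * c - d + e) ,
    trans (linear (+ 1) (+ 4) eq (ring a b c d e k (+ κ)))
        (cong (λ x → (+ 4 * k - (b + + 2 * c - d + e)) * + 11 + x) (sym (ℤ.pos-* 4 κ)))
    where
    ring : ∀ a b c d e k κ → + 1 * (e + + 4 * a + + 5 * b - + 2 * c + + 3 * d) + + 4 * (k * + 11 + κ) ≡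
           + 1 * ((+ 4 * k - (b + + 2 * c - d + e)) * + 11 + + 4 * κ) + + 4 *
               (a + + 4 * b + + 5 * c - + 2 * d + + 3 * e)
    ring = solve-∀

  Residue-step : ∀ c e d {z} → 4 ℕ.* c ≡ e ℕ.* 11 ℕ.+ d → Residue c z → Residue d (rot z)
  Residue-step c e d {z} 4c r with Residue-rot {c} {z} r
  ... | k , eq = k + + e , trans eq (trans (cong (λ x → k * + 11 + x)
    (trans (cong +_ 4c) (trans (ℤ.pos-+ (e ℕ.* 11) d) (cong (_+ + d) (ℤ.pos-* e 11)))))
        (ring k (+ e) (+ d)))
    where
    ring : ∀ k e c → k * + 11 + (e * + 11 + c) ≡ (k + e) * + 11 + c
    ring = solve-∀

  power : Fin 5 → ℕ
  power zero = 1
  power (suc zero) = 4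
  power (suc (suc zero)) = 5
  power (suc (suc (suc zero))) = 9
  power (suc (suc (suc (suc zero)))) = 3

  module _ {z : Vec ℤ 5} where
    1→4 : Residue 1 z → Residue 4 (rot z)
    1→4 = Residue-step 1 0 4 {z} refl
    4→5 : Residue 4 z → Residue 5 (rot z)
    4→5 = Residue-step 4 1 5 {z} refl
    5→9 : Residue 5 z → Residue 9 (rot z)
    5→9 = Residue-step 5 1 9 {z} refl
    9→3 : Residue 9 z → Residue 3 (rot z)
    9→3 = Residue-step 9 3 3 {z} refl
    3→1 : Residue 3 z → Residue 1 (rot z)
    3→1 = Residue-step 3 1 1 {z} refl

  Residue-rotate : ∀ i z → Residue 1 z → Residue (power i) (rotate (toℕ i) z)
  Residue-rotate zero z r = r
  Residue-rotate (suc zero) z r = 1→4 {z} r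
  Residue-rotate (suc (suc zero)) z r = 4→5 {rotate 1 z} (1→4 {z} r)
  Residue-rotate (suc (suc (suc zero))) z r = 5→9 {rotate 2 z} (4→5 {rotate 1 z} (1→4 {z} r))
  Residue-rotate (suc (suc (suc (suc zero)))) z r = 9→3 {rotate 3 z}
      (5→9 {rotate 2 z} (4→5 {rotate 1 z} (1→4 {z} r)))

  Residue-neg : ∀ c d → c ℕ.+ d ≡ 11 → ∀ {z} → Residue c z → Residue d (neg z)
  Residue-neg c d c+d {z} (k , eq) = - k - + 1 , trans (dot-neg z) (trans (cong (-_) eq)
    (linear (+ 1) (- + 1) (trans (sym (ℤ.pos-+ c d)) (cong +_ c+d)) (ring k (+ c) (+ d))))
    where
    ring : ∀ k c d → + 1 * - (k * + 11 + c) + - + 1 * + 11 ≡ + 1 * ((- k - + 1) * + 11 + d) + - + 1 *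
        (c + d)
    ring = solve-∀

  -- The factor 10 is -1 modulo 11, which keeps the congruence in ℕ and decidable by enumeration.
  powers-distinct : ∀ (i j : Fin 5) → 11 ℕ.∣ power i ℕ.+ 10 ℕ.* power j → i ≡ j
  powers-distinct = from-yes (Fin.all? λ (i : Fin 5) → Fin.all? λ (j : Fin 5) →
      (11 ℕ.∣? (power i ℕ.+ 10 ℕ.* power j)) →-dec (i Fin.≟ j))

  powers-not-opposite : ∀ (i j : Fin 5) → ¬ 11 ℕ.∣ power i ℕ.+ power j
  powers-not-opposite = from-yes (Fin.all? λ (i : Fin 5) → Fin.all? λ (j : Fin 5) → ¬?
      (11 ℕ.∣? (power i ℕ.+ power j)))

  powers-nonzero : ∀ (i : Fin 5) → ¬ 11 ℕ.∣ power i
  powers-nonzero = from-yes (Fin.all? λ (i : Fin 5) → ¬? (11 ℕ.∣? (power i)))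

  Finₛ : DecSetoid 0ℓ 0ℓ
  Finₛ = Fin.≡-decSetoid 5

  parity-Fin5 : Parity Finₛ (λ _ → ⊤) true
  parity-Fin5 = record { list = allFin 5 ; sound = All.universal (λ _ → tt) (allFin 5) ; complete =
      λ {i} _ → ∈.∈-allFin i
                       ; unique = allFin⁺ 5 ; parity = refl }

  -- Up to sign, every nonzero residue modulo 11 is a power of 4.
  module _ (N : ℤ) where

    -- The five rotations map five copies of the class v·z = 1 bijectively onto the vectors off the
    -- lattice, up to sign. On the source vectors are not identified up to sign, since - z lies in
    -- the class -1; and five is odd, so `c` is unchanged.
    off-lattice : ∀ {c} → Parity (Vecₛ 5) (λ z → norm z ≡ N × Residue 1 z) c →
                  Parity (ℤ± 5) (λ z → norm z ≡ N × ¬ Residue 0 z) c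
    off-lattice p = parity-image (×-decSetoid Finₛ (Vecₛ 5)) (ℤ± 5) φ (λ { (refl , refl) → inj₁ refl })
      (λ { {i , z} (_ , eq , res) → trans (norm-rotate (toℕ i) z) eq , λ res₀ → powers-nonzero i
          (differ i {rotate (toℕ i) z} (Residue-rotate i z res) res₀) })
      (λ { {i , z} {j , z′} (_ , _ , res) (_ , _ , res′) eq → injective i j z z′ (Residue-rotate i z res)
          (Residue-rotate j z′ res′) eq })
      (λ {z} → surjective z) (parity-× Finₛ (Vecₛ 5) parity-Fin5 p)
      where
      φ : Fin 5 × Vec ℤ 5 → Vec ℤ 5
      φ (i , z) = rotate (toℕ i) z
      differ : ∀ (i : Fin 5) {z} → Residue (power i) z → Residue 0 z → 11 ℕ.∣ power i
      differ i (k , eq) (l , eq′) = residue-0 (k - l)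
          (linear (+ 1) (+ 1) (trans (sym eq) eq′) (ring k l (+ (power i))))
        where
        ring : ∀ k l c → + 1 * ((k - l) * + 11 + c) + + 1 * (l * + 11 + + 0) ≡ + 1 * + 0 + + 1 *
            (k * + 11 + c)
        ring = solve-∀
      injective : ∀ i j z z′ → Residue (power i) (rotate (toℕ i) z) → Residue (power j)
          (rotate (toℕ j) z′) →
                  φ (i , z) ≡ φ (j , z′) ⊎ φ (i , z) ≡ neg (φ (j , z′)) → i ≡ j × z ≡ z′
      injective i j z z′ (k , h) (k′ , h′) (inj₁ eq) with powers-distinct i j (
          (residue-0 (k - k′ - + (power j)) (linear (+ 1) (+ 1) (trans (sym h) (trans (cong dot eq) h′))
            (trans (cong (λ x → + 1 * ((k - k′ - + (power j)) * + 11 + x) + + 1 * (k′ * + 11 + + (power j)))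
                     (trans (ℤ.pos-+ (power i) _) (cong (λ y → + (power i) + y) (ℤ.pos-* 10 (power j)))))
              (ring k k′ (+ (power i)) (+ (power j)))))))
        where
        ring : ∀ k k′ c d → + 1 * ((k - k′ - d) * + 11 + (c + + 10 * d)) + + 1 * (k′ * + 11 + d) ≡
            + 1 * + 0 + + 1 * (k * + 11 + c)
        ring = solve-∀
      ... | refl = refl , rotate-injective (toℕ i) eq
      injective i j z z′ (k , h) (k′ , h′) (inj₂ eq) = contradiction
        (residue-0 (k + k′) (trans (cong (λ x → (k + k′) * + 11 + x) (ℤ.pos-+ (power i) (power j)))
          (linear (+ 1) (+ 1) (trans (sym h) (trans (cong dot eq)
              (trans (dot-neg (φ (j , z′))) (cong (-_) h′))))
            (ring k k′ (+ (power i)) (+ (power j))))))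
        (powers-not-opposite i j)
        where
        ring : ∀ k k′ c d → + 1 * ((k + k′) * + 11 + (c + d)) + + 1 * - (k′ * + 11 + d) ≡ + 1 * + 0 + + 1 *
            (k * + 11 + c)
        ring = solve-∀
      Preimage : Vec ℤ 5 → Set
      Preimage z = ∃ λ x → (⊤ × norm (proj₂ x) ≡ N × Residue 1 (proj₂ x)) × (φ x ≡ z ⊎ φ x ≡ neg z)
      -- Rotation has order five, so a vector with residue 4ⁱ reaches residue 1 after 5 - i
      -- rotations, and i more bring it back definitionally.
      square : ∀ z → norm z ≡ N → Residue 1 z ⊎ Residue 3 z ⊎ Residue 4 z ⊎ Residue 5 z ⊎ Residue 9 z →
          Preimage z
      square z@(_ ∷ _ ∷ _ ∷ _ ∷ _ ∷ []) eq (inj₁ r) = (zero , z) , (tt , eq , r) , inj₁ refl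
      square z@(_ ∷ _ ∷ _ ∷ _ ∷ _ ∷ []) eq (inj₂ (inj₁ r)) =
        (suc (suc (suc (suc zero))) , rot z) , (tt , trans (norm-rotate 1 z) eq , 3→1 {z} r) , inj₁ refl
      square z@(_ ∷ _ ∷ _ ∷ _ ∷ _ ∷ []) eq (inj₂ (inj₂ (inj₁ r))) =
        (suc zero , rotate 4 z) , (tt , trans (norm-rotate 4 z) eq , 3→1 {rotate 3 z}
            (9→3 {rotate 2 z} (5→9 {rotate 1 z} (4→5 {z} r)))) , inj₁ refl
      square z@(_ ∷ _ ∷ _ ∷ _ ∷ _ ∷ []) eq (inj₂ (inj₂ (inj₂ (inj₁ r)))) =
        (suc (suc zero) , rotate 3 z) , (tt , trans (norm-rotate 3 z) eq , 3→1 {rotate 2 z}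
            (9→3 {rotate 1 z} (5→9 {z} r))) , inj₁ refl
      square z@(_ ∷ _ ∷ _ ∷ _ ∷ _ ∷ []) eq (inj₂ (inj₂ (inj₂ (inj₂ r)))) =
        (suc (suc (suc zero)) , rotate 2 z) , (tt , trans (norm-rotate 2 z) eq , 3→1 {rotate 1 z}
            (9→3 {z} r)) , inj₁ refl
      flip : ∀ z → Preimage (neg z) → Preimage z
      flip z (x , p , inj₁ eq) = x , p , inj₂ eq
      flip z (x , p , inj₂ eq) = x , p , inj₁ (trans eq (neg-neg z))
      surjective : ∀ z → norm z ≡ N × ¬ Residue 0 z → Preimage z
      surjective z (eq , nz) with residue 11 (dot z)
      ... | r , k , h = by-residue r (k , h)
        where
        S : Vec ℤ 5 → Set
        S z = Residue 1 z ⊎ Residue 3 z ⊎ Residue 4 z ⊎ Residue 5 z ⊎ Residue 9 z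
        pos : S z → Preimage z
        pos = square z eq
        opp : ∀ c d → c ℕ.+ d ≡ 11 → Residue c z → (Residue d (neg z) → S (neg z)) → Preimage z
        opp c d c+d r s = flip z (square (neg z) (trans (norm-neg z) eq) (s (Residue-neg c d c+d {z} r)))
        -- -1 is not a square modulo 11, so for a nonsquare residue the negative of z has a square
        -- one.
        by-residue : ∀ (r : Fin 11) → Residue (toℕ r) z → Preimage z
        by-residue zero h = contradiction h nz
        by-residue (suc zero) h = pos (inj₁ h)
        by-residue (suc (suc zero)) h = opp 2 9 refl h λ r → inj₂ (inj₂ (inj₂ (inj₂ r)))
        by-residue (suc (suc (suc zero))) h = pos (inj₂ (inj₁ h))
        by-residue (suc (suc (suc (suc zero)))) h = pos (inj₂ (inj₂ (inj₁ h)))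
        by-residue (suc (suc (suc (suc (suc zero))))) h = pos (inj₂ (inj₂ (inj₂ (inj₁ h))))
        by-residue (suc (suc (suc (suc (suc (suc zero)))))) h = opp 6 5 refl h λ r → inj₂
            (inj₂ (inj₂ (inj₁ r)))
        by-residue (suc (suc (suc (suc (suc (suc (suc zero))))))) h = opp 7 4 refl h λ r → inj₂
            (inj₂ (inj₁ r))
        by-residue (suc (suc (suc (suc (suc (suc (suc (suc zero)))))))) h = opp 8 3 refl h λ r → inj₂
            (inj₁ r)
        by-residue (suc (suc (suc (suc (suc (suc (suc (suc (suc zero))))))))) h = pos
            (inj₂ (inj₂ (inj₂ (inj₂ h))))
        by-residue (suc (suc (suc (suc (suc (suc (suc (suc (suc (suc zero)))))))))) h = opp 10 1 refl h inj₁

  -- Sums of five squares up to sign, reduced by involutions.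

  -- π and ι identify the fixed points of σ with the solutions of Q.
  parity-fold : ∀ {n k} {P : Vec ℤ n → Set} {Q : Vec ℤ k → Set} {c} (σ : Vec ℤ n → Vec ℤ n)
      (π : Vec ℤ n → Vec ℤ k) (ι : Vec ℤ k → Vec ℤ n) →
    (∀ v → σ (neg v) ≡ neg (σ v)) → (∀ v → σ (σ v) ≡ v) → (∀ v → P v → P (σ v)) →
        (∀ v → P v → ¬ σ v ≡ neg v) →
    (∀ v → π (neg v) ≡ neg (π v)) → (∀ w → ι (neg w) ≡ neg (ι w)) →
    (∀ v → P v → σ v ≡ v → Q (π v) × ι (π v) ≡ v) →
    (∀ w → Q w → P (ι w)) → (∀ w → σ (ι w) ≡ ι w) → (∀ w → π (ι w) ≡ w) →
    Parity (ℤ± n) P c → Parity (ℤ± k) Q c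
  parity-fold {n} {k} σ π ι σ-neg σσ σP anti π-neg ι-neg fix ιP σι πι p =
    parity-image (ℤ± n) (ℤ± k) π (λ { (inj₁ refl) → inj₁ refl ; {_} {v} (inj₂ refl) → inj₂ (π-neg v) })
      -- `anti` excludes the classes that σ fixes only by reversing the sign; they would not be
      -- described by π and ι.
      (λ { {v} (pv , inj₁ fx) → proj₁ (fix v pv fx) ; {v} (pv , inj₂ fx) → contradiction fx (anti v pv) })
      (λ { {v} {w} (pv , inj₁ fv) (pw , inj₁ fw) (inj₁ eq) →
             inj₁ (trans (sym (proj₂ (fix v pv fv))) (trans (cong ι eq) (proj₂ (fix w pw fw))))
         ; {v} {w} (pv , inj₁ fv) (pw , inj₁ fw) (inj₂ eq) →
             inj₂ (trans (sym (proj₂ (fix v pv fv)))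
                 (trans (cong ι eq) (trans (ι-neg (π w)) (cong neg (proj₂ (fix w pw fw))))))
         ; {v} (pv , inj₂ fv) _ _ → contradiction fv (anti v pv)
         ; {_} {w} _ (pw , inj₂ fw) _ → contradiction fw (anti w pw) })
      (λ {w} qw → ι w , (ιP w qw , inj₁ (σι w)) , inj₁ (πι w))
      (parity-involution (ℤ± n) σ (λ { (inj₁ refl) → inj₁ refl ; {_} {v} (inj₂ refl) → inj₂ (σ-neg v) })
        (λ {v} → σP v) (λ {v} _ → inj₁ (σσ v)) p)

  tri≡ : ∀ {a b c d e f : ℤ} → a ≡ d → b ≡ e → c ≡ f → _≡_ {A = Vec ℤ 3} (a ∷ b ∷ c ∷ []) (d ∷ e ∷ f ∷ [])
  tri≡ refl refl refl = refl

  0≡-0 : ∀ {x} → x ≡ - x → x ≡ + 0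
  0≡-0 {x} eq = linear (+ 2) (+ 1) eq (ring x)
    where
    ring : ∀ x → + 2 * x + + 1 * - x ≡ + 2 * + 0 + + 1 * x
    ring = solve-∀

  square-neg : ∀ x → - x * - x ≡ x * x
  square-neg x = trans (sym (ℤ.neg-distribˡ-* x (- x)))
      (trans (cong (-_) (sym (ℤ.neg-distribʳ-* x x))) (ℤ.neg-involutive (x * x)))

  module Lattices (m : ℕ) where
    open Neighbour m using (N)
    -- Discharges every `anti` hypothesis below: a vector that an involution sends to its negative
    -- has even norm.
    N-odd : ∀ x → ¬ + 2 * x ≡ N
    N-odd x eq = ¬even×odd (x , refl) (+ m , eq)

    +N : N ≡ + (2 ℕ.* m ℕ.+ 1)
    +N = sym (trans (ℤ.pos-+ (2 ℕ.* m) 1) (cong (_+ + 1) (ℤ.pos-* 2 m)))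

    -- Exchanging coordinates in pairs leaves z = (x, x, x, x, w), and x ↦ - x leaves x = 0.
    module Cubic where

      finite : ∃ (Parity (ℤ± 5) (λ z → norm z ≡ N))
      finite = parity-bounded (2 ℕ.* m ℕ.+ 1) (λ z → norm z ℤ.≟ N) (λ z eq → trans (norm-neg z) eq) bound
        where
        norm≥0 : ∀ {n} (v : Vec ℤ n) → + 0 ≤ norm v
        norm≥0 [] = +≤+ z≤n
        norm≥0 (x ∷ v) = 0≤x² x ⊕ norm≥0 v
        bounds : ∀ {n} (v : Vec ℤ n) {r} M → + 0 ≤ r → norm v + r ≡ + M → VecAll.All (λ x → ∣ x ∣ ℕ.≤ M) v
        bounds [] M r eq = []
        bounds (x ∷ v) {r} M r≥0 eq = square-bound x M (norm≥0 v ⊕ r≥0)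
            (trans (sym (ℤ.+-assoc (x * x) (norm v) r)) eq)
          ∷ bounds v M (0≤x² x ⊕ r≥0) (trans (ring (x * x) (norm v) r) eq)
          where
          ring : ∀ x v r → v + (x + r) ≡ x + v + r
          ring = solve-∀
        bound : ∀ z → norm z ≡ N → VecAll.All (λ x → ∣ x ∣ ℕ.≤ 2 ℕ.* m ℕ.+ 1) z
        bound z eq = bounds z (2 ℕ.* m ℕ.+ 1) (+≤+ z≤n) (trans (ℤ.+-identityʳ (norm z)) (trans eq +N))

      Q₃ : Vec ℤ 3 → Set
      Q₃ (x ∷ y ∷ w ∷ []) = + 2 * (x * x) + + 2 * (y * y) + w * w ≡ N

      Q₂ : Vec ℤ 2 → Set
      Q₂ (x ∷ w ∷ []) = + 4 * (x * x) + w * w ≡ N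

      Q₀ : Vec ℤ 1 → Set
      Q₀ (w ∷ []) = w * w ≡ N

      step₁ : ∀ {c} → Parity (ℤ± 5) (λ z → norm z ≡ N) c → Parity (ℤ± 3) Q₃ c
      step₁ = parity-fold
        (λ { (a ∷ b ∷ c ∷ d ∷ e ∷ []) → b ∷ a ∷ d ∷ c ∷ e ∷ [] })
        (λ { (a ∷ b ∷ c ∷ d ∷ e ∷ []) → a ∷ c ∷ e ∷ [] })
        (λ { (x ∷ y ∷ w ∷ []) → x ∷ x ∷ y ∷ y ∷ w ∷ [] })
        (λ { (a ∷ b ∷ c ∷ d ∷ e ∷ []) → refl }) (λ { (a ∷ b ∷ c ∷ d ∷ e ∷ []) → refl })
        (λ { (a ∷ b ∷ c ∷ d ∷ e ∷ []) eq → trans (ring (a * a) (b * b) (c * c) (d * d) (e * e)) eq })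
        (λ { (a ∷ b ∷ c ∷ d ∷ e ∷ []) eq fx → anti a b c d e (cong Vec.head fx)
            (cong (Vec.head ∘ Vec.tail ∘ Vec.tail) fx)
               (0≡-0 (cong (Vec.head ∘ Vec.tail ∘ Vec.tail ∘ Vec.tail ∘ Vec.tail) fx)) eq })
        (λ { (a ∷ b ∷ c ∷ d ∷ e ∷ []) → refl }) (λ { (x ∷ y ∷ w ∷ []) → refl })
        (λ { (a ∷ b ∷ c ∷ d ∷ e ∷ []) eq fx → fixed a b c d e (cong Vec.head fx)
            (cong (Vec.head ∘ Vec.tail ∘ Vec.tail) fx) eq })
        (λ { (x ∷ y ∷ w ∷ []) eq → trans (ring₃ (x * x) (y * y) (w * w)) eq })
        (λ { (x ∷ y ∷ w ∷ []) → refl }) (λ { (x ∷ y ∷ w ∷ []) → refl })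
        where
        ring : ∀ a b c d e → b + (a + (d + (c + (e + + 0)))) ≡ a + (b + (c + (d + (e + + 0))))
        ring = solve-∀
        ring₂ : ∀ a c → + 2 * (a + c) ≡ a + (a + (c + (c + (+ 0 + + 0))))
        ring₂ = solve-∀
        ring₃ : ∀ x y w → x + (x + (y + (y + (w + + 0)))) ≡ + 2 * x + + 2 * y + w
        ring₃ = solve-∀
        anti : ∀ a b c d e → b ≡ - a → d ≡ - c → e ≡ + 0 → ¬ norm (a ∷ b ∷ c ∷ d ∷ e ∷ []) ≡ N
        anti a _ c _ _ refl refl refl eq = N-odd (a * a + c * c) (trans (ring₂ (a * a) (c * c))
          (trans (cong₂ (λ x y → a * a + (x + (c * c + (y + (+ 0 + + 0))))) (sym (square-neg a))
              (sym (square-neg c))) eq))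
        fixed : ∀ a b c d e → b ≡ a → d ≡ c → norm (a ∷ b ∷ c ∷ d ∷ e ∷ []) ≡ N →
                + 2 * (a * a) + + 2 * (c * c) + e * e ≡ N × (a ∷ a ∷ c ∷ c ∷ e ∷ []) ≡
                    (a ∷ b ∷ c ∷ d ∷ e ∷ [])
        fixed a _ c _ e refl refl eq = trans (sym (ring₃ (a * a) (c * c) (e * e))) eq , refl

      step₂ : ∀ {c} → Parity (ℤ± 3) Q₃ c → Parity (ℤ± 2) Q₂ c
      step₂ = parity-fold
        (λ { (x ∷ y ∷ w ∷ []) → y ∷ x ∷ w ∷ [] }) (λ { (x ∷ y ∷ w ∷ []) → x ∷ w ∷ [] })
            (λ { (x ∷ w ∷ []) → x ∷ x ∷ w ∷ [] })
        (λ { (x ∷ y ∷ w ∷ []) → refl }) (λ { (x ∷ y ∷ w ∷ []) → refl })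
        (λ { (x ∷ y ∷ w ∷ []) eq → trans (ring (x * x) (y * y) (w * w)) eq })
        (λ { (x ∷ y ∷ w ∷ []) eq fx → anti x y w (0≡-0 (cong (Vec.head ∘ Vec.tail ∘ Vec.tail) fx)) eq })
        (λ { (x ∷ y ∷ w ∷ []) → refl }) (λ { (x ∷ w ∷ []) → refl })
        (λ { (x ∷ y ∷ w ∷ []) eq fx → fixed x y w (cong Vec.head fx) eq })
        (λ { (x ∷ w ∷ []) eq → trans (ring₃ (x * x) (w * w)) eq })
        (λ { (x ∷ w ∷ []) → refl }) (λ { (x ∷ w ∷ []) → refl })
        where
        ring : ∀ x y w → + 2 * y + + 2 * x + w ≡ + 2 * x + + 2 * y + w
        ring = solve-∀
        ring₂ : ∀ x y → + 2 * (x + y) ≡ + 2 * x + + 2 * y + + 0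
        ring₂ = solve-∀
        ring₃ : ∀ x w → + 2 * x + + 2 * x + w ≡ + 4 * x + w
        ring₃ = solve-∀
        anti : ∀ x y w → w ≡ + 0 → ¬ + 2 * (x * x) + + 2 * (y * y) + w * w ≡ N
        anti x y _ refl eq = N-odd (x * x + y * y) (trans (ring₂ (x * x) (y * y)) eq)
        fixed : ∀ x y w → y ≡ x → + 2 * (x * x) + + 2 * (y * y) + w * w ≡ N →
                + 4 * (x * x) + w * w ≡ N × (x ∷ x ∷ w ∷ []) ≡ (x ∷ y ∷ w ∷ [])
        fixed x _ w refl eq = trans (sym (ring₃ (x * x) (w * w))) eq , refl

      step₃ : ∀ {c} → Parity (ℤ± 2) Q₂ c → Parity (ℤ± 1) Q₀ c
      step₃ = parity-fold
        (λ { (x ∷ w ∷ []) → - x ∷ w ∷ [] }) (λ { (x ∷ w ∷ []) → w ∷ [] }) (λ { (w ∷ []) → + 0 ∷ w ∷ [] })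
        (λ { (x ∷ w ∷ []) → refl }) (λ { (x ∷ w ∷ []) → pair≡ (ℤ.neg-involutive x) refl })
        (λ { (x ∷ w ∷ []) eq → trans (cong (λ y → + 4 * y + w * w) (square-neg x)) eq })
        (λ { (x ∷ w ∷ []) eq fx → anti x w (0≡-0 (snd≡ fx)) eq })
        (λ { (x ∷ w ∷ []) → refl }) (λ { (w ∷ []) → refl })
        (λ { (x ∷ w ∷ []) eq fx → fixed x w (0≡-0 (sym (fst≡ fx))) eq })
        (λ { (w ∷ []) eq → trans (ring₃ (w * w)) eq })
        (λ { (w ∷ []) → refl }) (λ { (w ∷ []) → refl })
        where
        ring₂ : ∀ x → + 2 * (+ 2 * x) ≡ + 4 * x + + 0
        ring₂ = solve-∀
        ring₃ : ∀ w → + 4 * + 0 + w ≡ w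
        ring₃ = solve-∀
        anti : ∀ x w → w ≡ + 0 → ¬ + 4 * (x * x) + w * w ≡ N
        anti x _ refl eq = N-odd (+ 2 * (x * x)) (trans (ring₂ (x * x)) eq)
        fixed : ∀ x w → x ≡ + 0 → + 4 * (x * x) + w * w ≡ N → w * w ≡ N × (+ 0 ∷ w ∷ []) ≡ (x ∷ w ∷ [])
        fixed _ w refl eq = trans (sym (ring₃ (w * w))) eq , refl

      -- (4 k + 1)² = 2 m + 1 means m = 4 (2 k² + k), an exponent in ψ(q⁴).
      squares : Parity (ℤ± 1) Q₀ (ψ₄ m)
      squares = parity-image ℤₛ (ℤ± 1) (λ k → + 4 * k + + 1 ∷ []) (λ { refl → inj₁ refl })
        (λ {k} eq → linear (+ 1) (+ 2) (trans (sym (weight-ψ₄ k)) (cong +_ eq)) (ring k (+ m)))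
        (λ {k} {l} _ _ → λ { (inj₁ eq) → 1mod4-injective {k} {l} (inj₁ (cong Vec.head eq))
                          ; (inj₂ eq) → 1mod4-injective {k} {l} (inj₂ (cong Vec.head eq)) })
        (λ { {w ∷ []} eq → surjective w eq }) (counts-ψ₄ m)
        where
        ring : ∀ k j → + 1 * ((+ 4 * k + + 1) * (+ 4 * k + + 1)) + + 2 * j ≡ + 1 * (+ 2 * j + + 1) + + 2 *
            (+ 8 * (k * k) + + 4 * k)
        ring = solve-∀
        preimage : ∀ k → (+ 4 * k + + 1) * (+ 4 * k + + 1) ≡ N → weight 3 1 k ℕ.* 2 ℕ.* 2 ≡ m
        preimage k eq = ℤ.+-injective (trans (weight-ψ₄ k) (linear (+ 2) (+ 1) eq (ring₃ k (+ m))))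
          where
          ring₃ : ∀ k j → + 2 * (+ 8 * (k * k) + + 4 * k) + + 1 * (+ 2 * j + + 1) ≡ + 2 * j + + 1 *
              ((+ 4 * k + + 1) * (+ 4 * k + + 1))
          ring₃ = solve-∀
        square-odd : ∀ w → w * w ≡ N → Odd w
        square-odd w eq with even⊎odd w
        ... | inj₂ o = o
        ... | inj₁ (k , refl) = contradiction (trans (ring₂ k) eq) (N-odd (+ 2 * (k * k)))
          where
          ring₂ : ∀ k → + 2 * (+ 2 * (k * k)) ≡ + 2 * k * (+ 2 * k)
          ring₂ = solve-∀
        surjective : ∀ w → w * w ≡ N → ∃ λ k → weight 3 1 k ℕ.* 2 ℕ.* 2 ≡ m ×
                     ((+ 4 * k + + 1 ∷ []) ≡ (w ∷ []) ⊎ (+ 4 * k + + 1 ∷ []) ≡ (- w ∷ []))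
        surjective w eq with odd⇒±1mod4 (square-odd w eq)
        ... | k , inj₁ h = k , preimage k (trans (cong₂ _*_ h h) eq) , inj₁ (cong (_∷ []) h)
        ... | k , inj₂ h = k , preimage k (trans (cong₂ _*_ h h) (trans (square-neg w) eq)) , inj₂
            (cong (_∷ []) h)

      cubic : Parity (ℤ± 5) (λ z → norm z ≡ N) (ψ₄ m)
      cubic = subst (Parity (ℤ± 5) (λ z → norm z ≡ N))
        (parity-unique (ℤ± 1) (step₃ (step₂ (step₁ (proj₂ finite)))) squares) (proj₂ finite)

  -- The sublattice on which v·z is divisible by 11.

  form : Vec ℤ 5 → ℤ
  form (a ∷ b ∷ c ∷ d ∷ e ∷ []) = a * a + (b * b + (c * c + (d * d + (e * e +
    ((a - b) * (a - b) + ((b - c) * (b - c) + ((c - d) *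
        (c - d) + ((d - e) * (d - e) + (e - a) * (e - a)))))))))

  parity-of : ∀ w → (∃ λ i → w ≡ i ℕ.* 2) ⊎ (∃ λ i → w ≡ 1 ℕ.+ i ℕ.* 2)
  parity-of zero = inj₁ (0 , refl)
  parity-of (suc w) with parity-of w
  ... | inj₁ (i , refl) = inj₂ (i , refl)
  ... | inj₂ (i , refl) = inj₁ (suc i , refl)

  even-half : ∀ w → Even (+ w) → ∃ λ i → w ≡ i ℕ.* 2
  even-half w e with parity-of w
  ... | inj₁ h = h
  ... | inj₂ (i , refl) = contradiction (+ i , trans (ℤ.pos-+ 1 (i ℕ.* 2))
      (trans (ℤ.+-comm (+ 1) (+ (i ℕ.* 2)))
          (cong (_+ + 1) (trans (ℤ.pos-* i 2) (ℤ.*-comm (+ i) (+ 2)))))) (¬even×odd e)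

  -- The lattice of all z with v·z = 0 modulo 11 has the quadratic form `form` in a suitable basis.  A reflection
  -- of the pentagon and then (a , b , c) ↦ (a , b , b - c) reduce `form` to the binary form of Q₂.
  module Residual (m : ℕ) where
    open Neighbour m using (N; neighbour; E-row)
    open Lattices m using (N-odd; +N; module Cubic)
    open Cubic using (cubic)

    Q₃ : Vec ℤ 3 → Set
    Q₃ (a ∷ b ∷ c ∷ []) = a * a + + 2 * (b * b + (c * c + ((a - b) * (a - b) + (b - c) * (b - c)))) ≡ N

    Q₂ : Vec ℤ 2 → Set
    Q₂ (x ∷ t ∷ []) = x * x + + 2 * (+ 6 * (t * t) + (x - + 2 * t) * (x - + 2 * t)) ≡ N

    finite : ∃ (Parity (ℤ± 5) (λ y → form y ≡ N))
    finite = parity-bounded (2 ℕ.* m ℕ.+ 1) (λ y → form y ℤ.≟ N)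
      (λ { (a ∷ b ∷ c ∷ d ∷ e ∷ []) eq → trans (ring a b c d e) eq })
      (λ { (a ∷ b ∷ c ∷ d ∷ e ∷ []) eq → let A = 0≤x² a ; B = 0≤x² b ; C = 0≤x² c ; D = 0≤x² d ; E = 0≤x² e
                                             R = 0≤x² (a - b) ⊕ 0≤x² (b - c) ⊕ 0≤x² (c - d) ⊕ 0≤x² (d - e) ⊕
                                                 0≤x² (e - a)
                                             eq′ = trans eq +N
                                             r = (a - b) * (a - b) + ((b - c) *
                                                 (b - c) + ((c - d) * (c - d) + ((d - e) *
                                                 (d - e) + (e - a) * (e - a)))) in
           square-bound a _ (B ⊕ C ⊕ D ⊕ E ⊕ R) eq′
         ∷ square-bound b _ (A ⊕ C ⊕ D ⊕ E ⊕ R) (trans (r₁ (a * a) (b * b) (c * c) (d * d) (e * e) r) eq′)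
         ∷ square-bound c _ (A ⊕ B ⊕ D ⊕ E ⊕ R) (trans (r₂ (a * a) (b * b) (c * c) (d * d) (e * e) r) eq′)
         ∷ square-bound d _ (A ⊕ B ⊕ C ⊕ E ⊕ R) (trans (r₃ (a * a) (b * b) (c * c) (d * d) (e * e) r) eq′)
         ∷ square-bound e _ (A ⊕ B ⊕ C ⊕ D ⊕ R) (trans
             (r₄ (a * a) (b * b) (c * c) (d * d) (e * e) r) eq′) ∷ [] })
      where
      r₁ : ∀ a b c d e r → b + (a + (c + (d + (e + r)))) ≡ a + (b + (c + (d + (e + r))))
      r₁ = solve-∀
      r₂ : ∀ a b c d e r → c + (a + (b + (d + (e + r)))) ≡ a + (b + (c + (d + (e + r))))
      r₂ = solve-∀
      r₃ : ∀ a b c d e r → d + (a + (b + (c + (e + r)))) ≡ a + (b + (c + (d + (e + r))))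
      r₃ = solve-∀
      r₄ : ∀ a b c d e r → e + (a + (b + (c + (d + r)))) ≡ a + (b + (c + (d + (e + r))))
      r₄ = solve-∀
      ring : ∀ a b c d e → - a * - a + (- b * - b + (- c * - c + (- d * - d + (- e * - e +
               ((- a - - b) * (- a - - b) + ((- b - - c) *
                   (- b - - c) + ((- c - - d) * (- c - - d) + ((- d - - e) * (- d - - e) + (- e - - a) *
                   (- e - - a))))))))) ≡
             a * a + (b * b + (c * c + (d * d + (e * e +
               ((a - b) * (a - b) + ((b - c) * (b - c) + ((c - d) *
                   (c - d) + ((d - e) * (d - e) + (e - a) * (e - a)))))))))
      ring = solve-∀

    step₁ : ∀ {c} → Parity (ℤ± 5) (λ y → form y ≡ N) c → Parity (ℤ± 3) Q₃ c
    step₁ = parity-fold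
      (λ { (a ∷ b ∷ c ∷ d ∷ e ∷ []) → a ∷ e ∷ d ∷ c ∷ b ∷ [] })
      (λ { (a ∷ b ∷ c ∷ d ∷ e ∷ []) → a ∷ b ∷ c ∷ [] })
      (λ { (a ∷ b ∷ c ∷ []) → a ∷ b ∷ c ∷ c ∷ b ∷ [] })
      (λ { (a ∷ b ∷ c ∷ d ∷ e ∷ []) → refl }) (λ { (a ∷ b ∷ c ∷ d ∷ e ∷ []) → refl })
      (λ { (a ∷ b ∷ c ∷ d ∷ e ∷ []) eq → trans (ring a b c d e) eq })
      (λ { (a ∷ b ∷ c ∷ d ∷ e ∷ []) eq fx → anti a b c d e (0≡-0 (cong Vec.head fx))
          (cong (Vec.head ∘ Vec.tail) fx) (cong (Vec.head ∘ Vec.tail ∘ Vec.tail) fx) eq })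
      (λ { (a ∷ b ∷ c ∷ d ∷ e ∷ []) → refl }) (λ { (a ∷ b ∷ c ∷ []) → refl })
      (λ { (a ∷ b ∷ c ∷ d ∷ e ∷ []) eq fx → fixed a b c d e (cong (Vec.head ∘ Vec.tail) fx)
          (cong (Vec.head ∘ Vec.tail ∘ Vec.tail) fx) eq })
      (λ { (a ∷ b ∷ c ∷ []) eq → trans (sym (ring₃ a b c)) eq })
      (λ { (a ∷ b ∷ c ∷ []) → refl }) (λ { (a ∷ b ∷ c ∷ []) → refl })
      where
      ring : ∀ a b c d e → a * a + (e * e + (d * d + (c * c + (b * b +
               ((a - e) * (a - e) + ((e - d) * (e - d) + ((d - c) *
                   (d - c) + ((c - b) * (c - b) + (b - a) * (b - a))))))))) ≡
             a * a + (b * b + (c * c + (d * d + (e * e +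
               ((a - b) * (a - b) + ((b - c) * (b - c) + ((c - d) *
                   (c - d) + ((d - e) * (d - e) + (e - a) * (e - a)))))))))
      ring = solve-∀
      ring₂ : ∀ b c → + 2 * (+ 2 * (b * b) + + 3 * (c * c) + (b - c) * (b - c)) ≡
              + 0 + (b * b + (c * c + (- c * - c + (- b * - b +
               ((+ 0 - b) * (+ 0 - b) + ((b - c) * (b - c) + ((c - - c) *
                   (c - - c) + ((- c - - b) * (- c - - b) + (- b - + 0) * (- b - + 0)))))))))
      ring₂ = solve-∀
      ring₃ : ∀ a b c → a * a + + 2 * (b * b + (c * c + ((a - b) * (a - b) + (b - c) * (b - c)))) ≡
              a * a + (b * b + (c * c + (c * c + (b * b +
               ((a - b) * (a - b) + ((b - c) * (b - c) + ((c - c) *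
                   (c - c) + ((c - b) * (c - b) + (b - a) * (b - a)))))))))
      ring₃ = solve-∀
      anti : ∀ a b c d e → a ≡ + 0 → e ≡ - b → d ≡ - c → ¬ form (a ∷ b ∷ c ∷ d ∷ e ∷ []) ≡ N
      anti _ b c _ _ refl refl refl eq = N-odd (+ 2 * (b * b) + + 3 * (c * c) + (b - c) * (b - c))
          (trans (ring₂ b c) eq)
      fixed : ∀ a b c d e → e ≡ b → d ≡ c → form (a ∷ b ∷ c ∷ d ∷ e ∷ []) ≡ N →
              Q₃ (a ∷ b ∷ c ∷ []) × (a ∷ b ∷ c ∷ c ∷ b ∷ []) ≡ (a ∷ b ∷ c ∷ d ∷ e ∷ [])
      fixed a b c _ _ refl refl eq = trans (ring₃ a b c) eq , refl

    -- Replacing c by b - c exchanges the terms c² and (b - c)². On the fixed points b = 2 c, where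
    -- b² + c² + (b - c)² = 6 c².
    step₂ : ∀ {c} → Parity (ℤ± 3) Q₃ c → Parity (ℤ± 2) Q₂ c
    step₂ = parity-fold
      (λ { (a ∷ b ∷ c ∷ []) → a ∷ b ∷ b - c ∷ [] })
      (λ { (a ∷ b ∷ c ∷ []) → a ∷ c ∷ [] })
      (λ { (x ∷ t ∷ []) → x ∷ + 2 * t ∷ t ∷ [] })
      (λ { (a ∷ b ∷ c ∷ []) → tri≡ refl refl (ring₀ b c) })
          (λ { (a ∷ b ∷ c ∷ []) → tri≡ refl refl (ring₁ b c) })
      (λ { (a ∷ b ∷ c ∷ []) eq → trans (ring a b c) eq })
      (λ { (a ∷ b ∷ c ∷ []) eq fx → anti a b c (0≡-0 (cong Vec.head fx)) eq })
      (λ { (a ∷ b ∷ c ∷ []) → refl }) (λ { (x ∷ t ∷ []) → tri≡ refl (sym (ℤ.neg-distribʳ-* (+ 2) t)) refl })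
      (λ { (a ∷ b ∷ c ∷ []) eq fx → fixed a b c (linear (+ 1) (+ 1)
          (cong (Vec.head ∘ Vec.tail ∘ Vec.tail) fx) (ring₄ b c)) eq })
      (λ { (x ∷ t ∷ []) eq → trans (ring₃ x t) eq })
      (λ { (x ∷ t ∷ []) → tri≡ refl refl (ring₅ t) }) (λ { (x ∷ t ∷ []) → refl })
      where
      ring₀ : ∀ b c → - b - - c ≡ - (b - c)
      ring₀ = solve-∀
      ring₁ : ∀ b c → b - (b - c) ≡ c
      ring₁ = solve-∀
      ring : ∀ a b c → a * a + + 2 * (b * b + ((b - c) *
          (b - c) + ((a - b) * (a - b) + (b - (b - c)) * (b - (b - c))))) ≡
             a * a + + 2 * (b * b + (c * c + ((a - b) * (a - b) + (b - c) * (b - c))))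
      ring = solve-∀
      ring₂ : ∀ x → + 2 * x ≡ + 0 + + 2 * x
      ring₂ = solve-∀
      ring₃ : ∀ x t → x * x + + 2 * ((+ 2 * t) * (+ 2 * t) + (t * t + ((x - + 2 * t) *
          (x - + 2 * t) + (+ 2 * t - t) * (+ 2 * t - t)))) ≡
              x * x + + 2 * (+ 6 * (t * t) + (x - + 2 * t) * (x - + 2 * t))
      ring₃ = solve-∀
      ring₄ : ∀ b c → + 1 * b + + 1 * c ≡ + 1 * (+ 2 * c) + + 1 * (b - c)
      ring₄ = solve-∀
      ring₅ : ∀ t → + 2 * t - t ≡ t
      ring₅ = solve-∀
      anti : ∀ a b c → a ≡ + 0 → ¬ Q₃ (a ∷ b ∷ c ∷ [])
      anti _ b c refl eq = N-odd (b * b + (c * c + ((+ 0 - b) * (+ 0 - b) + (b - c) * (b - c))))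
          (trans (ring₂ _) eq)
      fixed : ∀ a b c → b ≡ + 2 * c → Q₃ (a ∷ b ∷ c ∷ []) → Q₂ (a ∷ c ∷ []) × (a ∷ + 2 * c ∷ c ∷ []) ≡
          (a ∷ b ∷ c ∷ [])
      fixed a _ c refl eq = trans (sym (ring₃ a c)) eq , refl

    -- Four times the form of `Q₂` is (x + 6 t)² + 11 (x - 2 t)². The two squares have p - r = 8 t,
    -- and this congruence with r odd describes the image.
    Q₈ : Vec ℤ 2 → Set
    Q₈ (p ∷ r ∷ []) = p * p + + 11 * (r * r) ≡ + 4 * N × Odd r × ∃ λ t → p - r ≡ + 8 * t

    step₃ : ∀ {c} → Parity (ℤ± 2) Q₂ c → Parity (ℤ± 2) Q₈ c
    step₃ = parity-image (ℤ± 2) (ℤ± 2) φ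
      (λ { (inj₁ refl) → inj₁ refl ; {_} {x ∷ t ∷ []} (inj₂ refl) → inj₂ (pair≡ (r₁ x t) (r₂ x t)) })
      (λ { {x ∷ t ∷ []} eq → trans (r₃ x t) (cong (+ 4 *_) eq) , sub-odd x t (x-odd x t eq) , t , r₄ x t })
      (λ { {x ∷ t ∷ []} {y ∷ u ∷ []} _ _ (inj₁ eq) → inj₁
          (pair≡ (linear₂ (+ 4) (+ 1) (+ 3) (fst≡ eq) (snd≡ eq) (i₁ x t y u))
                                                               (linear₂ (+ 8) (+ 1) (- + 1) (fst≡ eq)
                                                                   (snd≡ eq) (i₂ x t y u)))
         ; {x ∷ t ∷ []} {y ∷ u ∷ []} _ _ (inj₂ eq) → inj₂
             (pair≡ (linear₂ (+ 4) (+ 1) (+ 3) (fst≡ eq) (snd≡ eq) (i₃ x t y u))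
                                                               (linear₂ (+ 8) (+ 1) (- + 1) (fst≡ eq)
                                                                   (snd≡ eq) (i₄ x t y u))) })
      (λ { {p ∷ r ∷ []} (eq , _ , t , h) → r + + 2 * t ∷ t ∷ [] ,
             ℤ.*-cancelˡ-≡ (+ 4) _ N (trans (sym (r₃ (r + + 2 * t) t))
                 (trans (cong₂ (λ p r → p * p + + 11 * (r * r)) (p≡ p r t h) (s₂ r t)) eq)) ,
             inj₁ (pair≡ (p≡ p r t h) (s₂ r t)) })
      where
      φ : Vec ℤ 2 → Vec ℤ 2
      φ (x ∷ t ∷ []) = x + + 6 * t ∷ x - + 2 * t ∷ []
      r₁ : ∀ x t → - x + + 6 * - t ≡ - (x + + 6 * t)
      r₁ = solve-∀
      r₂ : ∀ x t → - x - + 2 * - t ≡ - (x - + 2 * t)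
      r₂ = solve-∀
      r₃ : ∀ x t → (x + + 6 * t) * (x + + 6 * t) + + 11 * ((x - + 2 * t) * (x - + 2 * t)) ≡
           + 4 * (x * x + + 2 * (+ 6 * (t * t) + (x - + 2 * t) * (x - + 2 * t)))
      r₃ = solve-∀
      r₄ : ∀ x t → x + + 6 * t - (x - + 2 * t) ≡ + 8 * t
      r₄ = solve-∀
      i₁ : ∀ x t y u → + 4 * x + (+ 1 * (y + + 6 * u) + + 3 * (y - + 2 * u)) ≡
          + 4 * y + (+ 1 * (x + + 6 * t) + + 3 * (x - + 2 * t))
      i₁ = solve-∀
      i₂ : ∀ x t y u → + 8 * t + (+ 1 * (y + + 6 * u) + - + 1 * (y - + 2 * u)) ≡
          + 8 * u + (+ 1 * (x + + 6 * t) + - + 1 * (x - + 2 * t))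
      i₂ = solve-∀
      i₃ : ∀ x t y u → + 4 * x + (+ 1 * - (y + + 6 * u) + + 3 * - (y - + 2 * u)) ≡
          + 4 * - y + (+ 1 * (x + + 6 * t) + + 3 * (x - + 2 * t))
      i₃ = solve-∀
      i₄ : ∀ x t y u → + 8 * t + (+ 1 * - (y + + 6 * u) + - + 1 * - (y - + 2 * u)) ≡
          + 8 * - u + (+ 1 * (x + + 6 * t) + - + 1 * (x - + 2 * t))
      i₄ = solve-∀
      s₂ : ∀ r t → r + + 2 * t - + 2 * t ≡ r
      s₂ = solve-∀
      p≡ : ∀ p r t → p - r ≡ + 8 * t → r + + 2 * t + + 6 * t ≡ p
      p≡ p r t h = linear (+ 1) (+ 1) (sym h) (ring p r t)
        where
        ring : ∀ p r t → + 1 * (r + + 2 * t + + 6 * t) + + 1 * (p - r) ≡ + 1 * p + + 1 * (+ 8 * t)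
        ring = solve-∀
      x-odd : ∀ x t → Q₂ (x ∷ t ∷ []) → Odd x
      x-odd x t eq with even⊎odd x
      ... | inj₂ o = o
      ... | inj₁ (k , refl) = contradiction (trans (ring k t) eq)
          (N-odd (+ 2 * (k * k) + (+ 6 * (t * t) + (+ 2 * k - + 2 * t) * (+ 2 * k - + 2 * t))))
        where
        ring : ∀ k t → + 2 * (+ 2 * (k * k) + (+ 6 * (t * t) + (+ 2 * k - + 2 * t) * (+ 2 * k - + 2 * t))) ≡
               + 2 * k * (+ 2 * k) + + 2 * (+ 6 * (t * t) + (+ 2 * k - + 2 * t) * (+ 2 * k - + 2 * t))
        ring = solve-∀
      sub-odd : ∀ x t → Odd x → Odd (x - + 2 * t)
      sub-odd _ t (k , refl) = k - t , ring k t
        where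
        ring : ∀ k t → + 2 * k + + 1 - + 2 * t ≡ + 2 * (k - t) + + 1
        ring = solve-∀

    W : ℤ × ℤ → ℕ
    W = weight 3 1 ⟨+⟩ weight 3 1

    Pₛ : Series
    Pₛ = ev (ψ PowerSeries.* dilate 11 ψ)

    -- Says that `W` x = m - 1 is even, in the unfolded form in which multiplication by q, dilation
    -- by 2 and `ev` produce it.
    W-even : ℤ × ℤ → Set
    W-even x = ∃ λ n → 1 ℕ.+ n ≡ m × ∃ λ i → i ℕ.* 2 ≡ n × W x ≡ i ℕ.* 2 ℕ.+ 0

    counts-W-even : Parity ℤ²ₛ W-even ((q PowerSeries.* dilate 2 Pₛ) m)
    counts-W-even = go m
      where
      go : ∀ m → Parity ℤ²ₛ (λ x → ∃ λ n → 1 ℕ.+ n ≡ m × ∃ λ i → i ℕ.* 2 ≡ n × W x ≡ i ℕ.* 2 ℕ.+ 0)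
          ((q PowerSeries.* dilate 2 Pₛ) m)
      go zero = parity-∅ ℤ²ₛ λ { (_ , () , _) }
      go (suc n) = subst (Parity ℤ²ₛ _) (sym (X*-at 1 (dilate 2 Pₛ) n))
          (parity-⇔ ℤ²ₛ (λ (i , eq , w) → n , refl , i , eq , w)
        (λ { (_ , refl , i , eq , w) → i , eq , w })
            (counts-dilate ℤ²ₛ 1 (λ i → counts-ψψ (i ℕ.* 2 ℕ.+ 0)) n))

    value : ∀ k l → + W (k , l) ≡ + 2 * (k * k) + k + + 11 * (+ 2 * (l * l) + l)
    value k l = linear (+ 2) (- + 1) (weights⇒ 3 1 3 1 k l refl) (ring k l (+ W (k , l)))
      where
      ring : ∀ k l w → + 2 * w + - + 1 * (+ 2 * w) ≡
             + 2 * (+ 2 * (k * k) + k + + 11 * (+ 2 * (l * l) + l)) + - + 1 *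
                 ((+ 3 * (k * (k + + 1)) + + 1 * (k * (k - + 1))) + (+ 3 * (l * (l + + 1)) + + 1 *
                 (l * (l - + 1))) * + 11)
      ring = solve-∀

    -- For p = 4 k + 1 and r = 4 l + 1 the equation reads 8 `W` + 12 = 8 m + 4. Moreover `W` has the
    -- parity of k + l, so p = r modulo 8 holds exactly when `W` is even: only the even part of ψ(q)
    -- ψ(q¹¹) contributes.
    residual : Parity (ℤ± 2) Q₈ ((q PowerSeries.* dilate 2 Pₛ) m)
    residual = parity-image ℤ²ₛ (ℤ± 2) φ (λ { (refl , refl) → inj₁ refl }) (λ { {k , l} → sound k l })
      (λ { {k , l} {k′ , l′} _ _ (inj₁ eq) → 1mod4-injective (inj₁ (fst≡ eq)) , 1mod4-injective
          (inj₁ (snd≡ eq))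
         ; {k , l} {k′ , l′} _ _ (inj₂ eq) → 1mod4-injective (inj₂ (fst≡ eq)) , 1mod4-injective
             (inj₂ (snd≡ eq)) })
      (λ { {p ∷ r ∷ []} → surjective p r }) counts-W-even
      where
      φ : ℤ × ℤ → Vec ℤ 2
      φ (k , l) = + 4 * k + + 1 ∷ + 4 * l + + 1 ∷ []
      norm-value : ∀ k l → suc (W (k , l)) ≡ m → (+ 4 * k + + 1) * (+ 4 * k + + 1) + + 11 *
          ((+ 4 * l + + 1) * (+ 4 * l + + 1)) ≡ + 4 * N
      norm-value k l eq = linear (+ 1) (+ 8) (trans (sym (cong (λ w → + 1 + w) (value k l)))
          (trans (sym (ℤ.pos-+ 1 (W (k , l)))) (cong +_ eq))) (ring k l (+ m))
        where
        ring : ∀ k l m → + 1 * ((+ 4 * k + + 1) * (+ 4 * k + + 1) + + 11 *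
            ((+ 4 * l + + 1) * (+ 4 * l + + 1))) + + 8 * m ≡
               + 1 * (+ 4 * (+ 2 * m + + 1)) + + 8 *
                   (+ 1 + (+ 2 * (k * k) + k + + 11 * (+ 2 * (l * l) + l)))
        ring = solve-∀
      sound : ∀ k l → W-even (k , l) → Q₈ (φ (k , l))
      sound k l (n , eq , i , i2 , w) = norm-value k l (trans (cong suc w≡n) eq) , (+ 2 * l , r₁ l) ,
          difference
        where
        w≡n : W (k , l) ≡ n
        w≡n = trans w (trans (ℕ.+-identityʳ _) i2)
        r₁ : ∀ l → + 4 * l + + 1 ≡ + 2 * (+ 2 * l) + + 1
        r₁ = solve-∀
        even-W : Even (+ W (k , l))
        even-W = + i , trans (cong +_ (trans w (ℕ.+-identityʳ _)))
            (trans (ℤ.pos-* i 2) (ℤ.*-comm (+ i) (+ 2)))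
        difference : ∃ λ t → + 4 * k + + 1 - (+ 4 * l + + 1) ≡ + 8 * t
        difference with even⊎odd (k - l)
        ... | inj₁ (t , h) = t , linear (+ 1) (+ 4) h (ring k l t)
          where
          ring : ∀ k l t → + 1 * (+ 4 * k + + 1 - (+ 4 * l + + 1)) + + 4 * (+ 2 * t) ≡ + 1 *
              (+ 8 * t) + + 4 * (k - l)
          ring = solve-∀
        ... | inj₂ (u , h) = contradiction (k * k + + 11 * (l * l) + + 6 * l + u ,
                trans (value k l) (linear (+ 1) (+ 1) h (ring k l u))) (¬even×odd even-W)
          where
          ring : ∀ k l u → + 1 * (+ 2 * (k * k) + k + + 11 * (+ 2 * (l * l) + l)) + + 1 * (+ 2 * u + + 1) ≡
                 + 1 * (+ 2 * (k * k + + 11 * (l * l) + + 6 * l + u) + + 1) + + 1 * (k - l)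
          ring = solve-∀
      found : ∀ k l t → k ≡ l + + 2 * t → (+ 4 * k + + 1) * (+ 4 * k + + 1) + + 11 *
          ((+ 4 * l + + 1) * (+ 4 * l + + 1)) ≡ + 4 * N → W-even (k , l)
      found k l t h eq with even-half (W (k , l)) (k * k + + 11 * (l * l) + + 6 * l + t , trans (value k l)
          (linear (+ 1) (+ 1) h (ring k l t)))
        where
        ring : ∀ k l t → + 1 * (+ 2 * (k * k) + k + + 11 * (+ 2 * (l * l) + l)) + + 1 * (l + + 2 * t) ≡
               + 1 * (+ 2 * (k * k + + 11 * (l * l) + + 6 * l + t)) + + 1 * k
        ring = solve-∀
      ... | i , w = W (k , l) , ℤ.+-injective (trans (ℤ.pos-+ 1 (W (k , l)))
          (trans (cong (λ w → + 1 + w) (value k l))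
                      (linear (+ 8) (+ 1) eq (ring k l (+ m))))) , i , sym w , trans w
                          (sym (ℕ.+-identityʳ _))
        where
        ring : ∀ k l m → + 8 * (+ 1 + (+ 2 * (k * k) + k + + 11 * (+ 2 * (l * l) + l))) + + 1 *
            (+ 4 * (+ 2 * m + + 1)) ≡
               + 8 * m + + 1 * ((+ 4 * k + + 1) * (+ 4 * k + + 1) + + 11 *
                   ((+ 4 * l + + 1) * (+ 4 * l + + 1)))
        ring = solve-∀
      surjective : ∀ p r → Q₈ (p ∷ r ∷ []) → ∃ λ x → W-even x ×
          (φ x ≡ (p ∷ r ∷ []) ⊎ φ x ≡ (- p ∷ - r ∷ []))
      surjective p r (eq , o , t , h) with odd⇒±1mod4 o
      ... | l , inj₁ refl = (l + + 2 * t , l) , found _ l t refl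
          (trans (cong (λ p → p * p + + 11 * ((+ 4 * l + + 1) * (+ 4 * l + + 1))) p≡) eq) , inj₁
          (pair≡ p≡ refl)
        where
        p≡ : + 4 * (l + + 2 * t) + + 1 ≡ p
        p≡ = linear (+ 1) (+ 1) (sym h) (ring l t p)
          where
          ring : ∀ l t p → + 1 * (+ 4 * (l + + 2 * t) + + 1) + + 1 * (p - (+ 4 * l + + 1)) ≡ + 1 * p + + 1 *
              (+ 8 * t)
          ring = solve-∀
      ... | l , inj₂ e = (l + + 2 * - t , l) , found _ l (- t) refl
              (trans (cong₂ (λ p r → p * p + + 11 * (r * r)) p≡ e)
                  (trans (cong₂ (λ x y → x + + 11 * y) (square-neg p) (square-neg r)) eq)) , inj₂
                  (pair≡ p≡ e)
        where
        p≡ : + 4 * (l + + 2 * - t) + + 1 ≡ - p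
        p≡ = linear₂ (+ 1) (+ 1) (+ 1) h e (ring l t p r)
          where
          ring : ∀ l t p r → + 1 * (+ 4 * (l + + 2 * - t) + + 1) + (+ 1 * (+ 8 * t) + + 1 * - r) ≡
              + 1 * - p + (+ 1 * (p - r) + + 1 * (+ 4 * l + + 1))
          ring = solve-∀

    lattice-form : Parity (ℤ± 5) (λ y → form y ≡ N) ((q PowerSeries.* dilate 2 Pₛ) m)
    lattice-form = subst (Parity (ℤ± 5) (λ y → form y ≡ N))
      (parity-unique (ℤ± 2) (step₃ (step₂ (step₁ (proj₂ finite)))) residual) (proj₂ finite)

    -- The columns of φ are the rotations of (1, 1, -1, 0, 0), which lie in the lattice as 1 + 4 - 5
    -- = 0. They are taken two steps at a time, so that neighbours on the pentagon have inner
    -- product -1 and the others 0; hence the norm becomes `form`.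
    on-lattice : Parity (ℤ± 5) (λ z → norm z ≡ N × Residue 0 z) ((q PowerSeries.* dilate 2 Pₛ) m)
    on-lattice = parity-image (ℤ± 5) (ℤ± 5) φ
      (λ { (inj₁ refl) → inj₁ refl ; {_} {y} (inj₂ refl) → inj₂ (φ-neg y) })
      (λ { {y@(a ∷ b ∷ c ∷ d ∷ e ∷ [])} eq → trans (norm-φ y) eq , d , dot-φ a b c d e })
      (λ { {y} {y′} _ _ (inj₁ eq) → inj₁ (φ-injective y y′ eq)
         ; {y} {y′} _ _ (inj₂ eq) → inj₂ (φ-injective y (neg y′) (trans eq (sym (φ-neg y′)))) })
      (λ { {z ∷ w ∷ x ∷ y ∷ u ∷ []} (eq , r , h) → surjective z w x y u r eq h }) lattice-form
      where
      φ : Vec ℤ 5 → Vec ℤ 5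
      φ (a ∷ b ∷ c ∷ d ∷ e ∷ []) = a + c - e ∷ d + a - c ∷ b + d - a ∷ e + b - d ∷ c + e - b ∷ []
      φ-neg : ∀ y → φ (neg y) ≡ neg (φ y)
      φ-neg (a ∷ b ∷ c ∷ d ∷ e ∷ []) = quint≡ (ring a c e) (ring d a c) (ring b d a) (ring e b d)
          (ring c e b)
        where
        ring : ∀ a b c → - a + - b - - c ≡ - (a + b - c)
        ring = solve-∀
      norm-φ : ∀ y → norm (φ y) ≡ form y
      norm-φ (a ∷ b ∷ c ∷ d ∷ e ∷ []) = ring a b c d e
        where
        ring : ∀ a b c d e → (a + c - e) * (a + c - e) + ((d + a - c) *
            (d + a - c) + ((b + d - a) * (b + d - a) + ((e + b - d) *
            (e + b - d) + ((c + e - b) * (c + e - b) + + 0)))) ≡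
               a * a + (b * b + (c * c + (d * d + (e * e +
                 ((a - b) * (a - b) + ((b - c) * (b - c) + ((c - d) *
                     (c - d) + ((d - e) * (d - e) + (e - a) * (e - a)))))))))
        ring = solve-∀
      dot-φ : ∀ a b c d e → (a + c - e) + + 4 * (d + a - c) + + 5 * (b + d - a) - + 2 * (e + b - d) + + 3 *
          (c + e - b) ≡ d * + 11 + + 0
      dot-φ = solve-∀
      φ-injective : ∀ y y′ → φ y ≡ φ y′ → y ≡ y′
      φ-injective y@(a ∷ b ∷ c ∷ d ∷ e ∷ []) y′@(a′ ∷ b′ ∷ c′ ∷ d′ ∷ e′ ∷ []) eq = quint≡
        -- The rows are the rotations of v: by `dot-φ` v itself yields 11 d, and each rotation
        -- yields 11 times another coordinate.
        (recover (E-row (+ 4) (+ 5) (- + 2) (+ 3) (+ 1)) (r₀ a b c d e) (r₀ a′ b′ c′ d′ e′))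
        (recover (E-row (+ 3) (+ 1) (+ 4) (+ 5) (- + 2)) (r₁ a b c d e) (r₁ a′ b′ c′ d′ e′))
        (recover (E-row (+ 5) (- + 2) (+ 3) (+ 1) (+ 4)) (r₂ a b c d e) (r₂ a′ b′ c′ d′ e′))
        (recover (E-row (+ 1) (+ 4) (+ 5) (- + 2) (+ 3)) (r₃ a b c d e) (r₃ a′ b′ c′ d′ e′))
        (recover (E-row (- + 2) (+ 3) (+ 1) (+ 4) (+ 5)) (r₄ a b c d e) (r₄ a′ b′ c′ d′ e′))
        where
        recover : ∀ (g : Vec ℤ 5 → ℤ) {x x′} → g (φ y) ≡ + 11 * x → g (φ y′) ≡ + 11 * x′ → x ≡ x′
        recover g h h′ = ℤ.*-cancelˡ-≡ (+ 11) _ _ (trans (sym h) (trans (cong g eq) h′))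
        r₀ : ∀ a b c d e → + 4 * (a + c - e) + + 5 * (d + a - c) + - + 2 * (b + d - a) + + 3 *
            (e + b - d) + + 1 * (c + e - b) ≡ + 11 * a
        r₀ = solve-∀
        r₁ : ∀ a b c d e → + 3 * (a + c - e) + + 1 * (d + a - c) + + 4 * (b + d - a) + + 5 *
            (e + b - d) + - + 2 * (c + e - b) ≡ + 11 * b
        r₁ = solve-∀
        r₂ : ∀ a b c d e → + 5 * (a + c - e) + - + 2 * (d + a - c) + + 3 * (b + d - a) + + 1 *
            (e + b - d) + + 4 * (c + e - b) ≡ + 11 * c
        r₂ = solve-∀
        r₃ : ∀ a b c d e → + 1 * (a + c - e) + + 4 * (d + a - c) + + 5 * (b + d - a) + - + 2 *
            (e + b - d) + + 3 * (c + e - b) ≡ + 11 * d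
        r₃ = solve-∀
        r₄ : ∀ a b c d e → - + 2 * (a + c - e) + + 3 * (d + a - c) + + 1 * (b + d - a) + + 4 *
            (e + b - d) + + 5 * (c + e - b) ≡ + 11 * e
        r₄ = solve-∀
      surjective : ∀ z w x y u r → norm (z ∷ w ∷ x ∷ y ∷ u ∷ []) ≡ N → dot (z ∷ w ∷ x ∷ y ∷ u ∷ []) ≡
          r * + 11 + + 0 →
                   ∃ λ v → form v ≡ N × (φ v ≡ (z ∷ w ∷ x ∷ y ∷ u ∷ []) ⊎ φ v ≡ neg
                       (z ∷ w ∷ x ∷ y ∷ u ∷ []))
      surjective z w x y u r eq h = v , trans (sym (norm-φ v)) (trans (cong norm φv) eq) , inj₁ φv
        where
        -- The inverse of φ, given by the rotations of v divided by 11, after the first coordinate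
        -- of the target is eliminated through its residue; the entry for d is `r`.
        v : Vec ℤ 5
        v = + 4 * r - w - + 2 * x + y - u ∷ + 3 * r - w - x + y - u ∷ + 5 * r - + 2 * w - + 2 * x + y - u ∷
            r ∷ - + 2 * r + w + x + u ∷ []
        q₀ : ∀ z w x y u r → + 1 * (+ 4 * r - w - + 2 * x + y - u + (+ 5 * r - + 2 * w - + 2 * x + y - u)
            - (- + 2 * r + w + x + u)) + + 1 * (z + + 4 * w + + 5 * x - + 2 * y + + 3 * u) ≡
             + 1 * z + + 1 * (r * + 11 + + 0)
        q₀ = solve-∀
        q₁ : ∀ w x y u r → r + (+ 4 * r - w - + 2 * x + y - u) - (+ 5 * r - + 2 * w - + 2 * x + y - u) ≡ w
        q₁ = solve-∀
        q₂ : ∀ w x y u r → + 3 * r - w - x + y - u + r - (+ 4 * r - w - + 2 * x + y - u) ≡ x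
        q₂ = solve-∀
        q₃ : ∀ w x y u r → - + 2 * r + w + x + u + (+ 3 * r - w - x + y - u) - r ≡ y
        q₃ = solve-∀
        q₄ : ∀ w x y u r → + 5 * r - + 2 * w - + 2 * x + y - u + (- + 2 * r + w + x + u)
            - (+ 3 * r - w - x + y - u) ≡ u
        q₄ = solve-∀
        φv : φ v ≡ (z ∷ w ∷ x ∷ y ∷ u ∷ [])
        φv = quint≡ (linear (+ 1) (+ 1) (sym h) (q₀ z w x y u r)) (q₁ w x y u r) (q₂ w x y u r)
            (q₃ w x y u r) (q₄ w x y u r)

    slice-Θ₅-at : slice 22 6 Θ₅ m ≡ (q PowerSeries.* dilate 2 Pₛ) m xor ψ₄ m
    slice-Θ₅-at = cancel (ψ₄ m) ((q PowerSeries.* dilate 2 Pₛ) m) (slice 22 6 Θ₅ m)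
        (parity-unique (ℤ± 5) cubic (parity-⊎ (ℤ± 5) on-lattice (off-lattice N neighbour)
      proj₁ proj₁ (λ {z} → split z) (λ { {z} {z′} (_ , r) (_ , nr) (inj₁ refl) → nr r ; {z} {z′} (_ , r)
          (_ , nr) (inj₂ refl) → nr (un-neg z′ r) })))
      where
      cancel : ∀ a b c → a ≡ b xor c → c ≡ b xor a
      cancel a b c refl = trans (cong (_xor c) (sym (xor-same b))) (xor-assoc b b c)
      un-neg : ∀ z → Residue 0 (neg z) → Residue 0 z
      un-neg z (k , h) = - k , linear (+ 1) (- + 1) (trans (sym (dot-neg z)) h) (ring (dot z) k)
        where
        ring : ∀ d k → + 1 * d + - + 1 * (k * + 11 + + 0) ≡ + 1 * (- k * + 11 + + 0) + - + 1 * - d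
        ring = solve-∀
      split : ∀ z → norm z ≡ N → norm z ≡ N × Residue 0 z ⊎ norm z ≡ N × ¬ Residue 0 z
      split z eq with residue 11 (dot z)
      ... | zero , k , h = inj₁ (eq , k , h)
      ... | suc r , k , h = inj₂ (eq , λ (l , h′) → nonzero r
          (residue-0 (k - l) (linear (+ 1) (+ 1) (trans (sym h) h′) (ring k l (+ suc (toℕ r))))))
        where
        nonzero : ∀ r → ¬ 11 ℕ.∣ suc (toℕ {10} r)
        nonzero r d = ℕ.<⇒≱ (s≤s (Fin.toℕ<n r)) (ℕ.∣⇒≤ d)
        ring : ∀ k l c → + 1 * ((k - l) * + 11 + c) + + 1 * (l * + 11 + + 0) ≡ + 1 * + 0 + + 1 *
            (k * + 11 + c)
        ring = solve-∀

-- Dissection of the modular equation and the identity f₁₁ H = O.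

module Congruence where

  open import Data.Integer.Tactic.RingSolver using (solve-∀)
  import Data.Nat.Tactic.RingSolver as ℕ-Solver
  open PowerSeries
  open Parities
  open Lattice
  open ≈-Reasoning

  g E O H : Series
  g = f * f₁₁
  E = ev g
  O = od g
  H = slice 22 6 b

  g-dissect : g ≈ E * E + q * (O * O)
  g-dissect = dissect g

  f₁₁-cube : dilate 11 ψ ≈ f₁₁ * f₁₁ * f₁₁
  f₁₁-cube = begin
    dilate 11 ψ                ≈⟨ dilate-cong 11 ψ-cube ⟩
    dilate 11 (f * f * f)      ≈⟨ dilate-* 10 (f * f) f ⟩
    dilate 11 (f * f) * f₁₁    ≈⟨ *-congʳ (dilate-* 10 f f) ⟩
    f₁₁ * f₁₁ * f₁₁ ∎

  ψψ-cube : ψ * dilate 11 ψ ≈ g * g * g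
  ψψ-cube = begin
    ψ * dilate 11 ψ                    ≈⟨ *-cong ψ-cube f₁₁-cube ⟩
    f * f * f * (f₁₁ * f₁₁ * f₁₁)      ≈⟨ solve 2 (λ f e → f :* f :* f :* (e :* e :* e) := f :* e :*
        (f :* e) :* (f :* e)) ≈-refl f f₁₁ ⟩
    g * g * g ∎

  g³-dissect : g * g * g ≈ (g * E) * (g * E) + q * ((g * O) * (g * O))
  g³-dissect = begin
    g * g * g                          ≈⟨ *-congˡ g-dissect ⟩
    g * g * (E * E + q * (O * O))      ≈⟨ solve 4 (λ g E O q → g :* g :* (E :* E :+ q :* (O :* O)) :=
                                            (g :* E) :* (g :* E) :+ q :* ((g :* O) :*
                                                (g :* O))) ≈-refl g E O q ⟩
    (g * E) * (g * E) + q * ((g * O) * (g * O)) ∎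

  ev-ψψ : ev (ψ * dilate 11 ψ) ≈ g * E
  ev-ψψ = begin
    ev (ψ * dilate 11 ψ)                                    ≈⟨ ev-cong (≈-trans ψψ-cube g³-dissect) ⟩
    ev ((g * E) * (g * E) + q * ((g * O) * (g * O)))        ≈⟨ ev-dissect (g * E) (g * O) ⟩
    g * E ∎

  f⁶ f₁₁⁶ : Series
  f⁶ = f * f * f * (f * f * f)
  f₁₁⁶ = f₁₁ * f₁₁ * f₁₁ * (f₁₁ * f₁₁ * f₁₁)

  ψ₄-square : ψ₄ ≈ f⁶ * f⁶
  ψ₄-square = begin
    dilate 2 (dilate 2 ψ)        ≈⟨ frobenius (dilate 2 ψ) ⟨
    dilate 2 ψ * dilate 2 ψ      ≈⟨ *-cong (frobenius ψ) (frobenius ψ) ⟨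
    ψ * ψ * (ψ * ψ)              ≈⟨ *-cong (*-cong ψ-cube ψ-cube) (*-cong ψ-cube ψ-cube) ⟩
    f⁶ * f⁶ ∎

  ψ₄-dilate : X 5 * dilate 11 ψ₄ ≈ q * ((q * q * f₁₁⁶) * (q * q * f₁₁⁶))
  ψ₄-dilate = begin
    X 5 * dilate 11 ψ₄
      ≈⟨ *-cong (≈-trans (X-+ 1 4) (*-congˡ (≈-trans (X-+ 2 2) (*-cong (X-+ 1 1) (X-+ 1 1)))))
           (≈-trans (dilate-cong 11 ψ₄-square) (≈-trans (dilate-* 10 f⁶ f⁶) (*-cong dilate-f⁶ dilate-f⁶))) ⟩
    q * ((q * q) * (q * q)) * (f₁₁⁶ * f₁₁⁶)
      ≈⟨ solve 2 (λ q e → q :* ((q :* q) :* (q :* q)) :* (e :* e) := q :*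
          ((q :* q :* e) :* (q :* q :* e))) ≈-refl q f₁₁⁶ ⟩
    q * ((q * q * f₁₁⁶) * (q * q * f₁₁⁶)) ∎
    where
    dilate-f³ : dilate 11 (f * f * f) ≈ f₁₁ * f₁₁ * f₁₁
    dilate-f³ = ≈-trans (dilate-* 10 (f * f) f) (*-congʳ (dilate-* 10 f f))
    dilate-f⁶ : dilate 11 f⁶ ≈ f₁₁⁶
    dilate-f⁶ = ≈-trans (dilate-* 10 (f * f * f) (f * f * f)) (*-cong dilate-f³ dilate-f³)

  modular-equation : g ≈ q * (g * g * g) + (f⁶ * f⁶ + q * ((q * q * f₁₁⁶) * (q * q * f₁₁⁶)))
  modular-equation = begin
    g
      ≈⟨ mk (λ j → Binary.modular-equation-at j) ⟩
    q * (ψ * dilate 11 ψ) + (ψ₄ + X 5 * dilate 11 ψ₄)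
      ≈⟨ +-cong {q * (ψ * dilate 11 ψ)} {b = ψ₄ + X 5 * dilate 11 ψ₄} (*-congˡ ψψ-cube)
           (+-cong {ψ₄} {b = X 5 * dilate 11 ψ₄} ψ₄-square ψ₄-dilate) ⟩
    q * (g * g * g) + (f⁶ * f⁶ + q * ((q * q * f₁₁⁶) * (q * q * f₁₁⁶))) ∎

  -- The factor q exchanges the two parts in the dissection of g³, and f¹² and q⁵ f₁₁¹² are a square
  -- and q times a square. So the modular equation is a second dissection of g, and uniqueness turns
  -- it into relations linear in E and O.
  g-dissect′ : g ≈ (f⁶ + q * (g * O)) * (f⁶ + q * (g * O)) + q *
      ((g * E + q * q * f₁₁⁶) * (g * E + q * q * f₁₁⁶))
  g-dissect′ = begin
    g
      ≈⟨ modular-equation ⟩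
    q * (g * g * g) + (f⁶ * f⁶ + q * (e * e))
      ≈⟨ +-cong {q * (g * g * g)} {b = f⁶ * f⁶ + q * (e * e)} (*-congˡ g³-dissect) ≈-refl ⟩
    q * ((g * E) * (g * E) + q * ((g * O) * (g * O))) + (f⁶ * f⁶ + q * (e * e))
      ≈⟨ solve 5 (λ q x y z e → q :* (x :* x :+ q :* (y :* y)) :+ (z :* z :+ q :* (e :* e)) :=
           (z :+ q :* y) :* (z :+ q :* y) :+ q :* ((x :+ e) :* (x :+ e))) ≈-refl q (g * E) (g * O) f⁶ e ⟩
    (f⁶ + q * (g * O)) * (f⁶ + q * (g * O)) + q * ((g * E + e) * (g * E + e)) ∎
    where
    e = q * q * f₁₁⁶

  E-relation : E ≈ f⁶ + q * (g * O)
  E-relation = ≈-trans (ev-cong g-dissect′) (ev-dissect (f⁶ + q * (g * O)) (g * E + q * q * f₁₁⁶))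

  O-relation : O ≈ g * E + q * q * f₁₁⁶
  O-relation = ≈-trans (od-cong g-dissect′) (od-dissect (f⁶ + q * (g * O)) (g * E + q * q * f₁₁⁶))

  -- The determinant of the system E + q g O = f⁶, g E + O = q² f₁₁⁶.
  u : Series
  u = 1# + q * (g * g)

  O-u : O * u ≈ g * f⁶ + q * q * f₁₁⁶
  O-u = begin
    O * u
      ≈⟨ solve 3 (λ O q g → O :* (con true :+ q :* (g :* g)) := O :+ q :* (g :* g) :* O) ≈-refl O q g ⟩
    O + q * (g * g) * O
      ≈⟨ +-cong {O} {b = q * (g * g) * O} (≈-trans O-relation
          (+-cong {g * E} (*-congˡ E-relation) ≈-refl)) ≈-refl ⟩
    (g * (f⁶ + q * (g * O)) + q * q * f₁₁⁶) + q * (g * g) * O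
      ≈⟨ solve 5 (λ g z q O e → (g :* (z :+ q :* (g :* O)) :+ q :* q :* e) :+ q :*
          (g :* g) :* O := g :* z :+ q :* q :* e) ≈-refl g f⁶ q O f₁₁⁶ ⟩
    g * f⁶ + q * q * f₁₁⁶ ∎

  -- Squaring the relation for E brings in q² g² O², which combines with q g² E² to q g² (E² + q O²)
  -- = q g³. Thus O disappears, and only E² is needed in `f⁵-O`.
  E²-u : E * E * u ≈ f⁶ * f⁶ + q * (g * g * g)
  E²-u = begin
    E * E * u
      ≈⟨ solve 3 (λ E q g → E :* E :* (con true :+ q :* (g :* g)) := E :* E :+ q :* (g :* g) :*
          (E :* E)) ≈-refl E q g ⟩
    E * E + q * (g * g) * (E * E)
      ≈⟨ +-cong {E * E} {b = q * (g * g) * (E * E)} (*-cong E-relation E-relation) ≈-refl ⟩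
    (f⁶ + q * (g * O)) * (f⁶ + q * (g * O)) + q * (g * g) * (E * E)
      ≈⟨ solve 5 (λ z q g O E → (z :+ q :* (g :* O)) :* (z :+ q :* (g :* O)) :+ q :* (g :* g) :* (E :* E) :=
           z :* z :+ q :* (g :* g :* (E :* E :+ q :* (O :* O)))) ≈-refl f⁶ q g O E ⟩
    f⁶ * f⁶ + q * (g * g * (E * E + q * (O * O)))
      ≈⟨ +-cong {f⁶ * f⁶} ≈-refl (*-congˡ (*-congˡ g-dissect)) ⟨
    f⁶ * f⁶ + q * (g * g * g) ∎

  f⁵ : Series
  f⁵ = f * (f * (f * (f * f)))

  -- Multiplication by u removes E and O: both sides become f₁₁ f¹² + q² f⁵ f₁₁⁶.
  f⁵-O : f⁵ * O ≈ f₁₁ * (q * ((g * E) * (g * E)) + f⁶ * f⁶)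
  f⁵-O = *-cancelʳ u refl (begin
    f⁵ * O * u
      ≈⟨ ≈-trans (*-assoc f⁵ O u) (*-congˡ O-u) ⟩
    f⁵ * (g * f⁶ + q * q * f₁₁⁶)
      ≈⟨ solve 3 (λ f e q →
           let g = f :* e ; z = f :* f :* f :* (f :* f :* f) ; y = e :* e :* e :* (e :* e :* e) in
           f :* (f :* (f :* (f :* f))) :* (g :* z :+ q :* q :* y) :=
           e :* (z :* z :* (con true :+ q :* (g :* g)) :+ q :* (g :* g) :*
               (z :* z :+ q :* (g :* g :* g)))) ≈-refl f f₁₁ q ⟩
    f₁₁ * (f⁶ * f⁶ * u + q * (g * g) * (f⁶ * f⁶ + q * (g * g * g)))
      ≈⟨ *-congˡ (+-cong {f⁶ * f⁶ * u} ≈-refl (*-congˡ E²-u)) ⟨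
    f₁₁ * (f⁶ * f⁶ * u + q * (g * g) * (E * E * u))
      ≈⟨ solve 6 (λ e z q g E u → e :* (z :* z :* u :+ q :* (g :* g) :* (E :* E :* u)) :=
           e :* (q :* ((g :* E) :* (g :* E)) :+ z :* z) :* u) ≈-refl f₁₁ f⁶ q g E u ⟩
    f₁₁ * (q * ((g * E) * (g * E)) + f⁶ * f⁶) * u ∎)

  -- f₁₁² = f₁₁(q²) = f(q²²). Splitting 22 n + 6 as 2 (11 n + 3) lets the factor pass through one
  -- slice modulo 2 and one modulo 11.
  slice-f₂₂ : ∀ a → slice 22 6 (f₁₁ * f₁₁ * a) ≈ f * slice 22 6 a
  slice-f₂₂ a = begin
    slice 22 6 (f₁₁ * f₁₁ * a)
      ≈⟨ slice-slice (f₁₁ * f₁₁ * a) ⟩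
    slice 11 3 (ev (f₁₁ * f₁₁ * a))
      ≈⟨ slice-cong 11 3 (≈-trans (ev-cong (*-congʳ (frobenius f₁₁))) (slice-dilate-* 1 0 z<s f₁₁ a)) ⟩
    slice 11 3 (f₁₁ * ev a)
      ≈⟨ slice-dilate-* 10 3 (s≤s (s≤s (s≤s (s≤s z≤n)))) f (ev a) ⟩
    f * slice 11 3 (ev a)
      ≈⟨ *-congˡ (slice-slice a) ⟨
    f * slice 22 6 a ∎
    where
    slice-slice : ∀ a → slice 22 6 a ≈ slice 11 3 (ev a)
    slice-slice a = mk λ n → cong a (ring n)
      where
      ring : ∀ n → n ℕ.* 22 ℕ.+ 6 ≡ (n ℕ.* 11 ℕ.+ 3) ℕ.* 2 ℕ.+ 0
      ring = ℕ-Solver.solve-∀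

  f⁵-H : f⁵ * H ≈ q * ((g * E) * (g * E)) + f⁶ * f⁶
  f⁵-H = begin
    f⁵ * H
      ≈⟨ solve 2 (λ f h → f :* (f :* (f :* (f :* f))) :* h := f :*
          (f :* (f :* (f :* (f :* h))))) ≈-refl f H ⟩
    f * (f * (f * (f * (f * H))))
      ≈⟨ *-congˡ (*-congˡ (*-congˡ (*-congˡ (slice-f₂₂ b)))) ⟨
    f * (f * (f * (f * slice 22 6 (s * b))))
      ≈⟨ *-congˡ (*-congˡ (*-congˡ (slice-f₂₂ (s * b)))) ⟨
    f * (f * (f * slice 22 6 (s * (s * b))))
      ≈⟨ *-congˡ (*-congˡ (slice-f₂₂ (s * (s * b)))) ⟨
    f * (f * slice 22 6 (s * (s * (s * b))))
      ≈⟨ *-congˡ (slice-f₂₂ (s * (s * (s * b)))) ⟨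
    f * slice 22 6 (s * (s * (s * (s * b))))
      ≈⟨ slice-f₂₂ (s * (s * (s * (s * b)))) ⟨
    slice 22 6 (s * (s * (s * (s * (s * b)))))
      ≈⟨ slice-cong 22 6 (≈-trans (solve 2 (λ s b → s :* (s :* (s :* (s :* (s :* b)))) := b :*
          (s :* (s :* (s :* (s :* s))))) ≈-refl s b) b-Θ₅) ⟩
    slice 22 6 Θ₅
      ≈⟨ mk (λ m → Residual.slice-Θ₅-at m) ⟩
    q * dilate 2 (ev (ψ * dilate 11 ψ)) + ψ₄
      ≈⟨ +-cong {q * dilate 2 (ev (ψ * dilate 11 ψ))} {b = ψ₄}
           (*-congˡ (≈-trans (dilate-cong 2 ev-ψψ) (≈-sym (frobenius (g * E))))) ψ₄-square ⟩
    q * ((g * E) * (g * E)) + f⁶ * f⁶ ∎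
    where
    s = f₁₁ * f₁₁

  H-O : f₁₁ * H ≈ O
  H-O = *-cancelʳ f⁵ refl (begin
    f₁₁ * H * f⁵
      ≈⟨ solve 3 (λ e h z → e :* h :* z := e :* (z :* h)) ≈-refl f₁₁ H f⁵ ⟩
    f₁₁ * (f⁵ * H)
      ≈⟨ *-congˡ f⁵-H ⟩
    f₁₁ * (q * ((g * E) * (g * E)) + f⁶ * f⁶)
      ≈⟨ f⁵-O ⟨
    f⁵ * O
      ≈⟨ *-comm f⁵ O ⟩
    O * f⁵ ∎)

  -- Nonsquares modulo 11 and the five progressions.

  NonSquare : ℕ → Set
  NonSquare c = ∀ (r : Fin 11) → ¬ 11 ℕ.∣ 3 ℕ.* (toℕ r ℕ.* toℕ r) ℕ.+ toℕ r ℕ.+ 10 ℕ.* (4 ℕ.* c ℕ.+ 2)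

  -- Modulo 11 the pentagonal number of l drops out and 3 κ² + κ = 4 c + 2 remains. Times 12 plus 1
  -- this is (6 κ + 1)² = 4 c + 3, so `NonSquare` says that 4 c + 3 is not a square.
  O-vanishes : ∀ c → NonSquare c → ∀ n → O (n ℕ.* 11 ℕ.+ c) ≡ false
  O-vanishes c nonsquare n = Counting.parity-unique ℤ²ₛ (counts-g j)
      (Counting.parity-∅ ℤ²ₛ λ { {κ , l} → impossible κ l })
    where
    -- The coefficient of O at k is the coefficient of g at 2 k + 1.
    j = (n ℕ.* 11 ℕ.+ c) ℕ.* 2 ℕ.+ 1
    impossible : ∀ κ l → ¬ weight 2 1 κ ℕ.+ weight 2 1 l ℕ.* 11 ≡ j
    impossible κ l eq with residue 11 κ
    ... | r , t , refl = nonsquare r (residue-0 s (trans (cong (λ z → s ℤ.* + 11 ℤ.+ z) (cast (toℕ r) c))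
            (linear (+ 1) (+ 1) (trans (weights⇒ 2 1 2 1 κ′ l eq) (cong (λ z → + 2 ℤ.* z) cast-j))
                (ring t l (+ toℕ r) (+ n) (+ c)))))
      where
      κ′ s : ℤ
      κ′ = t ℤ.* + 11 ℤ.+ + toℕ r
      -- The quotient by 11. Writing 10 (4 c + 2) in place of - (4 c + 2) adds 11 (4 c + 2), which -
      -- 4 c - 2 takes back.
      s = + 3 ℤ.* (l ℤ.* l) ℤ.+ l ℤ.+ + 33 ℤ.* (t ℤ.* t) ℤ.+ + 6 ℤ.*
          (t ℤ.* + toℕ r) ℤ.+ t ℤ.- + 4 ℤ.* + n ℤ.- + 4 ℤ.* + c ℤ.- + 2
      cast : ∀ r c → + (3 ℕ.* (r ℕ.* r) ℕ.+ r ℕ.+ 10 ℕ.* (4 ℕ.* c ℕ.+ 2)) ≡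
             + 3 ℤ.* (+ r ℤ.* + r) ℤ.+ + r ℤ.+ + 10 ℤ.* (+ 4 ℤ.* + c ℤ.+ + 2)
      cast r c = trans (ℤ.pos-+ (3 ℕ.* (r ℕ.* r) ℕ.+ r) _) (cong₂ ℤ._+_
        (trans (ℤ.pos-+ (3 ℕ.* (r ℕ.* r)) r) (cong (ℤ._+ + r)
            (trans (ℤ.pos-* 3 (r ℕ.* r)) (cong (+ 3 ℤ.*_) (ℤ.pos-* r r)))))
        (trans (ℤ.pos-* 10 (4 ℕ.* c ℕ.+ 2)) (cong (+ 10 ℤ.*_)
            (trans (ℤ.pos-+ (4 ℕ.* c) 2) (cong (ℤ._+ + 2) (ℤ.pos-* 4 c))))))
      cast-j : + j ≡ (+ n ℤ.* + 11 ℤ.+ + c) ℤ.* + 2 ℤ.+ + 1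
      cast-j = trans (ℤ.pos-+ ((n ℕ.* 11 ℕ.+ c) ℕ.* 2) 1)
          (cong (ℤ._+ + 1) (trans (ℤ.pos-* (n ℕ.* 11 ℕ.+ c) 2)
        (cong (ℤ._* + 2) (trans (ℤ.pos-+ (n ℕ.* 11) c) (cong (ℤ._+ + c) (ℤ.pos-* n 11))))))
      ring : ∀ t l r n c → let κ = t ℤ.* + 11 ℤ.+ r in
        + 1 ℤ.* ((+ 3 ℤ.* (l ℤ.* l) ℤ.+ l ℤ.+ + 33 ℤ.* (t ℤ.* t) ℤ.+ + 6 ℤ.*
            (t ℤ.* r) ℤ.+ t ℤ.- + 4 ℤ.* n ℤ.- + 4 ℤ.* c ℤ.- + 2) ℤ.* + 11
          ℤ.+ (+ 3 ℤ.* (r ℤ.* r) ℤ.+ r ℤ.+ + 10 ℤ.* (+ 4 ℤ.* c ℤ.+ + 2)))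
          ℤ.+ + 1 ℤ.* (+ 2 ℤ.* ((n ℤ.* + 11 ℤ.+ c) ℤ.* + 2 ℤ.+ + 1)) ≡
        + 1 ℤ.* + 0 ℤ.+ + 1 ℤ.* ((+ 2 ℤ.* (κ ℤ.* (κ ℤ.+ + 1)) ℤ.+ + 1 ℤ.* (κ ℤ.* (κ ℤ.- + 1)))
          ℤ.+ (+ 2 ℤ.* (l ℤ.* (l ℤ.+ + 1)) ℤ.+ + 1 ℤ.* (l ℤ.* (l ℤ.- + 1))) ℤ.* + 11)
      ring = solve-∀

  H-vanishes : ∀ c → c ℕ.< 11 → NonSquare c → slice 11 c H ≈ 0#
  H-vanishes c c<11 nonsquare = *-cancelʳ f refl (begin
    slice 11 c H * f           ≈⟨ *-comm (slice 11 c H) f ⟩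
    f * slice 11 c H           ≈⟨ slice-dilate-* 10 c c<11 f H ⟨
    slice 11 c (f₁₁ * H)       ≈⟨ slice-cong 11 c H-O ⟩
    slice 11 c O               ≈⟨ mk (λ n → trans (O-vanishes c nonsquare n) (sym (0#-at n))) ⟩
    0#                         ≈⟨ zeroˡ f ⟨
    0# * f ∎)

  even-at : ∀ c → c ℕ.< 11 → NonSquare c → ∀ n → 2 ℕ.∣ b₁₁ (242 ℕ.* n ℕ.+ (22 ℕ.* c ℕ.+ 6))
  even-at c c<11 nonsquare n = subst (λ k → 2 ℕ.∣ b₁₁ k) (ring n c)
    (even⇒2∣ (b₁₁ ((n ℕ.* 11 ℕ.+ c) ℕ.* 22 ℕ.+ 6)) (trans (at (H-vanishes c c<11 nonsquare) n) (0#-at n)))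
    where
    ring : ∀ n c → (n ℕ.* 11 ℕ.+ c) ℕ.* 22 ℕ.+ 6 ≡ 242 ℕ.* n ℕ.+ (22 ℕ.* c ℕ.+ 6)
    ring = ℕ-Solver.solve-∀

  nonSquare? : ∀ c → Dec (NonSquare c)
  nonSquare? c = Fin.all? λ r → ¬? (11 ℕ.∣? (3 ℕ.* (toℕ r ℕ.* toℕ r) ℕ.+ toℕ r ℕ.+ 10 ℕ.* (4 ℕ.* c ℕ.+ 2)))

open Congruence using (even-at; nonSquare?)
open import Data.Nat using (_+_; _*_)
open import Data.Nat.Divisibility using (_∣_)
open import Data.List.Membership.Propositional using (_∈_)

theorem3 : ∀ (n B : ℕ) → B ∈ (28 ∷ 94 ∷ 182 ∷ 204 ∷ 226 ∷ []) → 2 ∣ b₁₁ (242 * n + B)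
-- B = 22 c + 6, where c = 1, 4, 8, 9, 10 are the classes with 4 c + 3 a nonsquare modulo 11.
theorem3 n B (here refl) = even-at 1 (from-yes (1 ℕ.<? 11)) (from-yes (nonSquare? 1)) n
theorem3 n B (there (here refl)) = even-at 4 (from-yes (4 ℕ.<? 11)) (from-yes (nonSquare? 4)) n
theorem3 n B (there (there (here refl))) = even-at 8 (from-yes (8 ℕ.<? 11)) (from-yes (nonSquare? 8)) n
theorem3 n B (there (there (there (here refl)))) = even-at 9 (from-yes (9 ℕ.<? 11))
    (from-yes (nonSquare? 9)) n
theorem3 n B (there (there (there (there (here refl))))) = even-at 10 (from-yes (10 ℕ.<? 11))
    (from-yes (nonSquare? 10)) n
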